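{- Let $p$ be a fixed prime and let $(f_n)_{n\ge 1}$, $f_n:\{0,1\}^n\to\{0,1\}$, be a family of Boolean functions in $\mathrm{AC}^0[p]$. Then there is a constant $C>0$ (depending only on $p$ and the family) such that for every $n\ge1$ and every $\varepsilon\in(0,1)$, $$\overline{\deg}_\varepsilon(f_n)\le C(\log(n/\varepsilon))^{C}.$$
   Context: Logarithms are base 2. Let $\mathbb{T}=\mathbb{R}/\mathbb{Z}$. For $z\in\mathbb{T}$, $|z \bmod 1|$ denotes $|\iota(z)|$, where $\iota(z)$ is the unique representative of $z$ in $[-1/2,1/2)$. For $F:\{0,1\}^n\to\mathbb{T}$, $\|F \bmod 1\|_\infty=\max_{x\in\{0,1\}^n}|F(x)\bmod 1|$. A torus polynomial of degree (at most) $d$ is a function $P:\{0,1\}^n\to\mathbb{T}$ of the form $P(x)=\sum_{S\subseteq[n],|S|\le d}P_S\prod_{i\in S}x_i \bmod 1$ with $P_S\in\mathbb{R}$. For $f:\{0,1\}^n\to\{0,1\}$, the toroidal $\varepsilon$-approximation degree $\overline{\deg}_\varepsilon(f)$ is the minimal $d\ge0$ for which there is a torus polynomial $P$ of degree $d$ with $\|P-\tfrac{f}{2}\bmod 1\|_\infty\le\varepsilon$. A $\mathrm{MOD}_p$ gate outputs $1$ if and only if the sum of its (Boolean) inputs is congruent to a non-zero value modulo $p$. A family $(f_n)$ is in $\mathrm{AC}^0[p]$ if there are a constant $\ell$ and a polynomial $s$ such that each $f_n$ is computed by a Boolean circuit of depth at most $\ell$ and size at most $s(n)$ consisting of unbounded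 fan-in AND and OR gates, NOT gates, and unbounded fan-in $\mathrm{MOD}_p$ gates. -}

module Defs where

open import Data.Bool.Base using (Bool; true; false; not; if_then_else_)
open import Data.Empty using (⊥-elim)
open import Data.Fin.Base using (Fin)
open import Data.Fin.Subset using (Subset) renaming (∣_∣ to card)
open import Data.Integer.Base as ℤ using (ℤ; +_; -[1+_]; +[1+_]; +0)
import Data.Integer.Properties as ℤₚ
open import Data.List.Base using (List; []; _∷_; _++_; map; foldr; filter)
open import Data.Nat.Base as ℕ using (ℕ; zero; suc)
open import Data.Bool.ListAction using (and; or)
open import Data.Nat.ListAction using (sum)
import Data.Nat.Properties as ℕₚ
import Data.Nat.Coprimality as Coprimality
open import Data.Nat.Divisibility using (_∣?_)
open import Data.Product.Base using (Σ-syntax; ∃; ∃-syntax; _×_; _,_; proj₁; proj₂)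
open import Data.Rational.Base as ℚ using (ℚ; mkℚ; 0ℚ; 1ℚ; ½; ↥_; ↧ₙ_) hiding (module ℚ)
import Data.Rational.Properties as ℚₚ
open import Data.Sum.Base using (_⊎_; inj₁; inj₂)
open import Data.Vec.Base as Vec using (Vec; []; _∷_)
open import Function.Base using (_∘_)
open import Relation.Nullary using (¬_; yes; no; does)
open import Relation.Binary.PropositionalEquality
  using (_≡_; refl; sym; trans; cong; cong₂; subst; subst₂; module ≡-Reasoning)
open import Algebra.Bundles using (CommutativeRing)
open import Algebra.Definitions.RawSemiring ℚ.+-*-rawSemiring
  using () renaming (_^_ to _^ℚ_)
import Algebra.Properties.Semiring.Exp
       (CommutativeRing.semiring ℚₚ.+-*-commutativeRing) as Exp

ℤ→ℚ : ℤ → ℚ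
ℤ→ℚ k = mkℚ k 0 (Coprimality.sym (Coprimality.1-coprimeTo ℤ.∣ k ∣))

2ℚ : ℚ
2ℚ = ℤ→ℚ (+ 2)

2^_ : ℤ → ℚ
2^ (+ n)    = 2ℚ ^ℚ n
2^ -[1+ n ] = ½ ^ℚ suc n

cornerMin cornerMax : (a a′ b b′ : ℚ) → ℚ
cornerMin a a′ b b′ = ((a ℚ.* b) ℚ.⊓ (a ℚ.* b′)) ℚ.⊓ ((a′ ℚ.* b) ℚ.⊓ (a′ ℚ.* b′))
cornerMax a a′ b b′ = (a ℚ.* b ℚ.⊔ a ℚ.* b′) ℚ.⊔ (a′ ℚ.* b ℚ.⊔ a′ ℚ.* b′)

module RationalLemmas where

  open ℚ using (_≤_; _<_; _+_; _*_; _⊓_; _⊔_; *≤*; *<*)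

  0<1 : 0ℚ < 1ℚ
  0<1 = ℚₚ.positive⁻¹ 1ℚ

  0≤1 : 0ℚ ≤ 1ℚ
  0≤1 = ℚₚ.<⇒≤ 0<1

  1≤2 : 1ℚ ≤ 2ℚ
  1≤2 = *≤* (ℤ.+≤+ (ℕ.s≤s ℕ.z≤n))

  1<2 : 1ℚ < 2ℚ
  1<2 = *<* (ℤ.+<+ (ℕ.s≤s (ℕ.s≤s ℕ.z≤n)))

  0≤½ : 0ℚ ≤ ½
  0≤½ = ℚₚ.nonNegative⁻¹ ½

  ½≤1 : ½ ≤ 1ℚ
  ½≤1 = *≤* (ℤ.+≤+ (ℕ.s≤s ℕ.z≤n))

  *-monoˡ : ∀ {r p q} → 0ℚ ≤ r → p ≤ q → r * p ≤ r * q
  *-monoˡ {r} 0≤r = ℚₚ.*-monoˡ-≤-nonNeg r {{ℚ.nonNegative 0≤r}}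

  *-monoʳ : ∀ {r p q} → 0ℚ ≤ r → p ≤ q → p * r ≤ q * r
  *-monoʳ {r} 0≤r = ℚₚ.*-monoʳ-≤-nonNeg r {{ℚ.nonNegative 0≤r}}

  *-mono : ∀ {p q r s} → 0ℚ ≤ q → p ≤ q → 0ℚ ≤ r → r ≤ s → p * r ≤ q * s
  *-mono 0≤q p≤q 0≤r r≤s = ℚₚ.≤-trans (*-monoʳ 0≤r p≤q) (*-monoˡ 0≤q r≤s)

  *-mono-<ˡ : ∀ {r p q} → 0ℚ < r → p < q → r * p < r * q
  *-mono-<ˡ {r} 0<r = ℚₚ.*-monoʳ-<-pos r {{ℚ.positive 0<r}}

  *-mono-<ʳ : ∀ {r p q} → 0ℚ < r → p < q → p * r < q * r
  *-mono-<ʳ {r} 0<r = ℚₚ.*-monoˡ-<-pos r {{ℚ.positive 0<r}}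

  *-0≤ : ∀ {p q} → 0ℚ ≤ p → 0ℚ ≤ q → 0ℚ ≤ p * q
  *-0≤ {p} {q} 0≤p 0≤q = subst (_≤ p * q) (ℚₚ.*-zeroʳ p) (*-monoˡ 0≤p 0≤q)

  *-0< : ∀ {p q} → 0ℚ < p → 0ℚ < q → 0ℚ < p * q
  *-0< {p} {q} 0<p 0<q = subst (_< p * q) (ℚₚ.*-zeroʳ p) (*-mono-<ˡ 0<p 0<q)

  ^-0≤ : ∀ {p} n → 0ℚ ≤ p → 0ℚ ≤ p ^ℚ n
  ^-0≤ zero    _   = 0≤1
  ^-0≤ (suc n) 0≤p = *-0≤ 0≤p (^-0≤ n 0≤p)

  ^-0< : ∀ {p} n → 0ℚ < p → 0ℚ < p ^ℚ n
  ^-0< zero    _   = 0<1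
  ^-0< (suc n) 0<p = *-0< 0<p (^-0< n 0<p)

  ^-mono : ∀ {p q} n → 0ℚ ≤ p → p ≤ q → p ^ℚ n ≤ q ^ℚ n
  ^-mono zero    _   _   = ℚₚ.≤-refl
  ^-mono (suc n) 0≤p p≤q =
    *-mono (ℚₚ.≤-trans 0≤p p≤q) p≤q (^-0≤ n 0≤p) (^-mono n 0≤p p≤q)

  ^-mono-< : ∀ {p q} n → 0ℚ ≤ p → p < q → p ^ℚ suc n < q ^ℚ suc n
  ^-mono-< {p} {q} n 0≤p p<q = ℚₚ.≤-<-trans
    (*-monoˡ 0≤p (^-mono n 0≤p (ℚₚ.<⇒≤ p<q)))
    (*-mono-<ʳ (^-0< n (ℚₚ.≤-<-trans 0≤p p<q)) p<q)

  1≤^ : ∀ {p} n → 1ℚ ≤ p → 1ℚ ≤ p ^ℚ n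
  1≤^ zero    _   = ℚₚ.≤-refl
  1≤^ {p} (suc n) 1≤p =
    subst (_≤ p ^ℚ suc n) (ℚₚ.*-identityˡ 1ℚ) (*-mono (ℚₚ.≤-trans 0≤1 1≤p) 1≤p 0≤1 (1≤^ n 1≤p))

  ^≤1 : ∀ {p} n → 0ℚ ≤ p → p ≤ 1ℚ → p ^ℚ n ≤ 1ℚ
  ^≤1 zero    _   _   = ℚₚ.≤-refl
  ^≤1 {p} (suc n) 0≤p p≤1 =
    subst (p ^ℚ suc n ≤_) (ℚₚ.*-identityˡ 1ℚ) (*-mono 0≤1 p≤1 (^-0≤ n 0≤p) (^≤1 n 0≤p p≤1))

  ^-suc≤ : ∀ {p} n → 0ℚ ≤ p → p ≤ 1ℚ → p ^ℚ suc n ≤ p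
  ^-suc≤ {p} n 0≤p p≤1 =
    subst (p ^ℚ suc n ≤_) (ℚₚ.*-identityʳ p) (*-monoˡ 0≤p (^≤1 n 0≤p p≤1))

  2^-mono : ∀ {m n} → m ℕ.≤ n → 2ℚ ^ℚ m ≤ 2ℚ ^ℚ n
  2^-mono {n = n} ℕ.z≤n   = 1≤^ n 1≤2
  2^-mono (ℕ.s≤s m≤n) = *-monoˡ (ℚₚ.≤-trans 0≤1 1≤2) (2^-mono m≤n)

  2^-mono-< : ∀ {m n} → m ℕ.< n → 2ℚ ^ℚ m < 2ℚ ^ℚ n
  2^-mono-< {m} m<n = ℚₚ.<-≤-trans
    (subst (_< 2ℚ ^ℚ suc m) (ℚₚ.*-identityˡ (2ℚ ^ℚ m))
      (*-mono-<ʳ (^-0< m (ℚₚ.<-trans 0<1 1<2)) 1<2))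
    (2^-mono m<n)

  2^≤⇒≤ : ∀ a n → 2^ a ≤ 2ℚ ^ℚ n → a ℤ.≤ + n
  2^≤⇒≤ -[1+ _ ] _ _   = ℤ.-≤+
  2^≤⇒≤ (+ m)    n 2≤2 with m ℕₚ.≤? n
  ... | yes m≤n = ℤ.+≤+ m≤n
  ... | no  m≰n = ⊥-elim (ℚₚ.<-irrefl refl (ℚₚ.<-≤-trans (2^-mono-< (ℕₚ.≰⇒> m≰n)) 2≤2))

  ≤⇒2^≤ : ∀ a n → a ℤ.≤ + n → 2^ a ≤ 2ℚ ^ℚ n
  ≤⇒2^≤ -[1+ m ] n _              = ℚₚ.≤-trans (^≤1 (suc m) 0≤½ ½≤1) (1≤^ n 1≤2)
  ≤⇒2^≤ (+ m)    n (ℤ.+≤+ m≤n) = 2^-mono m≤n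

  ½^≤2^ : ∀ a → ½ ^ℚ suc ℤ.∣ a ∣ ≤ 2^ a
  ½^≤2^ (+ n)    = ℚₚ.≤-trans (^≤1 (suc n) 0≤½ ½≤1) (1≤^ n 1≤2)
  ½^≤2^ -[1+ n ] = ℚₚ.≤-trans (*-monoʳ (^-0≤ (suc n) 0≤½) ½≤1)
                     (ℚₚ.≤-reflexive (ℚₚ.*-identityˡ _))

  ℤ→ℚ-+ : ∀ a b → ℤ→ℚ a + ℤ→ℚ b ≡ ℤ→ℚ (a ℤ.+ b)
  ℤ→ℚ-+ a b = trans
    (cong (λ k → k ℚ./ 1) (cong₂ ℤ._+_ (ℤₚ.*-identityʳ a) (ℤₚ.*-identityʳ b)))
    (ℚₚ.↥p/↧p≡p (ℤ→ℚ (a ℤ.+ b)))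

  ℤ→ℚ-* : ∀ a b → ℤ→ℚ a * ℤ→ℚ b ≡ ℤ→ℚ (a ℤ.* b)
  ℤ→ℚ-* a b = ℚₚ.↥p/↧p≡p (ℤ→ℚ (a ℤ.* b))

  ℤ→ℚ-mono : ∀ {a b} → a ℤ.≤ b → ℤ→ℚ a ≤ ℤ→ℚ b
  ℤ→ℚ-mono {a} {b} a≤b =
    *≤* (subst₂ ℤ._≤_ (sym (ℤₚ.*-identityʳ a)) (sym (ℤₚ.*-identityʳ b)) a≤b)

  n≤2^n : ∀ n → ℤ→ℚ (+ n) ≤ 2ℚ ^ℚ n
  n≤2^n zero    = 0≤1
  n≤2^n (suc n) = begin
    ℤ→ℚ (+ suc n)            ≡⟨ ℤ→ℚ-+ (+ 1) (+ n) ⟨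
    ℤ→ℚ (+ 1) + ℤ→ℚ (+ n)    ≤⟨ ℚₚ.+-mono-≤ (1≤^ n 1≤2) (n≤2^n n) ⟩
    2ℚ ^ℚ n + 2ℚ ^ℚ n        ≡⟨ cong₂ _+_ (ℚₚ.*-identityˡ (2ℚ ^ℚ n)) (ℚₚ.*-identityˡ (2ℚ ^ℚ n)) ⟨
    1ℚ * 2ℚ ^ℚ n + 1ℚ * 2ℚ ^ℚ n ≡⟨ ℚₚ.*-distribʳ-+ (2ℚ ^ℚ n) 1ℚ 1ℚ ⟨
    2ℚ * 2ℚ ^ℚ n             ∎
    where open ℚₚ.≤-Reasoning

  ≤∣↥∣ : ∀ p → p ≤ ℤ→ℚ (+ ℤ.∣ ↥ p ∣)
  ≤∣↥∣ (mkℚ a d c) = *≤* (begin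
    a ℤ.* + 1               ≡⟨ ℤₚ.*-identityʳ a ⟩
    a                       ≤⟨ i≤∣i∣ a ⟩
    + ℤ.∣ a ∣               ≤⟨ ℤ.+≤+ (ℕₚ.m≤m*n ℤ.∣ a ∣ (suc d)) ⟩
    + (ℤ.∣ a ∣ ℕ.* suc d)   ≡⟨ ℤₚ.pos-* ℤ.∣ a ∣ (suc d) ⟩
    + ℤ.∣ a ∣ ℤ.* + suc d   ∎)
    where
    open ℤₚ.≤-Reasoning
    i≤∣i∣ : ∀ i → i ℤ.≤ + ℤ.∣ i ∣
    i≤∣i∣ (+ n)    = ℤₚ.≤-refl
    i≤∣i∣ -[1+ n ] = ℤ.-≤+

  neg-neg : ∀ p → ℚ.- (ℚ.- p) ≡ p
  neg-neg (mkℚ +0 _ _)       = refl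
  neg-neg (mkℚ +[1+ _ ] _ _) = refl
  neg-neg (mkℚ -[1+ _ ] _ _) = refl

  lowerℤ : ∀ p → Σ[ k ∈ ℤ ] ℤ→ℚ k ≤ p
  lowerℤ p = ℤ.- (+ ℤ.∣ ↥ (ℚ.- p) ∣) ,
    subst₂ _≤_ (neg-ℤ→ℚ (+ ℤ.∣ ↥ (ℚ.- p) ∣)) (neg-neg p) (ℚₚ.neg-antimono-≤ (≤∣↥∣ (ℚ.- p)))
    where
    neg-ℤ→ℚ : ∀ k → ℚ.- ℤ→ℚ k ≡ ℤ→ℚ (ℤ.- k)
    neg-ℤ→ℚ +0       = refl
    neg-ℤ→ℚ +[1+ _ ] = refl
    neg-ℤ→ℚ -[1+ _ ] = refl

  <-pred : ∀ p → p ℚ.- 1ℚ < p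
  <-pred p = subst (p ℚ.- 1ℚ <_) (ℚₚ.+-identityʳ p) (ℚₚ.+-monoʳ-< p (ℚₚ.negative⁻¹ (ℚ.- 1ℚ)))

  <-suc : ∀ p → p < p + 1ℚ
  <-suc p = subst (_< p + 1ℚ) (ℚₚ.+-identityʳ p) (ℚₚ.+-monoʳ-< p 0<1)

  ≤-neg-swap : ∀ {p q} → ℚ.- p ≤ q → ℚ.- q ≤ p
  ≤-neg-swap {p} -p≤q = subst (_ ≤_) (neg-neg p) (ℚₚ.neg-antimono-≤ -p≤q)

  ℤ→ℚ≤⇒ : ∀ {p} n → ↥ p ℤ.≤ + (n ℕ.* ↧ₙ p) → p ≤ ℤ→ℚ (+ n)
  ℤ→ℚ≤⇒ {mkℚ a d c} n a≤nd =
    *≤* (subst₂ ℤ._≤_ (sym (ℤₚ.*-identityʳ a)) (ℤₚ.pos-* n (suc d)) a≤nd)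

  ≤ℤ→ℚ⇒ : ∀ {p} n → p ≤ ℤ→ℚ (+ n) → ↥ p ℤ.≤ + (n ℕ.* ↧ₙ p)
  ≤ℤ→ℚ⇒ {mkℚ a d c} n (*≤* a≤nd) =
    subst₂ ℤ._≤_ (ℤₚ.*-identityʳ a) (sym (ℤₚ.pos-* n (suc d))) a≤nd

  bound : ℚ → ℕ
  bound p = ℤ.∣ ↥ p ∣

  ≤2^bound : ∀ p → p ≤ 2ℚ ^ℚ bound p
  ≤2^bound p = ℚₚ.≤-trans (≤∣↥∣ p) (n≤2^n (bound p))

  ½^*2^ : ∀ n → ½ ^ℚ n * 2ℚ ^ℚ n ≡ 1ℚ
  ½^*2^ zero    = ℚₚ.*-identityˡ 1ℚ
  ½^*2^ (suc n) = begin
    ½ * ½ ^ℚ n * (2ℚ * 2ℚ ^ℚ n)     ≡⟨ cong (_* (2ℚ * 2ℚ ^ℚ n)) (ℚₚ.*-comm ½ (½ ^ℚ n)) ⟩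
    ½ ^ℚ n * ½ * (2ℚ * 2ℚ ^ℚ n)     ≡⟨ ℚₚ.*-assoc (½ ^ℚ n) ½ _ ⟩
    ½ ^ℚ n * (½ * (2ℚ * 2ℚ ^ℚ n))   ≡⟨ cong (½ ^ℚ n *_) (ℚₚ.*-assoc ½ 2ℚ (2ℚ ^ℚ n)) ⟨
    ½ ^ℚ n * (1ℚ * 2ℚ ^ℚ n)         ≡⟨ cong (½ ^ℚ n *_) (ℚₚ.*-identityˡ (2ℚ ^ℚ n)) ⟩
    ½ ^ℚ n * 2ℚ ^ℚ n                ≡⟨ ½^*2^ n ⟩
    1ℚ                              ∎
    where open ≡-Reasoning

  archimedean : ∀ {s} → 0ℚ < s → Σ[ n ∈ ℕ ] ½ ^ℚ suc n ≤ s
  archimedean {s} 0<s = n , (begin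
    ½ ^ℚ suc n              ≤⟨ ℚₚ.≤-trans (*-monoʳ (^-0≤ n 0≤½) ½≤1) (ℚₚ.≤-reflexive (ℚₚ.*-identityˡ _)) ⟩
    ½ ^ℚ n                  ≡⟨ ℚₚ.*-identityʳ _ ⟨
    ½ ^ℚ n * 1ℚ             ≡⟨ cong (½ ^ℚ n *_) (ℚₚ.*-inverseˡ s) ⟨
    ½ ^ℚ n * (s⁻¹ * s)      ≤⟨ *-monoˡ (^-0≤ n 0≤½) (*-monoʳ (ℚₚ.<⇒≤ 0<s) (≤2^bound s⁻¹)) ⟩
    ½ ^ℚ n * (2ℚ ^ℚ n * s)  ≡⟨ ℚₚ.*-assoc (½ ^ℚ n) (2ℚ ^ℚ n) s ⟨
    ½ ^ℚ n * 2ℚ ^ℚ n * s    ≡⟨ cong (_* s) (½^*2^ n) ⟩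
    1ℚ * s                  ≡⟨ ℚₚ.*-identityˡ s ⟩
    s                       ∎)
    where
    open ℚₚ.≤-Reasoning
    instance _ = ℚ.>-nonZero 0<s
    s⁻¹ = ℚ.1/ s
    n = bound s⁻¹

  1/-0< : ∀ {p} (0<p : 0ℚ < p) → 0ℚ < (ℚ.1/ p) {{ℚ.>-nonZero 0<p}}
  1/-0< {p} 0<p = ℚₚ.positive⁻¹ _ {{ℚₚ.1/pos⇒pos p {{ℚ.positive 0<p}}}}

  segment-min : ∀ k {a c a′} → a ≤ c → c ≤ a′ → (k * a) ⊓ (k * a′) ≤ k * c
  segment-min k {a} {c} {a′} a≤c c≤a′ with ℚₚ.≤-total 0ℚ k
  ... | inj₁ 0≤k = ℚₚ.≤-trans (ℚₚ.p⊓q≤p (k * a) (k * a′)) (*-monoˡ 0≤k a≤c)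
  ... | inj₂ k≤0 = ℚₚ.≤-trans (ℚₚ.p⊓q≤q (k * a) (k * a′))
                     (ℚₚ.*-monoˡ-≤-nonPos k {{ℚ.nonPositive k≤0}} c≤a′)

  segment-max : ∀ k {a c a′} → a ≤ c → c ≤ a′ → k * c ≤ k * a ⊔ k * a′
  segment-max k {a} {c} {a′} a≤c c≤a′ with ℚₚ.≤-total 0ℚ k
  ... | inj₁ 0≤k = ℚₚ.≤-trans (*-monoˡ 0≤k c≤a′) (ℚₚ.p≤q⊔p (k * a) (k * a′))
  ... | inj₂ k≤0 = ℚₚ.≤-trans (ℚₚ.*-monoˡ-≤-nonPos k {{ℚ.nonPositive k≤0}} a≤c) (ℚₚ.p≤p⊔q (k * a) (k * a′))

  box-min : ∀ {a c a′ b d b′} → a ≤ c → c ≤ a′ → b ≤ d → d ≤ b′ → cornerMin a a′ b b′ ≤ c * d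
  box-min {a} {c} {a′} {d = d} a≤c c≤a′ b≤d d≤b′ = ℚₚ.≤-trans
    (ℚₚ.⊓-mono-≤ (segment-min a b≤d d≤b′) (segment-min a′ b≤d d≤b′))
    (subst₂ _≤_ (cong₂ _⊓_ (ℚₚ.*-comm d a) (ℚₚ.*-comm d a′)) (ℚₚ.*-comm d c)
      (segment-min d a≤c c≤a′))

  box-max : ∀ {a c a′ b d b′} → a ≤ c → c ≤ a′ → b ≤ d → d ≤ b′ → c * d ≤ cornerMax a a′ b b′
  box-max {a} {c} {a′} {d = d} a≤c c≤a′ b≤d d≤b′ = ℚₚ.≤-trans
    (subst₂ _≤_ (ℚₚ.*-comm d c) (cong₂ _⊔_ (ℚₚ.*-comm d a) (ℚₚ.*-comm d a′))
      (segment-max d a≤c c≤a′))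
    (ℚₚ.⊔-mono-≤ (segment-max a b≤d d≤b′) (segment-max a′ b≤d d≤b′))

  bernoulli : ∀ s δ n → 0ℚ ≤ δ → s ≡ 1ℚ + δ → 1ℚ + ℤ→ℚ (+ n) * δ ≤ s ^ℚ n
  bernoulli s δ zero 0≤δ eq =
    ℚₚ.≤-reflexive (trans (cong (λ k → 1ℚ + k) (ℚₚ.*-zeroˡ δ)) (ℚₚ.+-identityʳ 1ℚ))
  bernoulli s δ (suc n) 0≤δ eq = begin
    1ℚ + ℤ→ℚ (+ suc n) * δ          ≡⟨ cong (λ k → 1ℚ + k * δ) (trans (cong ℤ→ℚ (ℤₚ.+-comm (+ 1) (+ n))) (sym (ℤ→ℚ-+ (+ n) (+ 1)))) ⟩
    1ℚ + (ℤ→ℚ (+ n) + 1ℚ) * δ       ≡⟨ cong (λ k → 1ℚ + k) (ℚₚ.*-distribʳ-+ δ (ℤ→ℚ (+ n)) 1ℚ) ⟩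
    1ℚ + (ℤ→ℚ (+ n) * δ + 1ℚ * δ)   ≡⟨ cong (λ k → 1ℚ + (ℤ→ℚ (+ n) * δ + k)) (ℚₚ.*-comm 1ℚ δ) ⟩
    1ℚ + (ℤ→ℚ (+ n) * δ + δ * 1ℚ)   ≡⟨ ℚₚ.+-assoc 1ℚ (ℤ→ℚ (+ n) * δ) (δ * 1ℚ) ⟨
    1ℚ + ℤ→ℚ (+ n) * δ + δ * 1ℚ     ≤⟨ ℚₚ.+-mono-≤ (bernoulli s δ n 0≤δ eq) (*-monoˡ 0≤δ (1≤^ n 1≤s)) ⟩
    s ^ℚ n + δ * s ^ℚ n             ≡⟨ cong (_+ δ * s ^ℚ n) (ℚₚ.*-identityˡ (s ^ℚ n)) ⟨
    1ℚ * s ^ℚ n + δ * s ^ℚ n        ≡⟨ ℚₚ.*-distribʳ-+ (s ^ℚ n) 1ℚ δ ⟨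
    (1ℚ + δ) * s ^ℚ n               ≡⟨ cong (_* s ^ℚ n) eq ⟨
    s * s ^ℚ n                      ∎
    where
    open ℚₚ.≤-Reasoning
    1≤s : 1ℚ ≤ s
    1≤s = subst (1ℚ ≤_) (sym eq) (subst (_≤ 1ℚ + δ) (ℚₚ.+-identityʳ 1ℚ) (ℚₚ.+-monoʳ-≤ 1ℚ 0≤δ))

  1≤↧*p : ∀ {p} → 0ℚ < p → 1ℚ ≤ ℤ→ℚ (+ ↧ₙ p) * p
  1≤↧*p {p@(mkℚ +[1+ n ] d c)} 0<p = subst (1ℚ ≤_) (sym eq) (ℤ→ℚ-mono {+ 1} {+[1+ n ]} (ℤ.+≤+ (ℕ.s≤s ℕ.z≤n)))
    where
    eq : ℤ→ℚ (+ suc d) * p ≡ ℤ→ℚ +[1+ n ]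
    eq = ℚₚ.toℚᵘ-injective step
      where
      open import Data.Rational.Unnormalised.Base as ℚᵘ using (ℚᵘ; mkℚᵘ)
      open import Data.Rational.Unnormalised.Properties as ℚᵘₚ using (≃-trans)
      step : ℚ.toℚᵘ (ℤ→ℚ (+ suc d) * p) ℚᵘ.≃ mkℚᵘ +[1+ n ] 0
      step = ≃-trans (ℚₚ.toℚᵘ-homo-* (ℤ→ℚ (+ suc d)) p)
        (ℚᵘ.*≡* (trans (ℤₚ.*-identityʳ _)
          (trans (ℤₚ.*-comm (+ suc d) +[1+ n ])
                 (cong (λ k → +[1+ n ] ℤ.* + suc k) (sym (ℕₚ.+-identityʳ d))))))
  1≤↧*p {mkℚ +0       d c} (*<* 0<0) = ⊥-elim (ℤₚ.<-irrefl (sym (ℤₚ.*-zeroˡ (+ 1))) 0<0)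
  1≤↧*p {mkℚ -[1+ n ] d c} (*<* ())

  2≤power : ∀ {s} → 1ℚ < s → Σ[ n ∈ ℕ ] 2ℚ ≤ s ^ℚ suc n
  2≤power {s} 1<s = ℕ.pred (↧ₙ δ) ,
      ℚₚ.≤-trans (ℚₚ.+-monoʳ-≤ 1ℚ (1≤↧*p 0<δ)) (bern (↧ₙ δ) refl)
    where
    δ = s ℚ.- 1ℚ
    eq : s ≡ 1ℚ + δ
    eq = sym (trans (cong (λ k → 1ℚ + k) (ℚₚ.+-comm s (ℚ.- 1ℚ)))
         (trans (sym (ℚₚ.+-assoc 1ℚ (ℚ.- 1ℚ) s)) (ℚₚ.+-identityˡ s)))
    0<δ : 0ℚ < δ
    0<δ = ℚₚ.+-monoˡ-< (ℚ.- 1ℚ) 1<s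
    bern : ∀ m → m ≡ ↧ₙ δ → 1ℚ + ℤ→ℚ (+ m) * δ ≤ s ^ℚ suc (ℕ.pred (↧ₙ δ))
    bern m refl = bernoulli s δ (↧ₙ δ) (ℚₚ.<⇒≤ 0<δ) eq

private module L = RationalLemmas

-- Lower Dedekind cuts of ℚ: x is represented by { q ∣ q < x }.  No locatedness
-- is required, so these are the classical reals once excluded middle is assumed.
record ℝ : Set₁ where
  field
    below     : ℚ → Set
    inhabited : ∃ below
    bounded   : ∃[ u ] ¬ below u
    closed    : ∀ {p q} → p ℚ.< q → below q → below p
    rounded   : ∀ {p} → below p → ∃[ q ] p ℚ.< q × below q

infix 4 _◂_ _≤_ _<_ _≈_

_◂_ : ℚ → ℝ → Set
q ◂ x = ℝ.below x q

_≤_ : ℝ → ℝ → Set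
x ≤ y = ∀ q → q ◂ x → q ◂ y

_<_ : ℝ → ℝ → Set
x < y = ∃[ q ] ¬ (q ◂ x) × q ◂ y

_≈_ : ℝ → ℝ → Set
x ≈ y = x ≤ y × y ≤ x

◂-down : ∀ x {p q} → p ℚ.≤ q → q ◂ x → p ◂ x
◂-down x {p} {q} p≤q q◂x with p ℚₚ.<? q
... | yes p<q = ℝ.closed x p<q q◂x
... | no  p≮q = subst (_◂ x) (ℚₚ.≤-antisym (ℚₚ.≮⇒≥ p≮q) p≤q) q◂x

◂⇒< : ∀ x {p u} → p ◂ x → ¬ (u ◂ x) → p ℚ.< u
◂⇒< x p◂x ¬u◂x = ℚₚ.≰⇒> (λ u≤p → ¬u◂x (◂-down x u≤p p◂x))

sup : (S : ℚ → Set) → ∃ S → (∃[ u ] ∀ s → S s → s ℚ.≤ u) → ℝ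
sup S (s₀ , Ss₀) (u , S≤u) = record
  { below     = λ q → ∃[ s ] S s × q ℚ.< s
  ; inhabited = s₀ ℚ.- 1ℚ , s₀ , Ss₀ , L.<-pred s₀
  ; bounded   = u , λ (s , Ss , u<s) → ℚₚ.<-irrefl refl (ℚₚ.<-≤-trans u<s (S≤u s Ss))
  ; closed    = λ p<q (s , Ss , q<s) → s , Ss , ℚₚ.<-trans p<q q<s
  ; rounded   = λ (s , Ss , p<s) →
                  let q , p<q , q<s = ℚₚ.<-dense p<s in q , p<q , s , Ss , q<s
  }

fromℚ : ℚ → ℝ
fromℚ r = record
  { below     = ℚ._< r
  ; inhabited = r ℚ.- 1ℚ , L.<-pred r
  ; bounded   = r , ℚₚ.<-irrefl refl
  ; closed    = ℚₚ.<-trans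
  ; rounded   = λ p<r → let q , p<q , q<r = ℚₚ.<-dense p<r in q , p<q , q<r
  }

fromℤ : ℤ → ℝ
fromℤ k = fromℚ (ℤ→ℚ k)

fromℕ : ℕ → ℝ
fromℕ n = fromℤ (+ n)

0ℝ 1ℝ : ℝ
0ℝ = fromℕ 0
1ℝ = fromℕ 1

infixl 7 _*_
infixl 6 _+_ _-_ _⊔_
infix  8 -_

_+_ : ℝ → ℝ → ℝ
x + y = sup (λ q → ∃[ a ] ∃[ b ] a ◂ x × b ◂ y × q ≡ a ℚ.+ b)
  (let a , a◂x = ℝ.inhabited x
       b , b◂y = ℝ.inhabited y
   in a ℚ.+ b , a , b , a◂x , b◂y , refl)
  (let u , ¬u◂x = ℝ.bounded x
       v , ¬v◂y = ℝ.bounded y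
   in u ℚ.+ v , λ { _ (a , b , a◂x , b◂y , refl) →
        ℚₚ.+-mono-≤ (ℚₚ.<⇒≤ (◂⇒< x a◂x ¬u◂x)) (ℚₚ.<⇒≤ (◂⇒< y b◂y ¬v◂y)) })

-_ : ℝ → ℝ
- x = sup (λ q → ¬ ((ℚ.- q) ◂ x))
  (let u , ¬u◂x = ℝ.bounded x
   in ℚ.- u , λ u◂x → ¬u◂x (subst (_◂ x) (L.neg-neg u) u◂x))
  (let a , a◂x = ℝ.inhabited x
   in ℚ.- a , λ q ¬-q◂x →
        subst (ℚ._≤ ℚ.- a) (L.neg-neg q) (ℚₚ.neg-antimono-≤ (ℚₚ.<⇒≤ (◂⇒< x a◂x ¬-q◂x))))

_-_ : ℝ → ℝ → ℝ
x - y = x + (- y)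

_⊔_ : ℝ → ℝ → ℝ
x ⊔ y = sup (λ q → q ◂ x ⊎ q ◂ y)
  (let a , a◂x = ℝ.inhabited x in a , inj₁ a◂x)
  (let u , ¬u◂x = ℝ.bounded x
       v , ¬v◂y = ℝ.bounded y
   in u ℚ.⊔ v , λ { q (inj₁ q◂x) → ℚₚ.≤-trans (ℚₚ.<⇒≤ (◂⇒< x q◂x ¬u◂x)) (ℚₚ.p≤p⊔q u v)
                  ; q (inj₂ q◂y) → ℚₚ.≤-trans (ℚₚ.<⇒≤ (◂⇒< y q◂y ¬v◂y)) (ℚₚ.p≤q⊔p u v) })

∣_∣ : ℝ → ℝ
∣ x ∣ = x ⊔ (- x)

-- Interval product: q < x * y iff q is below c * d for all (c , d) in some
-- rational box [a , a′] × [b , b′] containing (x , y), and a bilinear form is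
-- smallest at a corner.
_*_ : ℝ → ℝ → ℝ
x * y = sup
  (λ q → ∃[ a ] ∃[ a′ ] ∃[ b ] ∃[ b′ ]
         (a ◂ x × ¬ (a′ ◂ x)) × (b ◂ y × ¬ (b′ ◂ y)) × q ≡ cornerMin a a′ b b′)
  (cornerMin a₀ a₀′ b₀ b₀′ , a₀ , a₀′ , b₀ , b₀′ , (a₀◂x , ¬a₀′◂x) , (b₀◂y , ¬b₀′◂y) , refl)
  (cornerMax a₀ a₀′ b₀ b₀′ , λ
    { _ (a , a′ , b , b′ , (a◂x , ¬a′◂x) , (b◂y , ¬b′◂y) , refl) →
      ℚₚ.≤-trans
        (L.box-min
          (ℚₚ.p≤p⊔q a a₀)
          (ℚₚ.⊔-lub (ℚₚ.<⇒≤ (◂⇒< x a◂x ¬a′◂x)) (ℚₚ.<⇒≤ (◂⇒< x a₀◂x ¬a′◂x)))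
          (ℚₚ.p≤p⊔q b b₀)
          (ℚₚ.⊔-lub (ℚₚ.<⇒≤ (◂⇒< y b◂y ¬b′◂y)) (ℚₚ.<⇒≤ (◂⇒< y b₀◂y ¬b′◂y))))
        (L.box-max
          (ℚₚ.p≤q⊔p a a₀)
          (ℚₚ.⊔-lub (ℚₚ.<⇒≤ (◂⇒< x a◂x ¬a₀′◂x)) (ℚₚ.<⇒≤ (◂⇒< x a₀◂x ¬a₀′◂x)))
          (ℚₚ.p≤q⊔p b b₀)
          (ℚₚ.⊔-lub (ℚₚ.<⇒≤ (◂⇒< y b◂y ¬b₀′◂y)) (ℚₚ.<⇒≤ (◂⇒< y b₀◂y ¬b₀′◂y)))) })
  where
  a₀     = proj₁ (ℝ.inhabited x)
  a₀◂x   = proj₂ (ℝ.inhabited x)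
  a₀′    = proj₁ (ℝ.bounded x)
  ¬a₀′◂x = proj₂ (ℝ.bounded x)
  b₀     = proj₁ (ℝ.inhabited y)
  b₀◂y   = proj₂ (ℝ.inhabited y)
  b₀′    = proj₁ (ℝ.bounded y)
  ¬b₀′◂y = proj₂ (ℝ.bounded y)

0<⇒witness : ∀ x → 0ℝ < x → ∃[ r ] 0ℚ ℚ.< r × r ◂ x
0<⇒witness x (q , ¬q<0 , q◂x) =
  let r , q<r , r◂x = ℝ.rounded x q◂x in r , ℚₚ.≤-<-trans (ℚₚ.≮⇒≥ ¬q<0) q<r , r◂x

recip : (x : ℝ) → 0ℝ < x → ℝ
recip x 0<x = sup (λ q → ∃[ v ] ¬ (v ◂ x) × q ℚ.* v ℚ.≤ 1ℚ)
  (let u , ¬u◂x = ℝ.bounded x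
   in 0ℚ , u , ¬u◂x , subst (ℚ._≤ 1ℚ) (sym (ℚₚ.*-zeroˡ u)) L.0≤1)
  (1/r , λ q (v , ¬v◂x , qv≤1) → ℚₚ.≮⇒≥ λ 1/r<q → ℚₚ.<-irrefl refl (begin-strict
    1ℚ         ≡⟨ ℚₚ.*-inverseˡ r ⟨
    1/r ℚ.* r  <⟨ L.*-mono-<ʳ 0<r 1/r<q ⟩
    q ℚ.* r    ≤⟨ L.*-monoˡ (ℚₚ.<⇒≤ (ℚₚ.<-trans (L.1/-0< 0<r) 1/r<q)) (ℚₚ.<⇒≤ (◂⇒< x r◂x ¬v◂x)) ⟩
    q ℚ.* v    ≤⟨ qv≤1 ⟩
    1ℚ         ∎))
  where
  open ℚₚ.≤-Reasoning
  r   = proj₁ (0<⇒witness x 0<x)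
  0<r = proj₁ (proj₂ (0<⇒witness x 0<x))
  r◂x = proj₂ (proj₂ (0<⇒witness x 0<x))
  instance _ = ℚ.>-nonZero 0<r
  1/r = ℚ.1/ r

divide : ℝ → (y : ℝ) → 0ℝ < y → ℝ
divide x y 0<y = x * recip y 0<y

⌊_⌋ : ℝ → ℝ
⌊ x ⌋ = sup (λ q → ∃[ k ] q ≡ ℤ→ℚ k × fromℤ k ≤ x)
  (let a , a◂x = ℝ.inhabited x
       k , k≤a = L.lowerℤ a
   in ℤ→ℚ k , k , refl , λ q q<k → ℝ.closed x (ℚₚ.<-≤-trans q<k k≤a) a◂x)
  (let u , ¬u◂x = ℝ.bounded x
   in u , λ { _ (k , refl , k≤x) → ℚₚ.≮⇒≥ λ u<k → ¬u◂x (k≤x u u<k) })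

-- For t = a / b in lowest terms and s > 0, 2^t ≤ s iff 2^a ≤ s^b.
log₂ : (x : ℝ) → 0ℝ < x → ℝ
log₂ x 0<x = sup (λ t → ∃[ s ] s ◂ x × 0ℚ ℚ.< s × 2^ (↥ t) ℚ.≤ s ^ℚ (↧ₙ t))
  (let r , 0<r , r◂x = 0<⇒witness x 0<x
       n , ½^≤r      = L.archimedean 0<r
   in ℤ→ℚ -[1+ n ] , r , r◂x , 0<r , subst (2^ -[1+ n ] ℚ.≤_) (sym (ℚₚ.*-identityʳ r)) ½^≤r)
  (let u , ¬u◂x = ℝ.bounded x
       N = L.bound u
   in ℤ→ℚ (+ N) , λ t (s , s◂x , 0<s , 2^≤s^) →
        L.ℤ→ℚ≤⇒ N (L.2^≤⇒≤ (↥ t) (N ℕ.* ↧ₙ t) (ℚₚ.≤-trans 2^≤s^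
          (subst (s ^ℚ (↧ₙ t) ℚ.≤_) (Exp.^-assocʳ 2ℚ N (↧ₙ t))
            (L.^-mono (↧ₙ t) (ℚₚ.<⇒≤ 0<s)
              (ℚₚ.≤-trans (ℚₚ.<⇒≤ (◂⇒< x s◂x ¬u◂x)) (L.≤2^bound u)))))))

exp₂ : ℝ → ℝ
exp₂ y = sup (λ s → 0ℚ ℚ.< s × ∃[ t ] t ◂ y × s ^ℚ (↧ₙ t) ℚ.≤ 2^ (↥ t))
  (let t , t◂y = ℝ.inhabited y
       m = suc ℤ.∣ ↥ t ∣
   in ½ ^ℚ m , L.^-0< m (ℚₚ.positive⁻¹ ½) , t , t◂y ,
        ℚₚ.≤-trans (L.^-suc≤ (ℕ.pred (↧ₙ t)) (L.^-0≤ m L.0≤½) (L.^≤1 m L.0≤½ L.½≤1))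
                   (L.½^≤2^ (↥ t)))
  (let u , ¬u◂y = ℝ.bounded y
       N = L.bound u
   in 2ℚ ^ℚ N , λ s (0<s , t , t◂y , s^≤2^) → ℚₚ.≮⇒≥ λ 2^N<s →
        ℚₚ.<-irrefl refl (ℚₚ.<-≤-trans
          (L.^-mono-< (ℕ.pred (↧ₙ t)) (L.^-0≤ N (ℚₚ.≤-trans L.0≤1 L.1≤2)) 2^N<s)
          (ℚₚ.≤-trans s^≤2^
            (subst (2^ (↥ t) ℚ.≤_) (sym (Exp.^-assocʳ 2ℚ N (↧ₙ t)))
              (L.≤⇒2^≤ (↥ t) (N ℕ.* ↧ₙ t) (L.≤ℤ→ℚ⇒ N
                (ℚₚ.≤-trans (ℚₚ.<⇒≤ (◂⇒< y t◂y ¬u◂y)) (L.≤∣↥∣ u))))))))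

pow : (x : ℝ) → 0ℝ < x → ℝ → ℝ
pow x 0<x c = exp₂ (c * log₂ x 0<x)

1<⇒0< : ∀ {x} → 1ℝ < x → 0ℝ < x
1<⇒0< (q , ¬q<1 , q◂x) = q , (λ q<0 → ¬q<1 (ℚₚ.<-trans q<0 L.0<1)) , q◂x

0<log₂ : ∀ x (1<x : 1ℝ < x) → 0ℝ < log₂ x (1<⇒0< {x} 1<x)
0<log₂ x (q , ¬q<1 , q◂x) =
  let s , q<s , s◂x = ℝ.rounded x q◂x
      1<s           = ℚₚ.≤-<-trans (ℚₚ.≮⇒≥ ¬q<1) q<s
      n , 2≤s^n     = L.2≤power 1<s
      t             = mkℚ (+ 1) n (Coprimality.1-coprimeTo (suc n))
  in 0ℚ , ℚₚ.<-irrefl refl , t ,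
     (s , s◂x , ℚₚ.<-trans L.0<1 1<s , subst (ℚ._≤ s ^ℚ suc n) (sym (ℚₚ.*-identityʳ 2ℚ)) 2≤s^n) ,
     ℚₚ.positive⁻¹ t

1<divide : ∀ n → 1 ℕ.≤ n → ∀ ε (0<ε : 0ℝ < ε) → ε < 1ℝ → 1ℝ < divide (fromℕ n) ε 0<ε
1<divide n 1≤n ε 0<ε (q , ¬q◂ε , q<1) =
  1ℚ , ℚₚ.<-irrefl refl , cornerMin a a′ b b′ ,
  (a , a′ , b , b′ , (a<n , ℚₚ.<-irrefl refl) , (b◂ε⁻¹ , ¬b′◂ε⁻¹) , refl) ,
  ℚₚ.<-≤-trans 1<ab
    (ℚₚ.⊓-glb (ℚₚ.⊓-glb ℚₚ.≤-refl ab≤ab′)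
              (ℚₚ.⊓-glb ab≤a′b (ℚₚ.≤-trans ab≤ab′ (L.*-monoʳ (ℚₚ.<⇒≤ (ℚₚ.<-trans 0<b b<b′)) a≤a′))))
  where
  ε⁻¹ = recip ε 0<ε
  0<q : 0ℚ ℚ.< q
  0<q = let r , 0<r , r◂ε = 0<⇒witness ε 0<ε in ℚₚ.<-trans 0<r (◂⇒< ε r◂ε ¬q◂ε)
  c   = proj₁ (ℚₚ.<-dense q<1)
  q<c = proj₁ (proj₂ (ℚₚ.<-dense q<1))
  c<1 = proj₂ (proj₂ (ℚₚ.<-dense q<1))
  a   = proj₁ (ℚₚ.<-dense c<1)
  c<a = proj₁ (proj₂ (ℚₚ.<-dense c<1))
  a<1 = proj₂ (proj₂ (ℚₚ.<-dense c<1))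
  0<c = ℚₚ.<-trans 0<q q<c
  0<a = ℚₚ.<-trans 0<c c<a
  instance
    _ = ℚ.>-nonZero 0<q
    _ = ℚ.>-nonZero 0<c
  a′ = ℤ→ℚ (+ n)
  b  = ℚ.1/ c
  0<b : 0ℚ ℚ.< b
  0<b = L.1/-0< 0<c
  a<n : a ℚ.< a′
  a<n = ℚₚ.<-≤-trans a<1 (L.ℤ→ℚ-mono (ℤ.+≤+ 1≤n))
  a≤a′ = ℚₚ.<⇒≤ a<n
  b◂ε⁻¹ : b ◂ ε⁻¹
  b◂ε⁻¹ = ℚ.1/ q , (q , ¬q◂ε , ℚₚ.≤-reflexive (ℚₚ.*-inverseˡ q)) ,
    ℚₚ.*-cancelʳ-<-nonNeg c {{ℚ.nonNegative (ℚₚ.<⇒≤ 0<c)}}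
      (subst₂ ℚ._<_ (trans (ℚₚ.*-inverseˡ q) (sym (ℚₚ.*-inverseˡ c))) refl
        (L.*-mono-<ˡ (L.1/-0< 0<q) q<c))
  b′      = proj₁ (ℝ.bounded ε⁻¹)
  ¬b′◂ε⁻¹ = proj₂ (ℝ.bounded ε⁻¹)
  b<b′ : b ℚ.< b′
  b<b′ = ◂⇒< ε⁻¹ b◂ε⁻¹ ¬b′◂ε⁻¹
  1<ab : 1ℚ ℚ.< a ℚ.* b
  1<ab = subst (ℚ._< a ℚ.* b) (ℚₚ.*-inverseʳ c) (L.*-mono-<ʳ 0<b c<a)
  ab≤ab′ = L.*-monoˡ (ℚₚ.<⇒≤ 0<a) (ℚₚ.<⇒≤ b<b′)
  ab≤a′b = L.*-monoʳ (ℚₚ.<⇒≤ 0<b) a≤a′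

Cube : ℕ → Set
Cube n = Vec Bool n

BooleanFunction : ℕ → Set
BooleanFunction n = Cube n → Bool

bit : Bool → ℕ
bit b = if b then 1 else 0

-- Every vector of n bits exactly once; also every Subset n.
bitVectors : ∀ n → List (Vec Bool n)
bitVectors zero    = [] ∷ []
bitVectors (suc n) = map (false ∷_) (bitVectors n) ++ map (true ∷_) (bitVectors n)

-- Elements of ℝ/ℤ are given by real representatives, compared by _≡₁_.
𝕋 : Set₁
𝕋 = ℝ

infix 4 _≡₁_
_≡₁_ : 𝕋 → 𝕋 → Set
z ≡₁ w = ∃[ k ] z ≈ w + fromℤ k

-- ι z = z - ⌊ z + ½ ⌋ is the representative of z in [ -½ , ½ ).
ι : 𝕋 → ℝ
ι z = z - ⌊ z + fromℚ ½ ⌋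

∣_mod1∣ : 𝕋 → ℝ
∣ z mod1∣ = ∣ ι z ∣

-- The maximum over the cube; starting from 0ℝ is harmless as the values are
-- nonnegative and the cube is nonempty.
∥_mod1∥∞ : ∀ {n} → (Cube n → 𝕋) → ℝ
∥_mod1∥∞ {n} F = foldr (λ x m → ∣ F x mod1∣ ⊔ m) 0ℝ (bitVectors n)

monomial : ∀ {n} → Subset n → Cube n → ℕ
monomial S x = Vec.foldr′ ℕ._*_ 1 (Vec.zipWith (λ i∈S xᵢ → if i∈S then bit xᵢ else 1) S x)

evalTorus : ∀ {n} → ℕ → (Subset n → ℝ) → Cube n → 𝕋
evalTorus {n} d P x =
  foldr (λ S acc → P S * fromℕ (monomial S x) + acc) 0ℝ
    (filter (λ S → card S ℕₚ.≤? d) (bitVectors n))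

IsTorusPolynomial : ∀ {n} → ℕ → (Cube n → 𝕋) → Set₁
IsTorusPolynomial {n} d P =
  Σ[ coeff ∈ (Subset n → ℝ) ] (∀ x → P x ≡₁ evalTorus d coeff x)

half : ∀ {n} → BooleanFunction n → Cube n → 𝕋
half f x = fromℕ (bit (f x)) * fromℚ ½

Approximable : ∀ {n} → ℝ → BooleanFunction n → ℕ → Set₁
Approximable {n} ε f d =
  Σ[ P ∈ (Cube n → 𝕋) ] IsTorusPolynomial d P × ∥ (λ x → P x - half f x) mod1∥∞ ≤ ε

IsToroidalDegree : ∀ {n} → ℝ → BooleanFunction n → ℕ → Set₁
IsToroidalDegree ε f d = Approximable ε f d × (∀ d′ → Approximable ε f d′ → d ℕ.≤ d′)

data Gate (w : ℕ) : Set where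
  AND OR MOD : List (Fin w) → Gate w
  NOT        : Fin w → Gate w

-- A circuit with n inputs and m gates (an acyclic graph, not a formula).  The
-- newest gate is wire 0 and the inputs are the last n wires.
data Circuit (n : ℕ) : ℕ → Set where
  inputs : Circuit n 0
  _▷_    : ∀ {m} → Circuit n m → Gate (m ℕ.+ n) → Circuit n (suc m)

gateValue : ℕ → ∀ {w} → Vec Bool w → Gate w → Bool
gateValue p v (AND is) = and (map (Vec.lookup v) is)
gateValue p v (OR is)  = or (map (Vec.lookup v) is)
gateValue p v (MOD is) = not (does (p ∣? sum (map (bit ∘ Vec.lookup v) is)))
gateValue p v (NOT i)  = not (Vec.lookup v i)

values : ℕ → ∀ {n m} → Circuit n m → Cube n → Vec Bool (m ℕ.+ n)
values p inputs  x = x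
values p (C ▷ g) x = let v = values p C x in gateValue p v g ∷ v

fanIn : ∀ {w} → Gate w → List (Fin w)
fanIn (AND is) = is
fanIn (OR is)  = is
fanIn (MOD is) = is
fanIn (NOT i)  = i ∷ []

-- Depth counts every gate on a path, NOT gates included.
depths : ∀ {n m} → Circuit n m → Vec ℕ (m ℕ.+ n)
depths {n} inputs = Vec.replicate n 0
depths (C ▷ g)    = let v = depths C in
  suc (foldr ℕ._⊔_ 0 (map (Vec.lookup v) (fanIn g))) ∷ v

-- Coefficients in increasing degree.  As polynomials only occur as upper
-- bounds, natural-number coefficients lose no generality.
Polynomial : Set
Polynomial = List ℕ

evalPoly : Polynomial → ℕ → ℕ
evalPoly cs n = foldr (λ c acc → c ℕ.+ n ℕ.* acc) 0 cs

Family : Set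
Family = ∀ n → BooleanFunction n

-- Only the members f n with n ≥ 1 matter.
AC⁰[_] : ℕ → Family → Set
AC⁰[ p ] f =
  Σ[ ℓ ∈ ℕ ] Σ[ s ∈ Polynomial ] ∀ n → 1 ℕ.≤ n →
  Σ[ size ∈ ℕ ] Σ[ C ∈ Circuit n size ] Σ[ out ∈ Fin (size ℕ.+ n) ]
    size ℕ.≤ evalPoly s n ×
    Vec.lookup (depths C) out ℕ.≤ ℓ ×
    (∀ x → Vec.lookup (values p C x) out ≡ f n x)

-- The proofs that n / ε > 1 make log₂ (n / ε) positive, so that it has real powers.
polylog : ℝ → ∀ n → 1 ℕ.≤ n → ∀ ε → 0ℝ < ε → ε < 1ℝ → ℝ
polylog C n 1≤n ε 0<ε ε<1 = C * pow (log₂ n/ε (1<⇒0< {n/ε} 1<n/ε)) (0<log₂ n/ε 1<n/ε) C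
  where
  n/ε   = divide (fromℕ n) ε 0<ε
  1<n/ε = 1<divide n 1≤n ε 0<ε ε<1

{-# OPTIONS --safe #-}
-- By Razborov and Smolensky, for every weighting of the cube there is a
-- polynomial over ℤ/p of polylogarithmic degree that computes f except on a set
-- of small relative weight: an OR of bits is nonzero modulo p on a random sublist
-- with probability at least 1/2, and the sublists are fixed greedily.  By
-- multiplicative weights, L = O (n / ε) such polynomials q₁, …, q_L suffice for
-- all but an O (ε) fraction of them to be right at every single point.  Lift
-- their values 0 and 1 from modulus p to modulus M = p ^ k by the polynomial
-- 1 - (1 - y ^ k) ^ k, with M ≥ L / ε.  Then Σ qⱼ is congruent modulo M to the
-- number of votes for f = 1, and multiplied by ⌊ M / 2 L ⌋ / M it is close to
-- f / 2 modulo 1.  For ε ≥ 1/4 the constant 1/4 is good enough, which matters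
-- because log (n / ε) may be arbitrarily close to 0 there.
module Submission where

-- Residues modulo `p` cannot hold a vote count as large as L; this forces the lift to a modulus
-- beyond L. The lift preserves only the values 0 and 1, so a polynomial that is wrong at a point
-- must still take one of them there. One more zero test before the vote ensures this, and a wrong
-- sample then costs a single vote. The further factor of order 1 / ε in M pays for rounding M / 2 L
-- down, which shifts the result by up to L / M. Arbitrary weightings are needed because the norm is
-- a maximum over the cube: a polynomial that is good on average says nothing about a single point.
-- The degree stays polylogarithmic because each of the boundedly many levels multiplies it by t (p
-- - 1), where the size and ε enter only through the logarithmic number t of tests, and the lift
-- multiplies it by the square of the logarithmic exponent k. Modulo m, subtraction is
-- multiplication by m - 1, so all coefficients are natural numbers. The final constant is both
-- factor and exponent of log (n / ε), so log log (n / ε) has to stay away from 0.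

module Polynomials where

  open import Defs using (Cube; BooleanFunction; bit; bitVectors; monomial; Gate; AND; OR; MOD; NOT; Circuit; inputs; _▷_; gateValue; values; fanIn; depths; Polynomial; evalPoly)
  open import Data.Bool.Base using (Bool; true; false; not; _∧_; _∨_; if_then_else_)
  open import Data.Bool.ListAction using (and; or)
  open import Data.Bool.Properties using (not-involutive)
  open import Data.Fin.Base using (Fin; zero; suc)
  open import Data.Fin.Subset using (Subset; ⊥; ⁅_⁆; _∪_) renaming (∣_∣ to card)
  open import Data.Fin.Subset.Properties using (∣⊥∣≡0; ∣⁅x⁆∣≡1)
  open import Data.List.Base using (List; []; _∷_; _++_; map; foldr; filter; length; replicate)
  open import Data.List.Membership.Propositional using (_∈_)
  open import Data.List.Membership.Propositional.Properties using (∈-++⁺ˡ; ∈-++⁺ʳ; ∈-map⁺)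
  open import Data.List.Properties using (map-++; map-∘; map-cong; length-++; length-map; filter-accept; filter-reject)
  open import Data.List.Relation.Unary.All as All using (All; []; _∷_)
  open import Data.List.Relation.Unary.All.Properties using (++⁺; map⁺; replicate⁺)
  open import Data.List.Relation.Unary.Any using (here; there)
  open import Data.Nat.Base
  open import Data.Nat.Coprimality using (coprime-Bézout; Coprime)
  open import Data.Nat.Divisibility
  open import Data.Nat.DivMod
  open import Data.Nat.GCD using (module Bézout)
  open import Data.Nat.ListAction using (sum)
  open import Data.Nat.ListAction.Properties using (sum-++)
  open import Data.Nat.Primality using (Prime; euclidsLemma; prime⇒nonZero; prime⇒nonTrivial; prime⇒irreducible)
  open import Data.Nat.Properties
  open import Data.Nat.Tactic.RingSolver using (solve-∀)
  open import Data.Product.Base using (Σ-syntax; ∃-syntax; _×_; _,_; proj₁; proj₂)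
  open import Data.Sum.Base using (_⊎_; inj₁; inj₂)
  open import Data.Vec.Base as Vec using (Vec; []; _∷_; lookup)
  open import Function.Base using (_∘_)
  open import Relation.Binary.PropositionalEquality using (_≡_; refl; sym; trans; cong; cong₂; subst; subst₂; module ≡-Reasoning)
  open import Relation.Nullary using (¬_; yes; no; does; contradiction)

  -- Sums and multilinear polynomials

  bit≤1 : ∀ b → bit b ≤ 1
  bit≤1 false = z≤n
  bit≤1 true  = ≤-refl

  bit-∧ : ∀ a b → bit (a ∧ b) ≡ bit a * bit b
  bit-∧ false b = refl
  bit-∧ true  b = sym (+-identityʳ _)

  bit-∨ : ∀ a b → bit (a ∨ b) ≤ bit a + bit b
  bit-∨ false b = ≤-refl
  bit-∨ true  b = s≤s z≤n

  *-interchange : ∀ a b c d → a * b * (c * d) ≡ a * c * (b * d)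
  *-interchange = solve-∀

  ∑ : ∀ {a} {A : Set a} → List A → (A → ℕ) → ℕ
  ∑ xs f = sum (map f xs)

  module _ {a} {A : Set a} where

    ∑-cong : ∀ (xs : List A) {f g} → (∀ x → f x ≡ g x) → ∑ xs f ≡ ∑ xs g
    ∑-cong xs f≗g = cong sum (map-cong f≗g xs)

    ∑-++ : ∀ (xs ys : List A) f → ∑ (xs ++ ys) f ≡ ∑ xs f + ∑ ys f
    ∑-++ xs ys f = trans (cong sum (map-++ f xs ys)) (sum-++ (map f xs) (map f ys))

    ∑-map : ∀ {b} {B : Set b} (h : B → A) (xs : List B) f → ∑ (map h xs) f ≡ ∑ xs (f ∘ h)
    ∑-map h xs f = cong sum (sym (map-∘ xs))

    ∑-mono : ∀ (xs : List A) {f g} → (∀ x → f x ≤ g x) → ∑ xs f ≤ ∑ xs g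
    ∑-mono []       f≤g = z≤n
    ∑-mono (x ∷ xs) f≤g = +-mono-≤ (f≤g x) (∑-mono xs f≤g)

    ∑-+ : ∀ (xs : List A) f g → ∑ xs (λ x → f x + g x) ≡ ∑ xs f + ∑ xs g
    ∑-+ []       f g = refl
    ∑-+ (x ∷ xs) f g rewrite ∑-+ xs f g = interchange (f x) (g x) (∑ xs f) (∑ xs g)
      where
      interchange : ∀ a b c d → a + b + (c + d) ≡ a + c + (b + d)
      interchange = solve-∀

    ∑-*ˡ : ∀ (xs : List A) k f → ∑ xs (λ x → k * f x) ≡ k * ∑ xs f
    ∑-*ˡ []       k f = sym (*-zeroʳ k)
    ∑-*ˡ (x ∷ xs) k f rewrite ∑-*ˡ xs k f = sym (*-distribˡ-+ k (f x) (∑ xs f))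

    ∑-zero : ∀ (xs : List A) → ∑ xs (λ _ → 0) ≡ 0
    ∑-zero []       = refl
    ∑-zero (x ∷ xs) = ∑-zero xs

    ∑-const : ∀ (xs : List A) k → ∑ xs (λ _ → k) ≡ length xs * k
    ∑-const []       k = refl
    ∑-const (x ∷ xs) k = cong (k +_) (∑-const xs k)

  monomial-⊥ : ∀ {n} (x : Cube n) → monomial ⊥ x ≡ 1
  monomial-⊥ []      = refl
  monomial-⊥ (b ∷ x) = trans (+-identityʳ _) (monomial-⊥ x)

  monomial-⁅⁆ : ∀ {n} (i : Fin n) (x : Cube n) → monomial ⁅ i ⁆ x ≡ bit (lookup x i)
  monomial-⁅⁆ zero    (b ∷ x) = trans (cong (bit b *_) (monomial-⊥ x)) (*-identityʳ _)
  monomial-⁅⁆ (suc i) (b ∷ x) = trans (+-identityʳ _) (monomial-⁅⁆ i x)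

  monomial-∪ : ∀ {n} (S T : Subset n) (x : Cube n) →
               monomial (S ∪ T) x ≡ monomial S x * monomial T x
  monomial-∪ []      []      []      = refl
  monomial-∪ (s ∷ S) (t ∷ T) (b ∷ x) rewrite monomial-∪ S T x = begin
    factor (s ∨ t) * (monomial S x * monomial T x)         ≡⟨ cong (_* _) (factor-∨ s t b) ⟩
    factor s * factor t * (monomial S x * monomial T x)    ≡⟨ *-interchange (factor s) (factor t) (monomial S x) (monomial T x) ⟩
    factor s * monomial S x * (factor t * monomial T x)    ∎
    where
    open ≡-Reasoning
    factor : Bool → ℕ
    factor s = if s then bit b else 1
    factor-∨ : ∀ s t b → (if s ∨ t then bit b else 1) ≡ (if s then bit b else 1) * (if t then bit b else 1)
    factor-∨ false t     b     = sym (+-identityʳ _)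
    factor-∨ true  false b     = sym (*-identityʳ _)
    factor-∨ true  true  false = refl
    factor-∨ true  true  true  = refl

  card-∪ : ∀ {n} (S T : Subset n) → card (S ∪ T) ≤ card S + card T
  card-∪ []          []          = z≤n
  card-∪ (false ∷ S) (false ∷ T) = card-∪ S T
  card-∪ (false ∷ S) (true  ∷ T) = ≤-trans (s≤s (card-∪ S T)) (≤-reflexive (sym (+-suc _ _)))
  card-∪ (true  ∷ S) (false ∷ T) = s≤s (card-∪ S T)
  card-∪ (true  ∷ S) (true  ∷ T) = s≤s (≤-trans (card-∪ S T) (+-monoʳ-≤ (card S) (n≤1+n _)))

  -- A polynomial is the list of its monomials, repeated according to their coefficients.
  record HasDegree≤ {n} (d : ℕ) (F : Cube n → ℕ) : Set where
    constructor degree≤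
    field
      terms : List (Subset n)
      small : All (λ S → card S ≤ d) terms
      eval  : ∀ x → F x ≡ ∑ terms (λ S → monomial S x)

  module _ {n : ℕ} where

    degree-mono : ∀ {d e} {F : Cube n → ℕ} → d ≤ e → HasDegree≤ d F → HasDegree≤ e F
    degree-mono d≤e (degree≤ Ss small eval) = degree≤ Ss (All.map (λ ≤d → ≤-trans ≤d d≤e) small) eval

    degree-const : ∀ {d} k → HasDegree≤ {n} d (λ _ → k)
    degree-const {d} k = degree≤ (replicate k ⊥)
      (replicate⁺ k (subst (_≤ d) (sym (∣⊥∣≡0 n)) z≤n)) λ x → sym (lemma x k)
      where
      lemma : ∀ (x : Cube n) k → ∑ (replicate k ⊥) (λ S → monomial S x) ≡ k
      lemma x zero    = refl
      lemma x (suc k) = cong₂ _+_ (monomial-⊥ x) (lemma x k)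

    degree-bit : ∀ i → HasDegree≤ {n} 1 (λ x → bit (lookup x i))
    degree-bit i = degree≤ (⁅ i ⁆ ∷ []) (≤-reflexive (∣⁅x⁆∣≡1 i) ∷ [])
      λ x → trans (sym (monomial-⁅⁆ i x)) (sym (+-identityʳ _))

    degree-+ : ∀ {d} {F G : Cube n → ℕ} → HasDegree≤ d F → HasDegree≤ d G → HasDegree≤ d (λ x → F x + G x)
    degree-+ (degree≤ Ss small eval) (degree≤ Ts small′ eval′) =
      degree≤ (Ss ++ Ts) (++⁺ small small′)
        λ x → trans (cong₂ _+_ (eval x) (eval′ x)) (sym (∑-++ Ss Ts _))

    degree-∑ : ∀ {d} {I : Set} {F : I → Cube n → ℕ} (is : List I) →
               All (λ i → HasDegree≤ d (F i)) is → HasDegree≤ d (λ x → ∑ is (λ i → F i x))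
    degree-∑ []       []         = degree-const 0
    degree-∑ (i ∷ is) (Fi ∷ Fis) = degree-+ Fi (degree-∑ is Fis)

    degree-* : ∀ {d e} {F G : Cube n → ℕ} → HasDegree≤ d F → HasDegree≤ e G →
               HasDegree≤ (d + e) (λ x → F x * G x)
    degree-* {d} {e} (degree≤ Ss small eval) (degree≤ Ts small′ eval′) =
      degree≤ (products Ss) (products-small Ss small)
        λ x → trans (cong₂ _*_ (eval x) (eval′ x)) (sym (products-eval x Ss))
      where
      products : List (Subset n) → List (Subset n)
      products []       = []
      products (S ∷ Ss) = map (S ∪_) Ts ++ products Ss
      products-small : ∀ Ss → All (λ S → card S ≤ d) Ss → All (λ S → card S ≤ d + e) (products Ss)
      products-small []       []       = []
      products-small (S ∷ Ss) (≤d ∷ ≤ds) = ++⁺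
        (map⁺ (All.map (λ {T} ≤e → ≤-trans (card-∪ S T) (+-mono-≤ ≤d ≤e)) small′))
        (products-small Ss ≤ds)
      products-eval : ∀ x Ss → ∑ (products Ss) (λ S → monomial S x)
                      ≡ ∑ Ss (λ S → monomial S x) * ∑ Ts (λ T → monomial T x)
      products-eval x []       = refl
      products-eval x (S ∷ Ss) = begin
        ∑ (map (S ∪_) Ts ++ products Ss) mon         ≡⟨ ∑-++ (map (S ∪_) Ts) (products Ss) mon ⟩
        ∑ (map (S ∪_) Ts) mon + ∑ (products Ss) mon  ≡⟨ cong₂ _+_ (∑-map (S ∪_) Ts mon) (products-eval x Ss) ⟩
        ∑ Ts (mon ∘ (S ∪_)) + ∑ Ss mon * ∑ Ts mon    ≡⟨ cong (_+ ∑ Ss mon * ∑ Ts mon) (∑-cong Ts λ T → monomial-∪ S T x) ⟩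
        ∑ Ts (λ T → mon S * mon T) + ∑ Ss mon * ∑ Ts mon ≡⟨ cong (_+ ∑ Ss mon * ∑ Ts mon) (∑-*ˡ Ts (mon S) mon) ⟩
        mon S * ∑ Ts mon + ∑ Ss mon * ∑ Ts mon       ≡⟨ *-distribʳ-+ (∑ Ts mon) (mon S) (∑ Ss mon) ⟨
        (mon S + ∑ Ss mon) * ∑ Ts mon                ∎
        where
        open ≡-Reasoning
        mon : Subset n → ℕ
        mon S = monomial S x

    degree-^ : ∀ {d} {F : Cube n → ℕ} k → HasDegree≤ d F → HasDegree≤ (k * d) (λ x → F x ^ k)
    degree-^ zero    F≤d = degree-const 1
    degree-^ (suc k) F≤d = degree-* F≤d (degree-^ k F≤d)

    degree-∏ : ∀ {d} {I : Set} {F : I → Cube n → ℕ} (is : List I) →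
               All (λ i → HasDegree≤ d (F i)) is →
               HasDegree≤ (length is * d) (λ x → foldr (λ i → F i x *_) 1 is)
    degree-∏ []       []         = degree-const 1
    degree-∏ (i ∷ is) (Fi ∷ Fis) = degree-* Fi (degree-∏ is Fis)


  -- Coefficients indexed by subsets, from lists of monomials

  _==_ : ∀ {n} → Subset n → Subset n → Bool
  []          == []          = true
  (false ∷ S) == (false ∷ T) = S == T
  (false ∷ S) == (true  ∷ T) = false
  (true  ∷ S) == (false ∷ T) = false
  (true  ∷ S) == (true  ∷ T) = S == T

  ==-card : ∀ {n} (S T : Subset n) → S == T ≡ true → card S ≡ card T
  ==-card []          []          _  = refl
  ==-card (false ∷ S) (false ∷ T) eq = ==-card S T eq
  ==-card (true  ∷ S) (true  ∷ T) eq = cong suc (==-card S T eq)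

  ∑-== : ∀ {n} (T : Subset n) (g : Subset n → ℕ) → ∑ (bitVectors n) (λ S → bit (S == T) * g S) ≡ g T
  ∑-== {zero}  []      g = trans (+-identityʳ _) (+-identityʳ _)
  ∑-== {suc n} (b ∷ T) g = begin
    ∑ (map (false ∷_) Ss ++ map (true ∷_) Ss) h          ≡⟨ ∑-++ (map (false ∷_) Ss) _ h ⟩
    ∑ (map (false ∷_) Ss) h + ∑ (map (true ∷_) Ss) h     ≡⟨ cong₂ _+_ (∑-map (false ∷_) Ss h) (∑-map (true ∷_) Ss h) ⟩
    ∑ Ss (h ∘ (false ∷_)) + ∑ Ss (h ∘ (true ∷_))         ≡⟨ halves b ⟩
    g (b ∷ T)                                            ∎
    where
    open ≡-Reasoning
    Ss = bitVectors n
    h : Subset (suc n) → ℕ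
    h S = bit (S == (b ∷ T)) * g S
    halves : ∀ b → ∑ Ss (λ S → bit ((false ∷ S) == (b ∷ T)) * g (false ∷ S))
                 + ∑ Ss (λ S → bit ((true ∷ S) == (b ∷ T)) * g (true ∷ S)) ≡ g (b ∷ T)
    halves false = trans (cong₂ _+_ (∑-== T (g ∘ (false ∷_))) (∑-zero Ss)) (+-identityʳ _)
    halves true  = cong₂ _+_ (∑-zero Ss) (∑-== T (g ∘ (true ∷_)))

  ∑-filter : ∀ {n} d (Ss : List (Subset n)) (g : Subset n → ℕ) → (∀ S → ¬ card S ≤ d → g S ≡ 0) →
             ∑ (filter (λ S → card S ≤? d) Ss) g ≡ ∑ Ss g
  ∑-filter d []       g vanish = refl
  ∑-filter d (S ∷ Ss) g vanish with card S ≤? d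
  ... | yes ≤d = trans (cong (λ Ts → ∑ Ts g) (filter-accept (λ S → card S ≤? d) {S} {Ss} ≤d))
                         (cong (g S +_) (∑-filter d Ss g vanish))
  ... | no ≰d  = trans (cong (λ Ts → ∑ Ts g) (filter-reject (λ S → card S ≤? d) {S} {Ss} ≰d))
                         (trans (∑-filter d Ss g vanish) (cong (_+ ∑ Ss g) (sym (vanish S ≰d))))

  coefficient : ∀ {n} → List (Subset n) → Subset n → ℕ
  coefficient Ts S = ∑ Ts (λ T → bit (S == T))

  -- Brings a list of monomials into the shape of `evalTorus`, which sums over all sets of at most
  -- `d` elements. The coefficient of a set is its multiplicity in the list, so each `T` contributes
  -- one Kronecker delta, and the filter removes none of them.
  ∑-coefficient : ∀ {n} d (Ts : List (Subset n)) → All (λ T → card T ≤ d) Ts → (g : Subset n → ℕ) →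
                  ∑ (filter (λ S → card S ≤? d) (bitVectors n)) (λ S → coefficient Ts S * g S) ≡ ∑ Ts g
  ∑-coefficient {n} d []       []         g = ∑-zero (filter (λ S → card S ≤? d) (bitVectors n))
  ∑-coefficient {n} d (T ∷ Ts) (≤d ∷ ≤ds) g = begin
    ∑ Ss (λ S → (bit (S == T) + coefficient Ts S) * g S)                ≡⟨ ∑-cong Ss (λ S → *-distribʳ-+ (g S) (bit (S == T)) (coefficient Ts S)) ⟩
    ∑ Ss (λ S → bit (S == T) * g S + coefficient Ts S * g S)            ≡⟨ ∑-+ Ss _ _ ⟩
    ∑ Ss (λ S → bit (S == T) * g S) + ∑ Ss (λ S → coefficient Ts S * g S) ≡⟨ cong₂ _+_ (trans (∑-filter d (bitVectors n) _ vanish) (∑-== T g)) (∑-coefficient d Ts ≤ds g) ⟩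
    g T + ∑ Ts g                                                        ∎
    where
    open ≡-Reasoning
    Ss = filter (λ S → card S ≤? d) (bitVectors n)
    vanish : ∀ S → ¬ card S ≤ d → bit (S == T) * g S ≡ 0
    vanish S ≰d with S == T in eq
    ... | false = refl
    ... | true  = contradiction (subst (_≤ d) (sym (==-card S T eq)) ≤d) ≰d

  -- Arithmetic modulo p and p ^ k

  infix 4 _≡_[mod_]
  -- A record, so that unification recovers both sides and the modulus.
  record _≡_[mod_] (a b m : ℕ) .{{_ : NonZero m}} : Set where
    constructor sameRemainder
    field
      remainders : a % m ≡ b % m

  module _ {m : ℕ} .{{_ : NonZero m}} where

    mod-refl : ∀ {a} → a ≡ a [mod m ]
    mod-refl = sameRemainder refl

    mod-reflexive : ∀ {a b} → a ≡ b → a ≡ b [mod m ]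
    mod-reflexive refl = mod-refl

    mod-sym : ∀ {a b} → a ≡ b [mod m ] → b ≡ a [mod m ]
    mod-sym (sameRemainder eq) = sameRemainder (sym eq)

    mod-trans : ∀ {a b c} → a ≡ b [mod m ] → b ≡ c [mod m ] → a ≡ c [mod m ]
    mod-trans (sameRemainder eq) (sameRemainder eq′) = sameRemainder (trans eq eq′)

    mod-+ : ∀ {a b c d} → a ≡ b [mod m ] → c ≡ d [mod m ] → a + c ≡ b + d [mod m ]
    mod-+ {a} {b} {c} {d} (sameRemainder a≡b) (sameRemainder c≡d) = sameRemainder (begin
      (a + c) % m         ≡⟨ %-distribˡ-+ a c m ⟩
      (a % m + c % m) % m ≡⟨ cong₂ (λ u v → (u + v) % m) a≡b c≡d ⟩
      (b % m + d % m) % m ≡⟨ %-distribˡ-+ b d m ⟨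
      (b + d) % m         ∎)
      where open ≡-Reasoning

    mod-* : ∀ {a b c d} → a ≡ b [mod m ] → c ≡ d [mod m ] → a * c ≡ b * d [mod m ]
    mod-* {a} {b} {c} {d} (sameRemainder a≡b) (sameRemainder c≡d) = sameRemainder (begin
      (a * c) % m           ≡⟨ %-distribˡ-* a c m ⟩
      (a % m * (c % m)) % m ≡⟨ cong₂ (λ u v → (u * v) % m) a≡b c≡d ⟩
      (b % m * (d % m)) % m ≡⟨ %-distribˡ-* b d m ⟨
      (b * d) % m           ∎)
      where open ≡-Reasoning

    mod-+ˡ : ∀ k {a b} → a ≡ b [mod m ] → k + a ≡ k + b [mod m ]
    mod-+ˡ k = mod-+ (mod-refl {k})

    mod-*ˡ : ∀ k {a b} → a ≡ b [mod m ] → k * a ≡ k * b [mod m ]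
    mod-*ˡ k = mod-* (mod-refl {k})

    mod-^ : ∀ {a b} k → a ≡ b [mod m ] → a ^ k ≡ b ^ k [mod m ]
    mod-^ zero    a≡b = mod-refl
    mod-^ (suc k) a≡b = mod-* a≡b (mod-^ k a≡b)

    mod-∑ : ∀ {I : Set} {f g : I → ℕ} (is : List I) → All (λ i → f i ≡ g i [mod m ]) is →
            ∑ is f ≡ ∑ is g [mod m ]
    mod-∑ []       []            = mod-refl
    mod-∑ (i ∷ is) (fi≡gi ∷ eqs) = mod-+ fi≡gi (mod-∑ is eqs)

    ∣⇒≡0 : ∀ {a} → m ∣ a → a ≡ 0 [mod m ]
    ∣⇒≡0 m∣a = sameRemainder (trans (n∣m⇒m%n≡0 _ m m∣a) (sym (n∣m⇒m%n≡0 0 m (m ∣0))))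

    ≡0⇒∣ : ∀ {a} → a ≡ 0 [mod m ] → m ∣ a
    ≡0⇒∣ (sameRemainder a≡0) = m%n≡0⇒n∣m _ m (trans a≡0 (n∣m⇒m%n≡0 0 m (m ∣0)))

    mod-∣ : ∀ {a b} → a ≡ b [mod m ] → m ∣ b → m ∣ a
    mod-∣ a≡b m∣b = ≡0⇒∣ (mod-trans a≡b (∣⇒≡0 m∣b))

    mod-+* : ∀ {a} k → a + k * m ≡ a [mod m ]
    mod-+* {a} k = sameRemainder ([m+kn]%n≡m%n a k m)

  -- 1 - y modulo m
  complement : ℕ → ℕ → ℕ
  complement m y = 1 + pred m * y

  module _ {m : ℕ} .{{_ : NonZero m}} where

    complement-cong : ∀ {a b} → a ≡ b [mod m ] → complement m a ≡ complement m b [mod m ]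
    complement-cong a≡b = mod-+ˡ 1 (mod-*ˡ (pred m) a≡b)

    complement-1 : complement m 1 ≡ 0 [mod m ]
    complement-1 = ∣⇒≡0 (subst (m ∣_) (sym (trans (cong suc (*-identityʳ (pred m))) (suc-pred m))) ∣-refl)

    complement-0 : complement m 0 ≡ 1 [mod m ]
    complement-0 = mod-reflexive (cong suc (*-zeroʳ (pred m)))

    complement-bit : ∀ b {a} → a ≡ bit b [mod m ] → complement m a ≡ bit (not b) [mod m ]
    complement-bit false a≡ = mod-trans (complement-cong a≡) complement-0
    complement-bit true  a≡ = mod-trans (complement-cong a≡) complement-1

  degree-complement : ∀ {n d} m {F : Cube n → ℕ} → HasDegree≤ d F → HasDegree≤ d (complement m ∘ F)
  degree-complement m F≤d = degree-+ (degree-const 1) (degree-* {d = 0} (degree-const (pred m)) F≤d)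

  ∣-^ : ∀ {a b} k → a ∣ b → a ^ k ∣ b ^ k
  ∣-^ zero    a∣b = ∣-refl
  ∣-^ (suc k) a∣b = *-pres-∣ a∣b (∣-^ k a∣b)

  -- 1 - (1 - y ^ k) ^ k lifts the values 0 and 1 modulo p to modulus p ^ k.
  module Amplification (p : ℕ) .{{_ : NonZero p}} (k : ℕ) where

    instance
      p^k≢0 : NonZero (p ^ suc k)
      p^k≢0 = m^n≢0 p (suc k)

    amplify : ℕ → ℕ
    amplify y = complement (p ^ suc k) (complement (p ^ suc k) (y ^ suc k) ^ suc k)

    -- If `p` divides `y`, then `p ^ suc k` divides `y ^ suc k`. If `y ≡ 1`, then `p` divides 1 -
    -- `y ^ suc k`, and the outer power makes this a multiple of `p ^ suc k`.
    amplify-bit : ∀ b {y} → y ≡ bit b [mod p ] → amplify y ≡ bit b [mod p ^ suc k ]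
    amplify-bit false y≡0 = mod-trans
      (complement-cong (mod-^ (suc k) (mod-trans (complement-cong (∣⇒≡0 (∣-^ (suc k) (≡0⇒∣ y≡0)))) complement-0)))
      (mod-trans (mod-reflexive (cong (complement (p ^ suc k)) (^-zeroˡ (suc k)))) complement-1)
    amplify-bit true {y} y≡1 = mod-trans (complement-cong (∣⇒≡0 (∣-^ (suc k) p∣))) complement-0
      where
      M = p ^ suc k
      y^k≡1 : y ^ suc k ≡ 1 [mod p ]
      y^k≡1 = mod-trans (mod-^ (suc k) y≡1) (mod-reflexive (^-zeroˡ (suc k)))
      p∣ : p ∣ complement M (y ^ suc k)
      p∣ = mod-∣ (mod-+ˡ 1 (mod-*ˡ (pred M) y^k≡1))
        (subst (p ∣_) (sym (trans (cong suc (*-identityʳ (pred M))) (suc-pred M))) (m∣m*n (p ^ k)))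

    degree-amplify : ∀ {n d} {F : Cube n → ℕ} → HasDegree≤ d F →
                     HasDegree≤ (suc k * (suc k * d)) (amplify ∘ F)
    degree-amplify F≤d =
      degree-complement (p ^ suc k) (degree-^ (suc k) (degree-complement (p ^ suc k) (degree-^ (suc k) F≤d)))

  -- A polynomial that tests for zero modulo a prime

  rising : ℕ → ℕ → ℕ
  rising y zero    = 1
  rising y (suc k) = (y + suc k) * rising y k

  ∣-rising : ∀ y a k → a < k → y + suc a ∣ rising y k
  ∣-rising y a (suc k) a<1+k with m≤n⇒m<n∨m≡n (s≤s⁻¹ a<1+k)
  ... | inj₁ a<k  = ∣n⇒∣m*n (y + suc k) (∣-rising y a k a<k)
  ... | inj₂ refl = m∣m*n (rising y k)

  degree-rising : ∀ {n d} {F : Cube n → ℕ} k → HasDegree≤ d F → HasDegree≤ (k * d) (λ x → rising (F x) k)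
  degree-rising zero    F≤d = degree-const 1
  degree-rising (suc k) F≤d = degree-* (degree-+ F≤d (degree-const (suc k))) (degree-rising k F≤d)

  module ModPrime (p : ℕ) (p-prime : Prime p) where

    instance
      p≢0 : NonZero p
      p≢0 = prime⇒nonZero p-prime

    1<p : 1 < p
    1<p = nonTrivial⇒n>1 p {{prime⇒nonTrivial p-prime}}

    p∤1 : ¬ p ∣ 1
    p∤1 p∣1 = <-irrefl refl (<-≤-trans 1<p (∣⇒≤ p∣1))

    p∤factorial : ∀ k → k < p → ¬ p ∣ rising 0 k
    p∤factorial zero    _   p∣1 = p∤1 p∣1
    p∤factorial (suc k) k<p p∣ with euclidsLemma (suc k) (rising 0 k) p-prime p∣
    ... | inj₁ p∣k = <-irrefl refl (<-≤-trans k<p (∣⇒≤ p∣k))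
    ... | inj₂ p∣! = p∤factorial k (<-trans (n<1+n k) k<p) p∣!

    inverse : ∀ r → ¬ p ∣ r → ∃[ c ] c * r ≡ 1 [mod p ]
    inverse r p∤r = from (coprime-Bézout coprime)
      where
      coprime : Coprime r p
      coprime (d∣r , d∣p) with prime⇒irreducible p-prime d∣p
      ... | inj₁ d≡1  = d≡1
      ... | inj₂ refl = contradiction d∣r p∤r
      from : Bézout.Identity 1 r p → ∃[ c ] c * r ≡ 1 [mod p ]
      from (Bézout.+- x y 1+yp≡xr) = x , mod-trans (mod-reflexive (sym 1+yp≡xr)) (mod-+* y)
      -- Here `x * r` is -1 modulo `p`, and `pred p` stands for the missing sign.
      from (Bézout.-+ x y 1+xr≡yp) = pred p * x ,
        mod-trans (mod-sym (mod-+* 1)) (mod-trans (mod-reflexive eq) (mod-+* (pred p * y)))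
        where
        rearrange : ∀ q x r → q * x * r + 1 * suc q ≡ 1 + q * (1 + x * r)
        rearrange = solve-∀
        eq : pred p * x * r + 1 * p ≡ 1 + pred p * y * p
        eq = begin
          pred p * x * r + 1 * p            ≡⟨ cong (λ q → pred p * x * r + 1 * q) (suc-pred p) ⟨
          pred p * x * r + 1 * suc (pred p) ≡⟨ rearrange (pred p) x r ⟩
          1 + pred p * (1 + x * r)          ≡⟨ cong (λ q → 1 + pred p * q) 1+xr≡yp ⟩
          1 + pred p * (y * p)              ≡⟨ cong suc (*-assoc (pred p) y p) ⟨
          1 + pred p * y * p                ∎
          where open ≡-Reasoning

    abstract
      scale : ∃[ c ] c * rising 0 (pred p) ≡ 1 [mod p ]
      scale = inverse _ (p∤factorial (pred p) (≤-reflexive (suc-pred p)))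

    -- The product (y + 1) ... (y + p - 1), scaled by the inverse of (p - 1)!. It contains a
    -- multiple of `p` unless `p` divides `y`, in which case it is congruent to (p - 1)!. It has the
    -- values and the degree of 1 - y ^ (p - 1).
    zeroTest : ℕ → ℕ
    zeroTest y = proj₁ scale * rising y (pred p)

    zeroTest-∣ : ∀ {y} → p ∣ y → zeroTest y ≡ 1 [mod p ]
    zeroTest-∣ {y} p∣y = mod-trans (mod-*ˡ (proj₁ scale) (rising≡ (pred p))) (proj₂ scale)
      where
      rising≡ : ∀ k → rising y k ≡ rising 0 k [mod p ]
      rising≡ zero    = mod-refl
      rising≡ (suc k) = mod-* (mod-+ (∣⇒≡0 p∣y) mod-refl) (rising≡ k)

    zeroTest-∤ : ∀ {y} → ¬ p ∣ y → zeroTest y ≡ 0 [mod p ]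
    zeroTest-∤ {y} p∤y = ∣⇒≡0 (∣n⇒∣m*n (proj₁ scale)
        (∣-trans p∣y+a (subst (λ a → y + a ∣ rising y (pred p)) (suc-pred a {{a≢0}}) (∣-rising y (pred a) (pred p) a<p))))
      where
      r = y % p
      0<r : 0 < r
      0<r = n≢0⇒n>0 (λ r≡0 → p∤y (m%n≡0⇒n∣m y p r≡0))
      -- The factor `y + a` of the product is the multiple of `p`; `0 < r` gives `a < p`, so that it
      -- does occur among the p - 1 factors.
      a = p ∸ r
      a≢0 : NonZero a
      a≢0 = >-nonZero (m<n⇒0<n∸m (m%n<n y p))
      a<p : pred a < pred p
      a<p = pred-mono-< {{a≢0}} (∸-monoʳ-< {p} {r} {0} 0<r (<⇒≤ (m%n<n y p)))
      p∣y+a : p ∣ y + a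
      p∣y+a = subst (p ∣_) (sym (begin
        y + a                     ≡⟨ cong (_+ a) (m≡m%n+[m/n]*n y p) ⟩
        r + y / p * p + a         ≡⟨ +-assoc r _ a ⟩
        r + (y / p * p + a)       ≡⟨ cong (r +_) (+-comm _ a) ⟩
        r + (a + y / p * p)       ≡⟨ +-assoc r a _ ⟨
        r + a + y / p * p         ≡⟨ cong (_+ y / p * p) (m+[n∸m]≡n (<⇒≤ (m%n<n y p))) ⟩
        p + y / p * p             ∎)) (∣m∣n⇒∣m+n ∣-refl (n∣m*n (y / p)))
        where open ≡-Reasoning

    divides? : ℕ → Bool
    divides? y = does (p ∣? y)

    zeroTest-bit : ∀ y → zeroTest y ≡ bit (divides? y) [mod p ]
    zeroTest-bit y with p ∣? y
    ... | yes p∣y = zeroTest-∣ p∣y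
    ... | no  p∤y = zeroTest-∤ p∤y

    divides?-cong : ∀ {a b} → a ≡ b [mod p ] → divides? a ≡ divides? b
    divides?-cong {a} {b} a≡b with p ∣? a | p ∣? b
    ... | yes _   | yes _   = refl
    ... | yes p∣a | no  p∤b = contradiction (mod-∣ (mod-sym a≡b) p∣a) p∤b
    ... | no  p∤a | yes p∣b = contradiction (mod-∣ a≡b p∣b) p∤a
    ... | no  _   | no  _   = refl

    degree-zeroTest : ∀ {n d} {F : Cube n → ℕ} → HasDegree≤ d F → HasDegree≤ (pred p * d) (zeroTest ∘ F)
    degree-zeroTest F≤d = degree-* {d = 0} (degree-const (proj₁ scale)) (degree-rising (pred p) F≤d)

  -- Random sublists

  module RandomSums (p : ℕ) (p-prime : Prime p) {A I : Set} (X : List A) (v : I → A → Bool) where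
    open ModPrime p p-prime

    some : List I → A → Bool
    some is x = or (map (λ i → v i x) is)

    selected : List I → A → ℕ
    selected js x = ∑ js (λ j → bit (v j x))

    -- The number of sublists js of is with p ∣ o + selected js x.
    misses : List I → ℕ → A → ℕ
    misses []       o x = bit (divides? o)
    misses (i ∷ is) o x = misses is o x + misses is (o + bit (v i x)) x

    twice : ∀ k → k + k ≡ 2 * k
    twice k = cong (k +_) (sym (+-identityʳ k))

    misses≤2^ : ∀ is o x → misses is o x ≤ 2 ^ length is
    misses≤2^ []       o x = bit≤1 (divides? o)
    misses≤2^ (i ∷ is) o x = ≤-trans
      (+-mono-≤ (misses≤2^ is o x) (misses≤2^ is (o + bit (v i x)) x)) (≤-reflexive (twice (2 ^ length is)))

    misses-none : ∀ is o x → some is x ≡ false → misses is o x ≡ 2 ^ length is * bit (divides? o)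
    misses-none []       o x none = sym (+-identityʳ _)
    misses-none (i ∷ is) o x none with v i x
    ... | false rewrite +-identityʳ o = begin
      misses is o x + misses is o x             ≡⟨ twice (misses is o x) ⟩
      2 * misses is o x                         ≡⟨ cong (2 *_) (misses-none is o x none) ⟩
      2 * (2 ^ length is * bit (divides? o))    ≡⟨ *-assoc 2 (2 ^ length is) _ ⟨
      2 * 2 ^ length is * bit (divides? o)      ∎
      where open ≡-Reasoning

    consecutive : ∀ o → bit (divides? o) + bit (divides? (o + 1)) ≤ 1
    consecutive o with p ∣? o | p ∣? (o + 1)
    ... | no  _   | no  _    = z≤n
    ... | no  _   | yes _    = ≤-refl
    ... | yes _   | no  _    = ≤-refl
    ... | yes p∣o | yes p∣o+1 = contradiction (∣m+n∣m⇒∣n p∣o+1 p∣o) p∤1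

    -- If a bit after `i` is on, the bound already holds for either decision about `i`, which only
    -- changes the offset; hence the arbitrary `o`. Otherwise `i` is the only bit that is on: the
    -- sum takes just the values `o` and `o + 1`, each for half of the sublists, and `p` divides at
    -- most one of two consecutive numbers.
    misses-half : ∀ is o x → some is x ≡ true → 2 * misses is o x ≤ 2 ^ length is
    misses-half (i ∷ is) o x any with some is x in eq
    ... | true = begin
      2 * (misses is o x + misses is (o + bit (v i x)) x)    ≡⟨ *-distribˡ-+ 2 (misses is o x) _ ⟩
      2 * misses is o x + 2 * misses is (o + bit (v i x)) x  ≤⟨ +-mono-≤ (misses-half is o x eq) (misses-half is _ x eq) ⟩
      2 ^ length is + 2 ^ length is                          ≡⟨ twice (2 ^ length is) ⟩
      2 * 2 ^ length is                                      ∎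
      where open ≤-Reasoning
    ... | false with v i x
    ...   | true rewrite misses-none is o x eq | misses-none is (o + 1) x eq = *-monoʳ-≤ 2 (begin
      2 ^ length is * bit (divides? o) + 2 ^ length is * bit (divides? (o + 1)) ≡⟨ *-distribˡ-+ (2 ^ length is) _ _ ⟨
      2 ^ length is * (bit (divides? o) + bit (divides? (o + 1))) ≤⟨ *-monoʳ-≤ (2 ^ length is) (consecutive o) ⟩
      2 ^ length is * 1 ≡⟨ *-identityʳ _ ⟩
      2 ^ length is ∎)
      where open ≤-Reasoning

    -- The method of conditional expectations: fix the bits of the sublist one at
    -- a time, never increasing the expected weight of the misses.
    derandomize : ∀ is (w o : A → ℕ) → Σ[ js ∈ List I ] All (_∈ is) js ×
      2 ^ length is * ∑ X (λ x → w x * bit (divides? (o x + selected js x))) ≤ ∑ X (λ x → w x * misses is (o x) x)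
    derandomize [] w o = [] , [] , ≤-reflexive (trans (+-identityʳ _)
      (∑-cong X λ x → cong (λ s → w x * bit (divides? s)) (+-identityʳ (o x))))
    derandomize (i ∷ is) w o with derandomize is w o | derandomize is w (λ x → o x + bit (v i x))
    ... | js₀ , js₀⊆ , ≤₀ | js₁ , js₁⊆ , ≤₁ =
      choose (≤-total (∑ X (λ x → w x * misses is (o x) x)) (∑ X (λ x → w x * misses is (o x + bit (v i x)) x)))
      where
      open ≤-Reasoning
      E₀ = ∑ X (λ x → w x * misses is (o x) x)
      E₁ = ∑ X (λ x → w x * misses is (o x + bit (v i x)) x)
      split : ∑ X (λ x → w x * misses (i ∷ is) (o x) x) ≡ E₀ + E₁
      split = trans (∑-cong X λ x → *-distribˡ-+ (w x) (misses is (o x) x) _) (∑-+ X _ _)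
      choose : E₀ ≤ E₁ ⊎ E₁ ≤ E₀ → Σ[ js ∈ List I ] All (_∈ i ∷ is) js ×
        2 ^ suc (length is) * ∑ X (λ x → w x * bit (divides? (o x + selected js x))) ≤ ∑ X (λ x → w x * misses (i ∷ is) (o x) x)
      choose (inj₁ E₀≤E₁) = js₀ , All.map there js₀⊆ , (begin
        2 * 2 ^ length is * F  ≡⟨ *-assoc 2 (2 ^ length is) F ⟩
        2 * (2 ^ length is * F) ≤⟨ *-monoʳ-≤ 2 ≤₀ ⟩
        2 * E₀                  ≡⟨ twice E₀ ⟨
        E₀ + E₀                 ≤⟨ +-monoʳ-≤ E₀ E₀≤E₁ ⟩
        E₀ + E₁                 ≡⟨ split ⟨
        ∑ X (λ x → w x * misses (i ∷ is) (o x) x) ∎)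
        where F = ∑ X (λ x → w x * bit (divides? (o x + selected js₀ x)))
      choose (inj₂ E₁≤E₀) = i ∷ js₁ , here refl ∷ All.map there js₁⊆ , (begin
        2 * 2 ^ length is * ∑ X (λ x → w x * bit (divides? (o x + (bit (v i x) + selected js₁ x))))
                                ≡⟨ cong (2 * 2 ^ length is *_) (∑-cong X λ x → cong (λ s → w x * bit (divides? s)) (sym (+-assoc (o x) _ _))) ⟩
        2 * 2 ^ length is * F   ≡⟨ *-assoc 2 (2 ^ length is) F ⟩
        2 * (2 ^ length is * F) ≤⟨ *-monoʳ-≤ 2 ≤₁ ⟩
        2 * E₁                  ≡⟨ twice E₁ ⟨
        E₁ + E₁                 ≤⟨ +-monoˡ-≤ E₁ E₁≤E₀ ⟩
        E₀ + E₁                 ≡⟨ split ⟨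
        ∑ X (λ x → w x * misses (i ∷ is) (o x) x) ∎)
        where F = ∑ X (λ x → w x * bit (divides? (o x + bit (v i x) + selected js₁ x)))

    oneTest : ∀ is (w : A → ℕ) → (∀ x → some is x ≡ false → w x ≡ 0) → Σ[ js ∈ List I ] All (_∈ is) js ×
      2 * ∑ X (λ x → w x * bit (divides? (selected js x))) ≤ ∑ X w
    oneTest is w supported with derandomize is w (λ _ → 0)
    ... | js , js⊆ , bound = js , js⊆ , *-cancelˡ-≤ (2 ^ length is) {{m^n≢0 2 (length is)}} (begin
      2 ^ length is * (2 * F)                   ≡⟨ swap (2 ^ length is) F ⟩
      2 * (2 ^ length is * F)                   ≤⟨ *-monoʳ-≤ 2 bound ⟩
      2 * ∑ X (λ x → w x * misses is 0 x)       ≡⟨ ∑-*ˡ X 2 _ ⟨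
      ∑ X (λ x → 2 * (w x * misses is 0 x))     ≤⟨ ∑-mono X pointwise ⟩
      ∑ X (λ x → 2 ^ length is * w x)           ≡⟨ ∑-*ˡ X (2 ^ length is) w ⟩
      2 ^ length is * ∑ X w                     ∎)
      where
      open ≤-Reasoning
      F = ∑ X (λ x → w x * bit (divides? (selected js x)))
      swap : ∀ a b → a * (2 * b) ≡ 2 * (a * b)
      swap = solve-∀
      rearrange : ∀ a b → 2 * (a * b) ≡ 2 * b * a
      rearrange = solve-∀
      pointwise : ∀ x → 2 * (w x * misses is 0 x) ≤ 2 ^ length is * w x
      pointwise x with some is x in eq
      ... | false rewrite supported x eq = z≤n
      ... | true  = ≤-trans (≤-reflexive (rearrange (w x) _)) (*-monoˡ-≤ (w x) (misses-half is 0 x eq))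

    allZero : List (List I) → A → Bool
    allZero Js x = and (map (λ js → divides? (selected js x)) Js)

    -- Each sublist is chosen against the weight that survived the previous ones, so each halves
    -- what is left. The surviving weight is still supported where the OR is true.
    tests : ∀ t is (w : A → ℕ) → (∀ x → some is x ≡ false → w x ≡ 0) →
      Σ[ Js ∈ List (List I) ] length Js ≡ t × All (All (_∈ is)) Js ×
      2 ^ t * ∑ X (λ x → w x * bit (allZero Js x)) ≤ ∑ X w
    tests zero    is w supported = [] , refl , [] ,
      ≤-reflexive (trans (+-identityʳ _) (∑-cong X λ x → *-identityʳ (w x)))
    tests (suc t) is w supported with oneTest is w supported
    ... | js , js⊆ , bound₁ with tests t is (λ x → w x * bit (divides? (selected js x)))
                                   (λ x none → cong (_* bit (divides? (selected js x))) (supported x none))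
    ...   | Js , len , Js⊆ , bound = js ∷ Js , cong suc len , js⊆ ∷ Js⊆ , (begin
      2 * 2 ^ t * ∑ X (λ x → w x * bit (divides? (selected js x) ∧ allZero Js x))
        ≡⟨ cong (2 * 2 ^ t *_) (∑-cong X λ x → trans (cong (w x *_) (bit-∧ (divides? (selected js x)) _)) (sym (*-assoc (w x) _ _))) ⟩
      2 * 2 ^ t * F                                         ≡⟨ *-assoc 2 (2 ^ t) F ⟩
      2 * (2 ^ t * F)                                       ≤⟨ *-monoʳ-≤ 2 bound ⟩
      2 * ∑ X (λ x → w x * bit (divides? (selected js x)))  ≤⟨ bound₁ ⟩
      ∑ X w                                                 ∎)
      where
      open ≤-Reasoning
      F = ∑ X (λ x → w x * bit (divides? (selected js x)) * bit (allZero Js x))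

    wrong : List I → List (List I) → A → Bool
    wrong is Js x = some is x ∧ allZero Js x

    -- Only points where the OR is true can be misjudged, so the tests are chosen for the
    -- restriction of `W` to them.
    orTests : ∀ t is (W : A → ℕ) → Σ[ Js ∈ List (List I) ] length Js ≡ t × All (All (_∈ is)) Js ×
      2 ^ t * ∑ X (λ x → W x * bit (wrong is Js x)) ≤ ∑ X W
    orTests t is W with tests t is (λ x → W x * bit (some is x)) (λ x none → trans (cong (λ b → W x * bit b) none) (*-zeroʳ (W x)))
    ... | Js , len , Js⊆ , bound = Js , len , Js⊆ , (begin
      2 ^ t * ∑ X (λ x → W x * bit (wrong is Js x))
        ≡⟨ cong (2 ^ t *_) (∑-cong X λ x → trans (cong (W x *_) (bit-∧ (some is x) _)) (sym (*-assoc (W x) _ _))) ⟩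
      2 ^ t * ∑ X (λ x → W x * bit (some is x) * bit (allZero Js x))  ≤⟨ bound ⟩
      ∑ X (λ x → W x * bit (some is x))   ≤⟨ ∑-mono X (λ x → *-monoʳ-≤ (W x) (bit≤1 (some is x))) ⟩
      ∑ X (λ x → W x * 1)                 ≡⟨ ∑-cong X (λ x → *-identityʳ (W x)) ⟩
      ∑ X W                               ∎)
      where open ≤-Reasoning

    -- The error is one-sided: where the OR is false, every selected bit is 0 because the sublists
    -- draw only on `is`, so all sums vanish.
    allZero-correct : ∀ is Js x → All (All (_∈ is)) Js → wrong is Js x ≡ false → allZero Js x ≡ not (some is x)
    allZero-correct is Js x Js⊆ right with some is x in eq
    ... | true  = right
    ... | false = vanishing Js Js⊆
      where
      off : ∀ is → some is x ≡ false → ∀ {j} → j ∈ is → bit (v j x) ≡ 0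
      off (i ∷ is) none (here refl) with v i x
      ... | false = refl
      off (i ∷ is) none (there j∈)  with v i x
      ... | false = off is none j∈
      sum≡0 : ∀ js → All (_∈ is) js → selected js x ≡ 0
      sum≡0 []       []         = refl
      sum≡0 (j ∷ js) (j∈ ∷ js⊆) = cong₂ _+_ (off is eq j∈) (sum≡0 js js⊆)
      divides-0 : divides? 0 ≡ true
      divides-0 with p ∣? 0
      ... | yes _  = refl
      ... | no p∤0 = contradiction (p ∣0) p∤0
      vanishing : ∀ Js → All (All (_∈ is)) Js → allZero Js x ≡ true
      vanishing []        []          = refl
      vanishing (js ∷ Js) (js⊆ ∷ Js⊆) rewrite sum≡0 js js⊆ | divides-0 = vanishing Js Js⊆

    -- A product of zero tests is 1 exactly when all sums vanish, so it approximates NOR; OR is its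
    -- complement, and AND is NOR of complemented inputs. The sublists come from the true bits `v`,
    -- while the sums are formed with polynomials `Q` that agree with them only at correct points.
    norPoly : (I → A → ℕ) → List (List I) → A → ℕ
    norPoly Q Js x = foldr (λ js → zeroTest (∑ js (λ j → Q j x)) *_) 1 Js

    norPoly-correct : ∀ Q is Js x → All (All (_∈ is)) Js → wrong is Js x ≡ false →
      (∀ i → Q i x ≡ bit (v i x) [mod p ]) → norPoly Q Js x ≡ bit (not (some is x)) [mod p ]
    norPoly-correct Q is Js x Js⊆ right Q≡v =
      subst (λ b → norPoly Q Js x ≡ bit b [mod p ]) (allZero-correct is Js x Js⊆ right) (product Js)
      where
      product : ∀ Js → norPoly Q Js x ≡ bit (allZero Js x) [mod p ]
      product []        = mod-refl
      product (js ∷ Js) = subst (norPoly Q (js ∷ Js) x ≡_[mod p ]) (sym (bit-∧ (divides? (selected js x)) (allZero Js x)))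
        (mod-* (mod-trans (zeroTest-bit (∑ js (λ j → Q j x)))
                          (mod-reflexive (cong bit (divides?-cong (mod-∑ js (All.universal Q≡v js))))))
               (product Js))

  -- Polynomials of circuits, and sampling

  module CircuitPolynomials (p : ℕ) (p-prime : Prime p) (t : ℕ) .{{_ : NonZero t}} where
    open ModPrime p p-prime

    -- The growth of the degree at one gate: `t` zero tests, each of degree p - 1.
    D : ℕ
    D = t * pred p

    instance
      pred-p≢0 : NonZero (pred p)
      pred-p≢0 = >-nonZero (pred-mono-< 1<p)
      D≢0 : NonZero D
      D≢0 = m*n≢0 t (pred p)

    depthOf : ∀ {w} → Vec ℕ w → List (Fin w) → ℕ
    depthOf δ is = foldr _⊔_ 0 (map (lookup δ) is)

    lookup≤depthOf : ∀ {w} (δ : Vec ℕ w) (is : List (Fin w)) {i} → i ∈ is → lookup δ i ≤ depthOf δ is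
    lookup≤depthOf δ (i ∷ is) (here refl) = m≤m⊔n _ _
    lookup≤depthOf δ (i ∷ is) (there i∈)  = ≤-trans (lookup≤depthOf δ is i∈) (m≤n⊔m (lookup δ i) _)

    not-or-not : ∀ {I : Set} (f : I → Bool) is → not (or (map (λ i → not (f i)) is)) ≡ and (map f is)
    not-or-not f []       = refl
    not-or-not f (i ∷ is) with f i
    ... | false = refl
    ... | true  = not-or-not f is

    module _ {n w : ℕ} (δ : Vec ℕ w) (Q : Fin w → Cube n → ℕ)
             (degree-Q : ∀ i → HasDegree≤ (D ^ lookup δ i) (Q i))
             (u : Cube n → Vec Bool w) (W : Cube n → ℕ) where

      private
        X = bitVectors n

      Correct : Cube n → Set
      Correct x = ∀ i → Q i x ≡ bit (lookup (u x) i) [mod p ]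

      -- `err` holds only the error of the gate's own sublists. They are chosen for the true wire
      -- values `u`, so `bound` does not involve the quality of `Q`; errors inherited from the
      -- inputs are excluded by `Correct` and accounted for at the gates where they arise.
      record GatePolynomial (g : Gate w) : Set where
        field
          poly    : Cube n → ℕ
          degree  : HasDegree≤ (D ^ suc (depthOf δ (fanIn g))) poly
          err     : Cube n → Bool
          correct : ∀ x → err x ≡ false → Correct x → poly x ≡ bit (gateValue p (u x) g) [mod p ]
          bound   : 2 ^ t * ∑ X (λ x → W x * bit (err x)) ≤ ∑ X W

      degree-fanIn : ∀ is → All (λ i → HasDegree≤ (D ^ depthOf δ is) (Q i)) is
      degree-fanIn is = All.tabulate λ {i} i∈ →
        degree-mono (^-monoʳ-≤ D (lookup≤depthOf δ is i∈)) (degree-Q i)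

      errorless : 2 ^ t * ∑ X (λ x → W x * bit false) ≤ ∑ X W
      errorless = ≤-trans (≤-reflexive (trans (cong (2 ^ t *_) (trans (∑-cong X λ x → *-zeroʳ (W x)) (∑-zero X))) (*-zeroʳ (2 ^ t)))) z≤n

      degree-norPoly : ∀ {d} (v : Fin w → Cube n → Bool) (Q′ : Fin w → Cube n → ℕ) is Js → length Js ≡ t →
        All (All (_∈ is)) Js → All (λ i → HasDegree≤ d (Q′ i)) is →
        HasDegree≤ (D * d) (RandomSums.norPoly p p-prime X v Q′ Js)
      degree-norPoly {d} v Q′ is Js refl Js⊆ Q′≤d =
        degree-mono (≤-reflexive (sym (*-assoc (length Js) (pred p) d)))
          (degree-∏ Js (All.map (λ {js} js⊆ → degree-zeroTest (degree-∑ js (All.map (All.lookup Q′≤d) js⊆))) Js⊆))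

      gatePolynomial : ∀ g → GatePolynomial g
      gatePolynomial (AND is) = record
        { poly    = norPoly Q′ Js
        ; degree  = degree-norPoly v Q′ is Js len Js⊆ (All.map (degree-complement p) (degree-fanIn is))
        ; err     = wrong is Js
        ; correct = λ x right Q≡u → subst (λ b → norPoly Q′ Js x ≡ bit b [mod p ]) (not-or-not (lookup (u x)) is)
                      (norPoly-correct Q′ is Js x Js⊆ right λ i → complement-bit (lookup (u x) i) (Q≡u i))
        ; bound   = bound
        }
        where
        v : Fin w → Cube n → Bool
        v i x = not (lookup (u x) i)
        Q′ : Fin w → Cube n → ℕ
        Q′ i x = complement p (Q i x)
        open RandomSums p p-prime X v
        chosen = orTests t is W
        Js    = proj₁ chosen
        len   = proj₁ (proj₂ chosen)
        Js⊆   = proj₁ (proj₂ (proj₂ chosen))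
        bound = proj₂ (proj₂ (proj₂ chosen))
      gatePolynomial (OR is) = record
        { poly    = λ x → complement p (norPoly Q Js x)
        ; degree  = degree-complement p (degree-norPoly v Q is Js len Js⊆ (degree-fanIn is))
        ; err     = wrong is Js
        ; correct = λ x right Q≡u → subst (λ b → complement p (norPoly Q Js x) ≡ bit b [mod p ])
                      (not-involutive (some is x))
                      (complement-bit (not (some is x)) (norPoly-correct Q is Js x Js⊆ right Q≡u))
        ; bound   = bound
        }
        where
        v : Fin w → Cube n → Bool
        v i x = lookup (u x) i
        open RandomSums p p-prime X v
        chosen = orTests t is W
        Js    = proj₁ chosen
        len   = proj₁ (proj₂ chosen)
        Js⊆   = proj₁ (proj₂ (proj₂ chosen))
        bound = proj₂ (proj₂ (proj₂ chosen))
      gatePolynomial (MOD is) = record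
        { poly    = λ x → complement p (zeroTest (∑ is λ i → Q i x))
        ; degree  = degree-mono (*-monoˡ-≤ (D ^ depthOf δ is) (m≤n*m (pred p) t))
                      (degree-complement p (degree-zeroTest (degree-∑ is (degree-fanIn is))))
        ; err     = λ _ → false
        ; correct = λ x _ Q≡u → complement-bit _ (mod-trans (zeroTest-bit (∑ is λ i → Q i x))
                      (mod-reflexive (cong bit (divides?-cong (mod-∑ is (All.universal Q≡u is))))))
        ; bound   = errorless
        }
      gatePolynomial (NOT i) = record
        { poly    = λ x → complement p (Q i x)
        ; degree  = degree-complement p (degree-mono
                      (^-monoʳ-≤ D (≤-trans (m≤m⊔n (lookup δ i) 0) (n≤1+n _))) (degree-Q i))
        ; err     = λ _ → false
        ; correct = λ x _ Q≡u → complement-bit (lookup (u x) i) (Q≡u i)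
        ; bound   = errorless
        }

    record CircuitPolynomial {n m} (C : Circuit n m) (W : Cube n → ℕ) : Set where
      field
        poly    : Fin (m + n) → Cube n → ℕ
        degree  : ∀ i → HasDegree≤ (D ^ lookup (depths C) i) (poly i)
        err     : Cube n → Bool
        correct : ∀ x → err x ≡ false → ∀ i → poly i x ≡ bit (lookup (values p C x) i) [mod p ]
        bound   : 2 ^ t * ∑ (bitVectors n) (λ x → W x * bit (err x)) ≤ m * ∑ (bitVectors n) W

    -- A union bound over the gates. The error set is shared by all wires, so outside it the values
    -- of every gate are right simultaneously.
    circuitPolynomial : ∀ {n m} (C : Circuit n m) W → CircuitPolynomial C W
    circuitPolynomial {n} inputs W = record
      { poly    = λ i x → bit (lookup x i)
      ; degree  = λ i → degree-mono (m^n>0 D (lookup (Vec.replicate n 0) i)) (degree-bit i)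
      ; err     = λ _ → false
      ; correct = λ x _ i → mod-refl
      ; bound   = ≤-reflexive (trans (cong (2 ^ t *_) (trans (∑-cong (bitVectors n) λ x → *-zeroʳ (W x)) (∑-zero (bitVectors n)))) (*-zeroʳ (2 ^ t)))
      }
    circuitPolynomial {n} {suc m} (C ▷ g) W = record
      { poly    = λ { zero → G.poly ; (suc i) → R.poly i }
      ; degree  = λ { zero → G.degree ; (suc i) → R.degree i }
      ; err     = λ x → G.err x ∨ R.err x
      ; correct = λ x ok → λ
          { zero    → G.correct x (∨-falseˡ (G.err x) ok) (R.correct x (∨-falseʳ (G.err x) ok))
          ; (suc i) → R.correct x (∨-falseʳ (G.err x) ok) i }
      ; bound   = begin
          2 ^ t * ∑ X (λ x → W x * bit (G.err x ∨ R.err x))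
            ≤⟨ *-monoʳ-≤ (2 ^ t) (∑-mono X λ x → *-monoʳ-≤ (W x) (bit-∨ (G.err x) (R.err x))) ⟩
          2 ^ t * ∑ X (λ x → W x * (bit (G.err x) + bit (R.err x)))
            ≡⟨ cong (2 ^ t *_) (trans (∑-cong X λ x → *-distribˡ-+ (W x) (bit (G.err x)) _) (∑-+ X _ _)) ⟩
          2 ^ t * (∑ X (λ x → W x * bit (G.err x)) + ∑ X (λ x → W x * bit (R.err x)))
            ≡⟨ *-distribˡ-+ (2 ^ t) (∑ X (λ x → W x * bit (G.err x))) _ ⟩
          2 ^ t * ∑ X (λ x → W x * bit (G.err x)) + 2 ^ t * ∑ X (λ x → W x * bit (R.err x))
            ≤⟨ +-mono-≤ G.bound R.bound ⟩
          ∑ X W + m * ∑ X W ∎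
      }
      where
      open ≤-Reasoning
      X = bitVectors n
      module R = CircuitPolynomial (circuitPolynomial C W)
      module G = GatePolynomial (gatePolynomial (depths C) R.poly R.degree (values p C) W g)
      ∨-falseˡ : ∀ a {b} → a ∨ b ≡ false → a ≡ false
      ∨-falseˡ false _ = refl
      ∨-falseʳ : ∀ a {b} → a ∨ b ≡ false → b ≡ false
      ∨-falseʳ false b≡false = b≡false

  -- Multiplicative weights: doubling the weight of every point on which the
  -- current sample errs multiplies the total weight by at most 1 + 1 / E.
  sampling : ∀ {A S : Set} (X : List A) (err : S → A → Bool) E →
    (∀ (W : A → ℕ) → Σ[ s ∈ S ] E * ∑ X (λ x → W x * bit (err s x)) ≤ ∑ X W) →
    ∀ L → Σ[ ss ∈ List S ] length ss ≡ L ×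
      E ^ L * ∑ X (λ x → 2 ^ ∑ ss (λ s → bit (err s x))) ≤ length X * suc E ^ L
  sampling X err E choose zero = [] , refl , ≤-reflexive (trans (+-identityʳ _) (∑-const X 1))
  sampling X err E choose (suc L) with sampling X err E choose L
  ... | ss , len , bound with choose (λ x → 2 ^ ∑ ss (λ s → bit (err s x)))
  ...   | s , few = s ∷ ss , cong suc len , (begin
    E * E ^ L * ∑ X (λ x → 2 ^ (bit (err s x) + ∑ ss (λ s → bit (err s x))))
      ≡⟨ cong (E * E ^ L *_) (trans (∑-cong X λ x → double (err s x) _) (∑-+ X W _)) ⟩
    E * E ^ L * (∑ X W + B)         ≡⟨ rearrange₁ E (E ^ L) (∑ X W) B ⟩
    E ^ L * (E * ∑ X W + E * B)     ≤⟨ *-monoʳ-≤ (E ^ L) (+-monoʳ-≤ (E * ∑ X W) few) ⟩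
    E ^ L * (E * ∑ X W + ∑ X W)     ≡⟨ rearrange₂ E (E ^ L) (∑ X W) ⟩
    suc E * (E ^ L * ∑ X W)         ≤⟨ *-monoʳ-≤ (suc E) bound ⟩
    suc E * (length X * suc E ^ L)  ≡⟨ rearrange₃ (suc E) (length X) (suc E ^ L) ⟩
    length X * (suc E * suc E ^ L)  ∎)
    where
    open ≤-Reasoning
    W = λ x → 2 ^ ∑ ss (λ s → bit (err s x))
    B = ∑ X (λ x → W x * bit (err s x))
    double : ∀ b k → 2 ^ (bit b + k) ≡ 2 ^ k + 2 ^ k * bit b
    double false k = sym (trans (cong (2 ^ k +_) (*-zeroʳ (2 ^ k))) (+-identityʳ (2 ^ k)))
    double true  k = cong (2 ^ k +_) (*-comm 1 (2 ^ k))
    rearrange₁ : ∀ a b c d → a * b * (c + d) ≡ b * (a * c + a * d)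
    rearrange₁ = solve-∀
    rearrange₂ : ∀ a b c → b * (a * c + c) ≡ suc a * (b * c)
    rearrange₂ = solve-∀
    rearrange₃ : ∀ a b c → a * (b * c) ≡ b * (a * c)
    rearrange₃ = solve-∀

  -- (a / (1 + a)) ^ k ≥ 1 - k / (1 + a), without fractions
  bernoulli : ∀ a k → suc a ^ suc k ≤ a ^ suc k + suc k * suc a ^ k
  bernoulli a zero    = ≤-reflexive (lemma a)
    where
    lemma : ∀ a → suc a * 1 ≡ a * 1 + 1 * 1
    lemma = solve-∀
  bernoulli a (suc k) = begin
    suc a * (suc a * s)                        ≡⟨ rearrange₁ a s ⟩
    a * (suc a * s) + suc a * s                ≤⟨ +-monoˡ-≤ (suc a * s) (*-monoʳ-≤ a (bernoulli a k)) ⟩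
    a * (a * a ^ k + suc k * s) + suc a * s    ≤⟨ m≤m+n _ (suc k * s) ⟩
    a * (a * a ^ k + suc k * s) + suc a * s + suc k * s ≡⟨ rearrange₂ a (a ^ k) k s ⟩
    a * (a * a ^ k) + suc (suc k) * (suc a * s) ∎
    where
    open ≤-Reasoning
    s = suc a ^ k
    rearrange₁ : ∀ a s → suc a * (suc a * s) ≡ a * (suc a * s) + suc a * s
    rearrange₁ = solve-∀
    rearrange₂ : ∀ a b k s → a * (a * b + suc k * s) + suc a * s + suc k * s ≡ a * (a * b) + suc (suc k) * (suc a * s)
    rearrange₂ = solve-∀

  -- By Bernoulli, (2 h / (2 h + 1)) ^ h ≥ 1 - h / (2 h + 1) ≥ 1/2.
  suc-^≤2* : ∀ h → suc (2 * h) ^ h ≤ 2 * (2 * h) ^ h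
  suc-^≤2* zero    = s≤s z≤n
  suc-^≤2* h@(suc k) = +-cancelʳ-≤ P P _ (begin
    P + P                                  ≡⟨ cong (P +_) (+-identityʳ P) ⟨
    2 * P                                  ≤⟨ *-monoʳ-≤ 2 (bernoulli (2 * h) k) ⟩
    2 * ((2 * h) ^ h + h * suc (2 * h) ^ k) ≡⟨ rearrange ((2 * h) ^ h) h (suc (2 * h) ^ k) ⟩
    2 * (2 * h) ^ h + 2 * h * suc (2 * h) ^ k ≤⟨ +-monoʳ-≤ (2 * (2 * h) ^ h) (*-monoˡ-≤ (suc (2 * h) ^ k) (n≤1+n (2 * h))) ⟩
    2 * (2 * h) ^ h + P                    ∎)
    where
    open ≤-Reasoning
    P = suc (2 * h) ^ h
    rearrange : ∀ a b c → 2 * (a + b * c) ≡ 2 * a + 2 * b * c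
    rearrange = solve-∀

  2^-cancel-≤ : ∀ {a b} → 2 ^ a ≤ 2 ^ b → a ≤ b
  2^-cancel-≤ {a} {b} 2^a≤2^b with a ≤? b
  ... | yes a≤b = a≤b
  ... | no  a≰b = contradiction 2^a≤2^b (<⇒≱ (^-monoʳ-< 2 ≤-refl (≰⇒> a≰b)))

  ^-distribʳ-* : ∀ a b n → (a * b) ^ n ≡ a ^ n * b ^ n
  ^-distribʳ-* a b zero    = refl
  ^-distribʳ-* a b (suc n) = trans (cong (a * b *_) (^-distribʳ-* a b n)) (*-interchange a b (a ^ n) (b ^ n))

  length-bitVectors : ∀ n → length (bitVectors n) ≡ 2 ^ n
  length-bitVectors zero    = refl
  length-bitVectors (suc n) = trans (length-++ (map (false ∷_) (bitVectors n))) (cong₂ _+_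
    (trans (length-map (false ∷_) (bitVectors n)) (length-bitVectors n))
    (trans (length-map (true ∷_) (bitVectors n)) (trans (length-bitVectors n) (sym (+-identityʳ _)))))

  ∈-bitVectors : ∀ {n} (x : Cube n) → x ∈ bitVectors n
  ∈-bitVectors []          = here refl
  ∈-bitVectors (false ∷ x) = ∈-++⁺ˡ (∈-map⁺ (false ∷_) (∈-bitVectors x))
  ∈-bitVectors (true  ∷ x) = ∈-++⁺ʳ _ (∈-map⁺ (true ∷_) (∈-bitVectors x))

  ≤-∑ : ∀ {A : Set} {X : List A} {x} f → x ∈ X → f x ≤ ∑ X f
  ≤-∑ f (here refl) = m≤m+n _ _
  ≤-∑ {X = y ∷ _} f (there x∈)  = ≤-trans (≤-∑ f x∈) (m≤n+m _ (f y))

  -- The total weight starts at `2 ^ n`, and `h * n` rounds multiply it by at most (1 + 1 / 2 h) ^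
  -- (h n) ≤ 2 ^ n. A point with e errors alone has weight 2 ^ e, hence e ≤ 2 n, a fraction 2 / h of
  -- the samples.
  few-errors : ∀ {S : Set} {n} (err : S → Cube n → Bool) h .{{_ : NonZero h}} →
    (∀ (W : Cube n → ℕ) → Σ[ s ∈ S ] 2 * h * ∑ (bitVectors n) (λ x → W x * bit (err s x)) ≤ ∑ (bitVectors n) W) →
    Σ[ ss ∈ List S ] length ss ≡ h * n × (∀ x → ∑ ss (λ s → bit (err s x)) ≤ 2 * n)
  few-errors {S} {n} err h choose with sampling (bitVectors n) err (2 * h) choose (h * n)
  ... | ss , len , bound = ss , len , λ x → 2^-cancel-≤ (*-cancelˡ-≤ P {{P≢0}} (begin
    P * 2 ^ ∑ ss (λ s → bit (err s x))                         ≤⟨ *-monoʳ-≤ P (≤-∑ (λ x → 2 ^ ∑ ss (λ s → bit (err s x))) (∈-bitVectors x)) ⟩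
    P * ∑ (bitVectors n) (λ x → 2 ^ ∑ ss (λ s → bit (err s x))) ≤⟨ bound ⟩
    length (bitVectors n) * suc (2 * h) ^ (h * n)              ≡⟨ cong₂ _*_ (length-bitVectors n) (sym (^-*-assoc (suc (2 * h)) h n)) ⟩
    2 ^ n * (suc (2 * h) ^ h) ^ n                              ≤⟨ *-monoʳ-≤ (2 ^ n) (^-monoˡ-≤ n (suc-^≤2* h)) ⟩
    2 ^ n * (2 * (2 * h) ^ h) ^ n                              ≡⟨ cong (2 ^ n *_) (^-distribʳ-* 2 ((2 * h) ^ h) n) ⟩
    2 ^ n * (2 ^ n * ((2 * h) ^ h) ^ n)                        ≡⟨ cong (λ q → 2 ^ n * (2 ^ n * q)) (^-*-assoc (2 * h) h n) ⟩
    2 ^ n * (2 ^ n * P)                                        ≡⟨ rearrange (2 ^ n) P ⟩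
    P * (2 ^ n * 2 ^ n)                                        ≡⟨ cong (P *_) (^-distribˡ-+-* 2 n n) ⟨
    P * 2 ^ (n + n)                                            ≡⟨ cong (λ m → P * 2 ^ (n + m)) (+-identityʳ n) ⟨
    P * 2 ^ (2 * n)                                            ∎))
    where
    open ≤-Reasoning
    P = (2 * h) ^ (h * n)
    P≢0 : NonZero P
    P≢0 = m^n≢0 (2 * h) (h * n) {{m*n≢0 2 h}}
    rearrange : ∀ a b → a * (a * b) ≡ b * (a * a)
    rearrange = solve-∀

  -- Approximation by a fraction

  -- | u / M - b / 2 | ≤ 1 / E
  Close : (E M u : ℕ) → Bool → Set
  Close E M u b = 2 * (u * E) ≤ bit b * (M * E) + 2 * M × bit b * (M * E) ≤ 2 * (u * E) + 2 * M

  -- For N = ⌊ M / 2 L ⌋, the number N c / M is close to c / 2 L, hence to b / 2.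
  close : ∀ E M n c b → let L = 2 * E * n in .{{_ : NonZero L}} →
    2 * L * E ≤ M → c ≤ L * bit b + 2 * n → L * bit b ≤ c + 2 * n →
    Σ[ N ∈ ℕ ] Close E M (N * c) b
  close E M n c b large upper lower = N , (begin
      2 * (N * c * E)                                       ≡⟨ r₁ N c E ⟩
      2 * N * E * c                                         ≤⟨ *-monoʳ-≤ (2 * N * E) upper ⟩
      2 * N * E * (L * bit b + 2 * n)                       ≡⟨ r₂ N E n (bit b) ⟩
      bit b * (N * (2 * L) * E) + N * (2 * L)               ≤⟨ +-mono-≤ (*-monoʳ-≤ (bit b) (*-monoˡ-≤ E N2L≤M)) N2L≤M ⟩
      bit b * (M * E) + M                                   ≤⟨ +-monoʳ-≤ (bit b * (M * E)) (m≤n*m M 2) ⟩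
      bit b * (M * E) + 2 * M                               ∎) , (begin
      bit b * (M * E)                                       ≤⟨ *-monoʳ-≤ (bit b) (*-monoˡ-≤ E M≤) ⟩
      bit b * ((2 * L + N * (2 * L)) * E)                   ≡⟨ r₃ (bit b) L N E ⟩
      -- The allowance `2 * M` is spent in halves: rounding in `N` costs at most `2 * L * E ≤ M`,
      -- and the `2 * n` wrong votes cost `N * (2 * L) ≤ M`.
      bit b * (2 * L * E) + 2 * N * E * (L * bit b)         ≤⟨ +-mono-≤ (*-mono-≤ (bit≤1 b) large) (*-monoʳ-≤ (2 * N * E) lower) ⟩
      1 * M + 2 * N * E * (c + 2 * n)                       ≡⟨ r₄ M N E c n ⟩
      2 * (N * c * E) + (N * (2 * L) + M)                   ≤⟨ +-monoʳ-≤ (2 * (N * c * E)) (+-monoˡ-≤ M N2L≤M) ⟩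
      2 * (N * c * E) + (M + M)                             ≡⟨ cong (λ k → 2 * (N * c * E) + (M + k)) (+-identityʳ M) ⟨
      2 * (N * c * E) + 2 * M                               ∎)
    where
    open ≤-Reasoning
    L = 2 * E * n
    instance
      2L≢0 : NonZero (2 * L)
      2L≢0 = m*n≢0 2 L
    N = M / (2 * L)
    N2L≤M : N * (2 * L) ≤ M
    N2L≤M = m/n*n≤m M (2 * L)
    M≤ : M ≤ 2 * L + N * (2 * L)
    M≤ = ≤-trans (≤-reflexive (m≡m%n+[m/n]*n M (2 * L))) (+-monoˡ-≤ _ (<⇒≤ (m%n<n M (2 * L))))
    r₁ : ∀ N c E → 2 * (N * c * E) ≡ 2 * N * E * c
    r₁ = solve-∀
    r₂ : ∀ N E n b → 2 * N * E * (2 * E * n * b + 2 * n) ≡ b * (N * (2 * (2 * E * n)) * E) + N * (2 * (2 * E * n))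
    r₂ = solve-∀
    r₃ : ∀ b L N E → b * ((2 * L + N * (2 * L)) * E) ≡ b * (2 * L * E) + 2 * N * E * (L * b)
    r₃ = solve-∀
    r₄ : ∀ M N E c n → 1 * M + 2 * N * E * (c + 2 * n) ≡ 2 * (N * c * E) + (N * (2 * (2 * E * n)) + M)
    r₄ = solve-∀

  -- From circuits to votes, and from votes to an approximation

  module CircuitApproximation (p : ℕ) (p-prime : Prime p) where
    open ModPrime p p-prime

    -- F ≡ u modulo M makes F / M and u / M equal in ℝ/ℤ.
    record Approximation {n} (d E : ℕ) (f : BooleanFunction n) : Set where
      field
        modulus   : ℕ
        {{modulus≢0}} : NonZero modulus
        poly      : Cube n → ℕ
        degree    : HasDegree≤ d poly
        value     : Cube n → ℕ
        congruent : ∀ x → poly x ≡ value x [mod modulus ]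
        isClose   : ∀ x → Close E modulus (value x) (f x)

    -- `correct` holds at every point, also where `err` is true: the lift is meaningful only on
    -- values 0 and 1, and a wrong sample then changes the vote count by at most one.
    record Sample {n} (d : ℕ) (f : BooleanFunction n) : Set where
      field
        poly    : Cube n → ℕ
        degree  : HasDegree≤ d poly
        value   : Cube n → Bool
        correct : ∀ x → poly x ≡ bit (value x) [mod p ]
        err     : Cube n → Bool
        good    : ∀ x → err x ≡ false → value x ≡ f x

    module _ (t : ℕ) .{{_ : NonZero t}} {n m : ℕ} (C : Circuit n m) (out : Fin (m + n))
             (f : BooleanFunction n) (computes : ∀ x → lookup (values p C x) out ≡ f x)
             (ℓ : ℕ) (shallow : lookup (depths C) out ≤ ℓ) where
      open CircuitPolynomials p p-prime t

      d₀ : ℕ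
      d₀ = pred p * D ^ ℓ

      sample : ∀ E (W : Cube n → ℕ) → suc m * E ≤ 2 ^ t →
        Σ[ s ∈ Sample d₀ f ] E * ∑ (bitVectors n) (λ x → W x * bit (Sample.err s x)) ≤ ∑ (bitVectors n) W
      sample E W small = record
        -- Outside its correct points the circuit polynomial may have any residue. The complemented
        -- zero test sends nonzero residues to 1 and keeps 0 and 1; this is the factor `pred p` in
        -- `d₀`.
        { poly    = λ x → complement p (zeroTest (R.poly out x))
        ; degree  = degree-complement p (degree-zeroTest (degree-mono (^-monoʳ-≤ D shallow) (R.degree out)))
        ; value   = λ x → not (divides? (R.poly out x))
        ; correct = λ x → complement-bit (divides? (R.poly out x)) (zeroTest-bit (R.poly out x))
        ; err     = R.err
        ; good    = λ x ok → trans (cong not (divides?-cong (R.correct x ok out)))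
                      (trans (cong (λ b → not (divides? (bit b))) (computes x)) (nonzero (f x)))
        -- The factor `suc m`, not `m`, can be cancelled even for a circuit without gates.
        } , *-cancelˡ-≤ (suc m) (begin
          suc m * (E * F)                  ≡⟨ *-assoc (suc m) E F ⟨
          suc m * E * F                    ≤⟨ *-monoˡ-≤ F small ⟩
          2 ^ t * F                        ≤⟨ R.bound ⟩
          m * ∑ (bitVectors n) W           ≤⟨ *-monoˡ-≤ (∑ (bitVectors n) W) (n≤1+n m) ⟩
          suc m * ∑ (bitVectors n) W       ∎)
        where
        open ≤-Reasoning
        module R = CircuitPolynomial (circuitPolynomial C W)
        F = ∑ (bitVectors n) (λ x → W x * bit (R.err x))
        nonzero : ∀ b → not (divides? (bit b)) ≡ b
        nonzero false with p ∣? 0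
        ... | yes _  = refl
        ... | no p∤0 = contradiction (p ∣0) p∤0
        nonzero true with p ∣? 1
        ... | yes p∣1 = contradiction p∣1 p∤1
        ... | no  _   = refl

      approximation : ∀ E k .{{_ : NonZero E}} .{{_ : NonZero n}} →
        suc m * (2 * (2 * E)) ≤ 2 ^ t → 2 * (2 * E * n) * E ≤ p ^ suc k →
        Approximation (suc k * (suc k * d₀)) E f
      approximation E k enoughTests largeModulus = record
        { modulus   = M
        ; modulus≢0 = p^k≢0
        ; poly      = λ x → N * ∑ ss (λ s → amplify (Sample.poly s x))
        ; degree    = degree-* {d = 0} (degree-const N) (degree-∑ ss
                        (All.universal (λ s → degree-amplify (Sample.degree s)) ss))
        ; value     = λ x → N * count x
        ; congruent = λ x → mod-*ˡ N (mod-∑ ss (All.universal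
                        (λ s → amplify-bit (Sample.value s x) (Sample.correct s x)) ss))
        ; isClose   = λ x → proj₂ (close E M n (count x) (f x) largeModulus (upper x) (lower x))
        }
        where
        open ≤-Reasoning
        open Amplification p k
        M = p ^ suc k
        L = 2 * E * n
        instance
          E+E≢0 : NonZero (2 * E)
          E+E≢0 = m*n≢0 2 E
          L≢0 : NonZero L
          L≢0 = m*n≢0 (2 * E) n
        -- With h = 2 E there are L = 2 E n samples, of which at most 2 n = L / E are wrong at any
        -- point. Each must therefore have relative error at most 1 / 4 E.
        chosen = few-errors {S = Sample d₀ f} Sample.err (2 * E) (λ W → sample (2 * (2 * E)) W enoughTests)
        ss = proj₁ chosen
        -- The quotient returned by `close`. It depends neither on `x` nor on the count, so a single
        -- polynomial serves all points.
        N = M / (2 * L)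
          where instance 2L≢0 = m*n≢0 2 L
        errors : ∀ x → ∑ ss (λ s → bit (Sample.err s x)) ≤ 2 * n
        errors = proj₂ (proj₂ chosen)
        count : Cube n → ℕ
        count x = ∑ ss (λ s → bit (Sample.value s x))
        agreement : ∀ x → ∑ ss (λ _ → bit (f x)) ≡ L * bit (f x)
        agreement x = trans (∑-const ss (bit (f x))) (cong (_* bit (f x)) (proj₁ (proj₂ chosen)))
        differ : ∀ v b e → (e ≡ false → v ≡ b) → bit v ≤ bit b + bit e × bit b ≤ bit v + bit e
        differ v     b     false v≡b rewrite v≡b refl = m≤m+n _ 0 , m≤m+n _ 0
        differ false false true _ = z≤n , z≤n
        differ false true  true _ = z≤n , ≤-refl
        differ true  false true _ = ≤-refl , z≤n
        differ true  true  true _ = s≤s z≤n , s≤s z≤n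
        upper : ∀ x → count x ≤ L * bit (f x) + 2 * n
        upper x = begin
          count x                                                      ≤⟨ ∑-mono ss (λ s → proj₁ (differ _ (f x) (Sample.err s x) (Sample.good s x))) ⟩
          ∑ ss (λ s → bit (f x) + bit (Sample.err s x))                ≡⟨ ∑-+ ss _ _ ⟩
          ∑ ss (λ _ → bit (f x)) + ∑ ss (λ s → bit (Sample.err s x))   ≤⟨ +-mono-≤ (≤-reflexive (agreement x)) (errors x) ⟩
          L * bit (f x) + 2 * n                                        ∎
        lower : ∀ x → L * bit (f x) ≤ count x + 2 * n
        lower x = begin
          L * bit (f x)                                                ≡⟨ agreement x ⟨
          ∑ ss (λ _ → bit (f x))                                       ≤⟨ ∑-mono ss (λ s → proj₂ (differ (Sample.value s x) _ (Sample.err s x) (Sample.good s x))) ⟩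
          ∑ ss (λ s → bit (Sample.value s x) + bit (Sample.err s x))   ≡⟨ ∑-+ ss _ _ ⟩
          count x + ∑ ss (λ s → bit (Sample.err s x))                  ≤⟨ +-monoʳ-≤ (count x) (errors x) ⟩
          count x + 2 * n                                              ∎

  -- Parameters

  suc≤2^ : ∀ k → suc k ≤ 2 ^ k
  suc≤2^ zero    = ≤-refl
  suc≤2^ (suc k) = ≤-trans (+-mono-≤ (m^n>0 2 k) (suc≤2^ k)) (≤-reflexive (cong (2 ^ k +_) (sym (+-identityʳ (2 ^ k)))))

  dyadic : ∀ n → 1 ≤ n → ∃[ k ] 2 ^ k ≤ n × n < 2 ^ suc k
  dyadic (suc zero)      _ = 0 , ≤-refl , ≤-refl
  dyadic (suc n@(suc _)) _ with dyadic n (s≤s z≤n)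
  ... | k , 2^k≤n , n<2^ with suc n <? 2 ^ suc k
  ...   | yes 1+n<2^ = k , ≤-trans 2^k≤n (n≤1+n n) , 1+n<2^
  ...   | no  1+n≮2^ = suc k , ≮⇒≥ 1+n≮2^ , (begin-strict
    suc n              ≤⟨ n<2^ ⟩
    2 ^ suc k          <⟨ ^-monoʳ-< 2 ≤-refl (n<1+n (suc k)) ⟩
    2 ^ suc (suc k)    ∎)
    where open ≤-Reasoning

  -- With the successor carried along, a Horner step c + n v is dominated by the product (1 + c) (1
  -- + n v), so that the exponents simply add up.
  evalPoly<2^ : ∀ s {n λ′} → n ≤ 2 ^ λ′ → suc (evalPoly s n) ≤ 2 ^ (sum s + length s * λ′)
  evalPoly<2^ []      _ = ≤-refl
  evalPoly<2^ (c ∷ s) {n} {λ′} n≤ = begin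
    suc (c + n * v)                                ≤⟨ m≤m+n _ (c * (n * v)) ⟩
    suc (c + n * v) + c * (n * v)                  ≡⟨ factor c (n * v) ⟩
    suc c * (1 + n * v)                            ≤⟨ *-mono-≤ (suc≤2^ c) (+-mono-≤ (m^n>0 2 λ′) (*-monoˡ-≤ v n≤)) ⟩
    2 ^ c * (2 ^ λ′ + 2 ^ λ′ * v)                  ≡⟨ cong (2 ^ c *_) (*-suc (2 ^ λ′) v) ⟨
    2 ^ c * (2 ^ λ′ * suc v)                       ≤⟨ *-monoʳ-≤ (2 ^ c) (*-monoʳ-≤ (2 ^ λ′) (evalPoly<2^ s n≤)) ⟩
    2 ^ c * (2 ^ λ′ * 2 ^ (sum s + length s * λ′)) ≡⟨ cong (2 ^ c *_) (^-distribˡ-+-* 2 λ′ _) ⟨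
    2 ^ c * 2 ^ (λ′ + (sum s + length s * λ′))     ≡⟨ ^-distribˡ-+-* 2 c _ ⟨
    2 ^ (c + (λ′ + (sum s + length s * λ′)))       ≡⟨ cong (2 ^_) (rearrange c λ′ (sum s) (length s * λ′)) ⟩
    2 ^ (c + sum s + (λ′ + length s * λ′))         ∎
    where
    open ≤-Reasoning
    v = evalPoly s n
    factor : ∀ c v → suc (c + v) + c * v ≡ suc c * (1 + v)
    factor = solve-∀
    rearrange : ∀ c l s r → c + (l + (s + r)) ≡ c + s + (l + r)
    rearrange = solve-∀

  -- Bounds by powers of `2 ^ β`, which stands in for log (n / ε)

  module PowerBounds (β : ℕ) (1≤β : 1 ≤ β) where

    bound-const : ∀ c → c ≤ 2 ^ (c * β)
    bound-const c = ≤-trans (n≤1+n c) (≤-trans (suc≤2^ c)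
      (^-monoʳ-≤ 2 (≤-trans (≤-reflexive (sym (*-identityʳ c))) (*-monoʳ-≤ c 1≤β))))

    bound-* : ∀ {x y} a c → x ≤ 2 ^ (a * β) → y ≤ 2 ^ (c * β) → x * y ≤ 2 ^ ((a + c) * β)
    bound-* {x} {y} a c x≤ y≤ = begin
      x * y                     ≤⟨ *-mono-≤ x≤ y≤ ⟩
      2 ^ (a * β) * 2 ^ (c * β) ≡⟨ ^-distribˡ-+-* 2 (a * β) (c * β) ⟨
      2 ^ (a * β + c * β)       ≡⟨ cong (2 ^_) (*-distribʳ-+ β a c) ⟨
      2 ^ ((a + c) * β)         ∎
      where open ≤-Reasoning

    bound-^ : ∀ {x} a ℓ → x ≤ 2 ^ (a * β) → x ^ ℓ ≤ 2 ^ (ℓ * a * β)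
    bound-^ a zero    x≤ = ≤-refl
    bound-^ a (suc ℓ) x≤ = bound-* a (ℓ * a) x≤ (bound-^ a ℓ x≤)

  -- One summand per factor of the degree: 4 for each of the two factors `suc κ ≤ 3 * b`, `p` for
  -- `pred p`, and `T + 1 + p` for each of the `ℓ` factors `t * pred p`. Neither n nor ε enters.
  degreeExponent : (p ℓ T : ℕ) → ℕ
  degreeExponent p ℓ T = 4 + (4 + (p + ℓ * (T + 1 + p)))

  -- With n ≈ 2 ^ λ, 1 / ε ≈ 2 ^ (3 + k), and b = 3 + (λ + k) ≈ log (n / ε)
  module Parameters (s : Polynomial) (λ′ k : ℕ) where

    -- The precision is E = 2 ^ `e`. The exponent `κ` is such that 2 ^ (1 + κ) equals 4 E² n at n =
    -- 2 ^ (1 + λ′), and 2 ^ `t` is 4 E times the bound on the size. `T` is the constant in t =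
    -- O(b).
    e b κ t T : ℕ
    e = 3 + k
    b = 3 + (λ′ + k)
    κ = 2 + (λ′ + (e + e))
    t = 2 + (e + (sum s + length s * suc λ′))
    T = 3 + sum s + length s

    κ-bound : suc κ ≤ 3 * b
    κ-bound = ≤-trans (m≤m+n (suc κ) (λ′ + λ′ + k)) (≤-reflexive (lemma λ′ k))
      where
      lemma : ∀ l k → suc (2 + (l + (3 + k + (3 + k)))) + (l + l + k) ≡ 3 * (3 + (l + k))
      lemma = solve-∀

    t-bound : t ≤ T * b
    t-bound = ≤-trans (m≤m+n t extra) (≤-reflexive (lemma (sum s) (length s) λ′ k))
      where
      -- The exact difference of `T * b` and `t`, which turns the inequality into a polynomial
      -- identity.
      extra = 4 + 3 * λ′ + 2 * k + sum s * (2 + λ′ + k) + length s * (2 + k)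
      lemma : ∀ σ r l k → 2 + (3 + k + (σ + r * suc l)) + (4 + 3 * l + 2 * k + σ * (2 + l + k) + r * (2 + k))
              ≡ (3 + σ + r) * (3 + (l + k))
      lemma = solve-∀

    enough-tests : ∀ {n m} → n ≤ 2 ^ suc λ′ → m ≤ evalPoly s n → suc m * (2 * (2 * 2 ^ e)) ≤ 2 ^ t
    enough-tests {n} {m} n≤ m≤ = begin
      suc m * 2 ^ (2 + e)                                  ≤⟨ *-monoˡ-≤ (2 ^ (2 + e)) (≤-trans (s≤s m≤) (evalPoly<2^ s n≤)) ⟩
      2 ^ (sum s + length s * suc λ′) * 2 ^ (2 + e)        ≡⟨ *-comm (2 ^ (sum s + length s * suc λ′)) _ ⟩
      2 ^ (2 + e) * 2 ^ (sum s + length s * suc λ′)        ≡⟨ ^-distribˡ-+-* 2 (2 + e) (sum s + length s * suc λ′) ⟨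
      2 ^ t                                                ∎
      where open ≤-Reasoning

    large-modulus : ∀ {p n} → 2 ≤ p → n ≤ 2 ^ suc λ′ → 2 * (2 * 2 ^ e * n) * 2 ^ e ≤ p ^ suc κ
    large-modulus {p} {n} 2≤p n≤ = begin
      2 * (2 * E * n) * E                        ≤⟨ *-monoˡ-≤ E (*-monoʳ-≤ 2 (*-monoʳ-≤ (2 * E) n≤)) ⟩
      2 * (2 * E * (2 * 2 ^ λ′)) * E             ≡⟨ rearrange E (2 ^ λ′) ⟩
      2 * (2 * (2 * (2 ^ λ′ * (E * E))))         ≡⟨ cong (λ v → 2 * (2 * (2 * (2 ^ λ′ * v)))) (^-distribˡ-+-* 2 e e) ⟨
      2 * (2 * (2 * (2 ^ λ′ * 2 ^ (e + e))))     ≡⟨ cong (λ v → 2 * (2 * (2 * v))) (^-distribˡ-+-* 2 λ′ (e + e)) ⟨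
      2 ^ suc κ                                  ≤⟨ ^-monoˡ-≤ (suc κ) 2≤p ⟩
      p ^ suc κ                                  ∎
      where
      open ≤-Reasoning
      E = 2 ^ e
      rearrange : ∀ E l → 2 * (2 * E * (2 * l)) * E ≡ 2 * (2 * (2 * (l * (E * E))))
      rearrange = solve-∀

    degree-bound : ∀ p ℓ β → 1 ≤ β → b ≤ 2 ^ β →
      suc κ * (suc κ * (pred p * (t * pred p) ^ ℓ)) ≤ 2 ^ (degreeExponent p ℓ T * β)
    degree-bound p ℓ β 1≤β b≤ =
      bound-* 4 (4 + (p + ℓ * (T + 1 + p))) κ≤ (bound-* 4 (p + ℓ * (T + 1 + p)) κ≤
        (bound-* p (ℓ * (T + 1 + p)) p≤ (bound-^ (T + 1 + p) ℓ
          (bound-* (T + 1) p (≤-trans t-bound (bound-* T 1 (bound-const T) b≤′)) p≤))))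
      where
      open PowerBounds β 1≤β
      b≤′ : b ≤ 2 ^ (1 * β)
      b≤′ = subst (λ v → b ≤ 2 ^ v) (sym (*-identityˡ β)) b≤
      p≤ : pred p ≤ 2 ^ (p * β)
      p≤ = ≤-trans pred[n]≤n (bound-const p)
      κ≤ : suc κ ≤ 2 ^ (4 * β)
      κ≤ = ≤-trans κ-bound (bound-* 3 1 (bound-const 3) b≤′)

open Polynomials
open import Defs
open import Level using (0ℓ; Lift; lift) renaming (suc to lsuc)
open import Algebra.Bundles using (CommutativeRing)
open import Axiom.ExcludedMiddle using (ExcludedMiddle)
open import Data.Bool.Base using (Bool; true; false)
open import Data.Fin.Subset using (Subset) renaming (∣_∣ to card)
open import Data.Integer.Base as ℤ using (ℤ; +_; -[1+_]; +[1+_]; +0)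
import Data.Integer.Properties as ℤₚ
open import Data.Integer.Solver using () renaming (module +-*-Solver to ℤ-Solver)
open import Data.List.Base using (List; []; _∷_; foldr; filter; length)
open import Data.Nat.Base as ℕ using (ℕ; zero; suc)
open import Data.Nat.DivMod using (_/_; _%_; m≡m%n+[m/n]*n)
open import Data.Nat.ListAction using (sum)
open import Data.Nat.Primality using (Prime)
import Data.Nat.Properties as ℕₚ
open import Data.Product.Base using (Σ-syntax; ∃-syntax; _×_; _,_; proj₁; proj₂)
open import Data.Rational.Base as ℚ using (ℚ; mkℚ; 0ℚ; 1ℚ; ½; ↥_; ↧ₙ_)
import Data.Rational.Properties as ℚₚ
open import Data.Rational.Solver using (module +-*-Solver)
import Data.Rational.Unnormalised.Base as ℚᵘ
import Data.Rational.Unnormalised.Properties as ℚᵘₚ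
open import Data.Sum.Base using (inj₁; inj₂)
open import Relation.Nullary using (¬_; Dec; yes; no; contradiction)
open import Relation.Binary.PropositionalEquality using (_≡_; refl; sym; trans; cong; cong₂; subst; subst₂; module ≡-Reasoning)
open import Algebra.Definitions.RawSemiring ℚ.+-*-rawSemiring using () renaming (_^_ to _^ℚ_)
import Algebra.Properties.Semiring.Exp (CommutativeRing.semiring ℚₚ.+-*-commutativeRing) as Exp
open +-*-Solver using (solve; _:+_; _:*_; :-_; _:-_; _:=_; con)

-- Real arithmetic

module L = RationalLemmas

♯ : ℕ → ℚ
♯ n = ℤ→ℚ (+ n)

♯-+ : ∀ a b → ♯ (a ℕ.+ b) ≡ ♯ a ℚ.+ ♯ b
♯-+ a b = sym (L.ℤ→ℚ-+ (+ a) (+ b))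

♯-* : ∀ a b → ♯ (a ℕ.* b) ≡ ♯ a ℚ.* ♯ b
♯-* a b = trans (cong ℤ→ℚ (ℤₚ.pos-* a b)) (sym (L.ℤ→ℚ-* (+ a) (+ b)))

♯-mono : ∀ {a b} → a ℕ.≤ b → ♯ a ℚ.≤ ♯ b
♯-mono a≤b = L.ℤ→ℚ-mono (ℤ.+≤+ a≤b)

♯-0≤ : ∀ a → 0ℚ ℚ.≤ ♯ a
♯-0≤ a = ♯-mono ℕ.z≤n

♯-0< : ∀ a .{{_ : ℕ.NonZero a}} → 0ℚ ℚ.< ♯ a
♯-0< (suc a) = ℚₚ.<-≤-trans L.0<1 (♯-mono (ℕ.s≤s ℕ.z≤n))

♯-inverse : ∀ m .{{_ : ℕ.NonZero m}} → Σ[ r ∈ ℚ ] 0ℚ ℚ.< r × ♯ m ℚ.* r ≡ 1ℚ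
♯-inverse (suc m) = ℚ.1/ (♯ (suc m)) , L.1/-0< (♯-0< (suc m)) , ℚₚ.*-inverseʳ (♯ (suc m))

≤-by-gap : ∀ {x y r} → 0ℚ ℚ.≤ r → y ≡ x ℚ.+ r → x ℚ.≤ y
≤-by-gap {x} 0≤r refl = subst (ℚ._≤ x ℚ.+ _) (ℚₚ.+-identityʳ x) (ℚₚ.+-monoʳ-≤ x 0≤r)

0≤- : ∀ {x y} → x ℚ.≤ y → 0ℚ ℚ.≤ y ℚ.- x
0≤- {x} {y} x≤y = subst (ℚ._≤ y ℚ.- x) (ℚₚ.+-inverseʳ x) (ℚₚ.+-monoˡ-≤ (ℚ.- x) x≤y)

0≤+ : ∀ {x y} → 0ℚ ℚ.≤ x → 0ℚ ℚ.≤ y → 0ℚ ℚ.≤ x ℚ.+ y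
0≤+ = ℚₚ.+-mono-≤

≈-refl : ∀ {x} → x ≈ x
≈-refl = (λ _ q◂x → q◂x) , (λ _ q◂x → q◂x)

≈-sym : ∀ {x y} → x ≈ y → y ≈ x
≈-sym (x≤y , y≤x) = y≤x , x≤y

≤-trans : ∀ {x y z} → x ≤ y → y ≤ z → x ≤ z
≤-trans x≤y y≤z q q◂x = y≤z q (x≤y q q◂x)

≈-trans : ∀ {x y z} → x ≈ y → y ≈ z → x ≈ z
≈-trans {x} {y} {z} (x≤y , y≤x) (y≤z , z≤y) = ≤-trans {x} {y} {z} x≤y y≤z , ≤-trans {z} {y} {x} z≤y y≤x

fromℚ-mono : ∀ {a b} → a ℚ.≤ b → fromℚ a ≤ fromℚ b
fromℚ-mono a≤b q q<a = ℚₚ.<-≤-trans q<a a≤b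

fromℚ-cong : ∀ {a b} → a ≡ b → fromℚ a ≈ fromℚ b
fromℚ-cong refl = ≈-refl {fromℚ _}

fromℚ-cancel-≤ : ∀ {a b} → fromℚ a ≤ fromℚ b → a ℚ.≤ b
fromℚ-cancel-≤ {a} {b} a≤b = ℚₚ.≮⇒≥ (λ b<a → ℚₚ.<-irrefl refl (a≤b b b<a))

fromℚ≤⇒≤ : ∀ x {a u} → fromℚ a ≤ x → ¬ (u ◂ x) → a ℚ.≤ u
fromℚ≤⇒≤ x {a} {u} a≤x ¬u◂x = ℚₚ.≮⇒≥ (λ u<a → ¬u◂x (a≤x u u<a))

◂⇒fromℚ≤ : ∀ x {a} → a ◂ x → fromℚ a ≤ x
◂⇒fromℚ≤ x a◂x q q<a = ℝ.closed x q<a a◂x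

+-mono : ∀ {x x′ y y′} → x ≤ x′ → y ≤ y′ → x + y ≤ x′ + y′
+-mono x≤x′ y≤y′ q (s , (a , b , a◂x , b◂y , eq) , q<s) = s , (a , b , x≤x′ a a◂x , y≤y′ b b◂y , eq) , q<s

+-cong : ∀ {x x′ y y′} → x ≈ x′ → y ≈ y′ → x + y ≈ x′ + y′
+-cong {x} {x′} {y} {y′} (p , p′) (q , q′) = +-mono {x} {x′} {y} {y′} p q , +-mono {x′} {x} {y′} {y} p′ q′

fromℚ-+ : ∀ a b → fromℚ a + fromℚ b ≈ fromℚ (a ℚ.+ b)
fromℚ-+ a b =
  (λ { q (_ , (a₀ , b₀ , a₀<a , b₀<b , refl) , q<s) → ℚₚ.<-trans q<s (ℚₚ.+-mono-< a₀<a b₀<b) }) ,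
  λ q q<a+b →
    let r , q<r , r<a+b = ℚₚ.<-dense q<a+b
        r-b<a = subst (r ℚ.- b ℚ.<_) (solve 2 (λ a b → a :+ b :- b := a) refl a b) (ℚₚ.+-monoˡ-< (ℚ.- b) r<a+b)
        a₀ , r-b<a₀ , a₀<a = ℚₚ.<-dense r-b<a
        r-a₀<b = subst (r ℚ.- a₀ ℚ.<_) (solve 2 (λ a b → a :+ b :- a := b) refl a₀ b)
                   (ℚₚ.+-monoˡ-< (ℚ.- a₀) (subst (ℚ._< a₀ ℚ.+ b) (solve 2 (λ r b → r :- b :+ b := r) refl r b) (ℚₚ.+-monoˡ-< b r-b<a₀)))
    in r , (a₀ , r ℚ.- a₀ , a₀<a , r-a₀<b , solve 2 (λ r a → r := a :+ (r :- a)) refl r a₀) , q<r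

neg-antimono : ∀ {x y} → x ≤ y → - y ≤ - x
neg-antimono x≤y q (s , ¬-s◂y , q<s) = s , (λ -s◂x → ¬-s◂y (x≤y _ -s◂x)) , q<s

neg-cong : ∀ {x y} → x ≈ y → - x ≈ - y
neg-cong {x} {y} (p , q) = neg-antimono {y} {x} q , neg-antimono {x} {y} p

fromℚ-neg : ∀ a → - fromℚ a ≈ fromℚ (ℚ.- a)
fromℚ-neg a =
  (λ { q (s , ¬-s<a , q<s) → ℚₚ.<-≤-trans q<s
         (subst (ℚ._≤ ℚ.- a) (L.neg-neg s) (ℚₚ.neg-antimono-≤ (ℚₚ.≮⇒≥ ¬-s<a))) }) ,
  λ q q<-a → ℚ.- a , (λ a″<a → ℚₚ.<-irrefl (L.neg-neg a) a″<a) , q<-a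

⊔-lub : ∀ {x y z} → x ≤ z → y ≤ z → x ⊔ y ≤ z
⊔-lub {z = z} x≤z y≤z q (s , inj₁ s◂x , q<s) = ℝ.closed z q<s (x≤z s s◂x)
⊔-lub {z = z} x≤z y≤z q (s , inj₂ s◂y , q<s) = ℝ.closed z q<s (y≤z s s◂y)

⌊⌋-mono : ∀ {x y} → x ≤ y → ⌊ x ⌋ ≤ ⌊ y ⌋
⌊⌋-mono x≤y q (s , (k , s≡k , k≤x) , q<s) = s , (k , s≡k , λ r r<k → x≤y r (k≤x r r<k)) , q<s

⌊⌋-cong : ∀ {x y} → x ≈ y → ⌊ x ⌋ ≈ ⌊ y ⌋
⌊⌋-cong {x} {y} (p , q) = ⌊⌋-mono {x} {y} p , ⌊⌋-mono {y} {x} q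

⌊⌋-fraction : ∀ {w} → 0ℚ ℚ.≤ w → w ℚ.< 1ℚ → ⌊ fromℚ w ⌋ ≈ fromℚ 0ℚ
⌊⌋-fraction {w} 0≤w w<1 =
  (λ { q (_ , (k , refl , k≤w) , q<k) → ℚₚ.<-≤-trans q<k (below k (ℚₚ.≤-<-trans (fromℚ-cancel-≤ k≤w) w<1)) }) ,
  λ q q<0 → 0ℚ , (+0 , refl , fromℚ-mono 0≤w) , q<0
  where
  below : ∀ k → ℤ→ℚ k ℚ.< 1ℚ → ℤ→ℚ k ℚ.≤ 0ℚ
  below +0       _   = ℚₚ.≤-refl
  below +[1+ n ] k<1 = contradiction (ℚₚ.<-≤-trans k<1 (♯-mono {1} {suc n} (ℕ.s≤s ℕ.z≤n))) (ℚₚ.<-irrefl refl)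
  below -[1+ n ] _   = L.ℤ→ℚ-mono { -[1+ n ]} {+0} ℤ.-≤+

-- With upper bounds `u` and `v`, the box [a - η, u] × [b - η, v] contains the point (x, y); the
-- shift by η is needed because `a` and `b` need not lie strictly below. At each corner the product
-- is at least a b - η (u + v), which exceeds `q` for small η.
*-lower : ∀ x y {a b} → 0ℚ ℚ.≤ a → 0ℚ ℚ.≤ b → fromℚ a ≤ x → fromℚ b ≤ y → fromℚ (a ℚ.* b) ≤ x * y
*-lower x y {a} {b} 0≤a 0≤b a≤x b≤y q q<ab =
  cornerMin (a ℚ.- η) u (b ℚ.- η) v ,
  (a ℚ.- η , u , b ℚ.- η , v , (a≤x _ (less a) , ¬u◂x) , (b≤y _ (less b) , ¬v◂y) , refl) ,
  ℚₚ.<-≤-trans q<c (ℚₚ.⊓-glb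
    (ℚₚ.⊓-glb
      (≤-by-gap (0≤+ (0≤+ (L.*-0≤ 0≤η 0≤u-a) (L.*-0≤ 0≤η 0≤v-b)) (L.*-0≤ 0≤η 0≤η))
        (solve 5 (λ a b u v η → (a :- η) :* (b :- η) := (a :* b :- η :* (u :+ v)) :+ (η :* (u :- a) :+ η :* (v :- b) :+ η :* η)) refl a b u v η))
      (≤-by-gap (0≤+ (L.*-0≤ 0≤a 0≤v-b) (L.*-0≤ 0≤η 0≤u))
        (solve 5 (λ a b u v η → (a :- η) :* v := (a :* b :- η :* (u :+ v)) :+ (a :* (v :- b) :+ η :* u)) refl a b u v η)))
    (ℚₚ.⊓-glb
      (≤-by-gap (0≤+ (L.*-0≤ 0≤b 0≤u-a) (L.*-0≤ 0≤η 0≤v))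
        (solve 5 (λ a b u v η → u :* (b :- η) := (a :* b :- η :* (u :+ v)) :+ (b :* (u :- a) :+ η :* v)) refl a b u v η))
      (≤-by-gap (0≤+ (0≤+ (L.*-0≤ 0≤u-a 0≤v) (L.*-0≤ 0≤a 0≤v-b)) (L.*-0≤ 0≤η (0≤+ 0≤u 0≤v)))
        (solve 5 (λ a b u v η → u :* v := (a :* b :- η :* (u :+ v)) :+ ((u :- a) :* v :+ a :* (v :- b) :+ η :* (u :+ v))) refl a b u v η))))
  where
  u = proj₁ (ℝ.bounded x)
  v = proj₁ (ℝ.bounded y)
  ¬u◂x = proj₂ (ℝ.bounded x)
  ¬v◂y = proj₂ (ℝ.bounded y)
  a≤u = fromℚ≤⇒≤ x a≤x ¬u◂x
  b≤v = fromℚ≤⇒≤ y b≤y ¬v◂y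
  0≤u = ℚₚ.≤-trans 0≤a a≤u
  0≤v = ℚₚ.≤-trans 0≤b b≤v
  0≤u-a = 0≤- a≤u
  0≤v-b = 0≤- b≤v
  -- The summand 1 makes `K` positive and leaves η to spare: a b - η (u + v) equals `q + η`.
  K = u ℚ.+ v ℚ.+ 1ℚ
  0<K : 0ℚ ℚ.< K
  0<K = ℚₚ.+-mono-≤-< (0≤+ 0≤u 0≤v) L.0<1
  instance _ = ℚ.>-nonZero 0<K
  gap = a ℚ.* b ℚ.- q
  0<gap : 0ℚ ℚ.< gap
  0<gap = subst (ℚ._< gap) (ℚₚ.+-inverseʳ q) (ℚₚ.+-monoˡ-< (ℚ.- q) q<ab)
  η = gap ℚ.* ℚ.1/ K
  0<η : 0ℚ ℚ.< η
  0<η = L.*-0< 0<gap (L.1/-0< 0<K)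
  0≤η = ℚₚ.<⇒≤ 0<η
  less : ∀ a → a ℚ.- η ℚ.< a
  less a = subst (a ℚ.- η ℚ.<_) (ℚₚ.+-identityʳ a) (ℚₚ.+-monoʳ-< a (ℚₚ.neg-antimono-< 0<η))
  ηK≡gap : η ℚ.* K ≡ gap
  ηK≡gap = trans (ℚₚ.*-assoc gap (ℚ.1/ K) K) (trans (cong (gap ℚ.*_) (ℚₚ.*-inverseˡ K)) (ℚₚ.*-identityʳ gap))
  q<c : q ℚ.< a ℚ.* b ℚ.- η ℚ.* (u ℚ.+ v)
  q<c = subst₂ ℚ._<_ (ℚₚ.+-identityʳ q) (sym (begin
      a ℚ.* b ℚ.- η ℚ.* (u ℚ.+ v)                 ≡⟨ solve 5 (λ a b u v η → a :* b :- η :* (u :+ v) := a :* b :- η :* (u :+ v :+ con 1ℚ) :+ η) refl a b u v η ⟩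
      a ℚ.* b ℚ.- η ℚ.* K ℚ.+ η                   ≡⟨ cong (λ g → a ℚ.* b ℚ.- g ℚ.+ η) ηK≡gap ⟩
      a ℚ.* b ℚ.- gap ℚ.+ η                       ≡⟨ solve 3 (λ c q η → c :- (c :- q) :+ η := q :+ η) refl (a ℚ.* b) q η ⟩
      q ℚ.+ η                                     ∎)) (ℚₚ.+-monoʳ-< q 0<η)
    where open ≡-Reasoning

fromℚ-* : ∀ {a b} → 0ℚ ℚ.≤ a → 0ℚ ℚ.≤ b → fromℚ a * fromℚ b ≈ fromℚ (a ℚ.* b)
fromℚ-* {a} {b} 0≤a 0≤b =
  (λ { q (_ , (a₀ , a′ , b₀ , b′ , (a₀<a , ¬a′<a) , (b₀<b , ¬b′<b) , refl) , q<s) →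
       ℚₚ.<-≤-trans q<s (L.box-min (ℚₚ.<⇒≤ a₀<a) (ℚₚ.≮⇒≥ ¬a′<a) (ℚₚ.<⇒≤ b₀<b) (ℚₚ.≮⇒≥ ¬b′<b)) }) ,
  *-lower (fromℚ a) (fromℚ b) 0≤a 0≤b (fromℚ-mono ℚₚ.≤-refl) (fromℚ-mono ℚₚ.≤-refl)

-- Torus polynomials with rational coefficients

module _ {n : ℕ} (κ : Subset n → ℕ) {r : ℚ} (0≤r : 0ℚ ℚ.≤ r) (x : Cube n) where

  torus-sum : ∀ Ss → foldr (λ S acc → fromℚ (♯ (κ S) ℚ.* r) * fromℕ (monomial S x) + acc) 0ℝ Ss
              ≈ fromℚ (♯ (∑ Ss λ S → κ S ℕ.* monomial S x) ℚ.* r)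
  torus-sum []       = fromℚ-cong (sym (ℚₚ.*-zeroˡ r))
  torus-sum (S ∷ Ss) = ≈-trans {c * fromℚ m + acc} {fromℚ (c₀ ℚ.* m) + fromℚ a} {fromℚ _}
    (+-cong {c * fromℚ m} {fromℚ (c₀ ℚ.* m)} {acc} {fromℚ a}
      (fromℚ-* (L.*-0≤ (♯-0≤ (κ S)) 0≤r) (♯-0≤ (monomial S x))) (torus-sum Ss))
    (≈-trans {fromℚ (c₀ ℚ.* m) + fromℚ a} {fromℚ (c₀ ℚ.* m ℚ.+ a)} {fromℚ _}
      (fromℚ-+ (c₀ ℚ.* m) a) (fromℚ-cong eq))
    where
    c₀ = ♯ (κ S) ℚ.* r
    c = fromℚ c₀
    m = ♯ (monomial S x)
    s = ∑ Ss λ S → κ S ℕ.* monomial S x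
    a = ♯ s ℚ.* r
    acc = foldr (λ S acc → fromℚ (♯ (κ S) ℚ.* r) * fromℕ (monomial S x) + acc) 0ℝ Ss
    eq : c₀ ℚ.* m ℚ.+ a ≡ ♯ (κ S ℕ.* monomial S x ℕ.+ s) ℚ.* r
    eq = trans (solve 4 (λ k r m s → k :* r :* m :+ s :* r := (k :* m :+ s) :* r) refl (♯ (κ S)) r m (♯ s))
      (cong (ℚ._* r) (trans (cong (ℚ._+ ♯ s) (sym (♯-* (κ S) (monomial S x)))) (sym (♯-+ (κ S ℕ.* monomial S x) s))))

torus-value : ∀ {n d r} {F : Cube n → ℕ} (F≤d : HasDegree≤ d F) → 0ℚ ℚ.≤ r → ∀ x →
  evalTorus d (λ S → fromℚ (♯ (coefficient (HasDegree≤.terms F≤d) S) ℚ.* r)) x ≈ fromℚ (♯ (F x) ℚ.* r)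
torus-value {n} {d} {r} {F} (degree≤ terms small eval) 0≤r x =
  subst (λ v → evalTorus d (λ S → fromℚ (♯ (coefficient terms S) ℚ.* r)) x ≈ fromℚ (♯ v ℚ.* r))
    (trans (∑-coefficient d terms small (λ S → monomial S x)) (sym (eval x)))
    (torus-sum (coefficient terms) 0≤r x (filter (λ S → card S ℕₚ.≤? d) (bitVectors n)))

≈-shift : ∀ y {v b} k → y ≈ fromℚ v → b ≡ v ℚ.+ ℤ→ℚ k → fromℚ b ≈ y + fromℤ k
≈-shift y {v} k y≈v refl = ≈-trans {fromℚ (v ℚ.+ ℤ→ℚ k)} {fromℚ v + fromℤ k} {y + fromℤ k}
  (≈-sym {fromℚ v + fromℤ k} {fromℚ (v ℚ.+ ℤ→ℚ k)} (fromℚ-+ v (ℤ→ℚ k)))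
  (+-cong {fromℚ v} {y} {fromℤ k} {fromℤ k} (≈-sym {y} {fromℚ v} y≈v) (≈-refl {fromℤ k}))

-- The norm modulo 1 of small values

foldr-⊔-≤ : ∀ {A : Set} (g : A → ℝ) {z} (xs : List A) → 0ℝ ≤ z → (∀ x → g x ≤ z) →
            foldr (λ x m → g x ⊔ m) 0ℝ xs ≤ z
foldr-⊔-≤ g         []       0≤z g≤z = 0≤z
foldr-⊔-≤ g {z} (x ∷ xs) 0≤z g≤z =
  ⊔-lub {g x} {foldr (λ x m → g x ⊔ m) 0ℝ xs} {z} (g≤z x) (foldr-⊔-≤ g {z} xs 0≤z g≤z)

ι-small : ∀ z w → z ≈ fromℚ w → 0ℚ ℚ.≤ w ℚ.+ ½ → w ℚ.+ ½ ℚ.< 1ℚ → ι z ≈ fromℚ w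
ι-small z w z≈w 0≤w+½ w+½<1 =
  ≈-trans {ι z} {fromℚ w + - fromℚ 0ℚ} {fromℚ w}
    (+-cong {z} {fromℚ w} { - ⌊ z + fromℚ ½ ⌋} { - fromℚ 0ℚ} z≈w
      (neg-cong {⌊ z + fromℚ ½ ⌋} {fromℚ 0ℚ}
        (≈-trans {⌊ z + fromℚ ½ ⌋} {⌊ fromℚ (w ℚ.+ ½) ⌋} {fromℚ 0ℚ}
          (⌊⌋-cong {z + fromℚ ½} {fromℚ (w ℚ.+ ½)}
            (≈-trans {z + fromℚ ½} {fromℚ w + fromℚ ½} {fromℚ (w ℚ.+ ½)}
              (+-cong {z} {fromℚ w} {fromℚ ½} {fromℚ ½} z≈w (≈-refl {fromℚ ½})) (fromℚ-+ w ½)))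
          (⌊⌋-fraction 0≤w+½ w+½<1))))
    (≈-trans {fromℚ w + - fromℚ 0ℚ} {fromℚ w + fromℚ (ℚ.- 0ℚ)} {fromℚ w}
      (+-cong {fromℚ w} {fromℚ w} { - fromℚ 0ℚ} {fromℚ (ℚ.- 0ℚ)} (≈-refl {fromℚ w}) (fromℚ-neg 0ℚ))
      (≈-trans {fromℚ w + fromℚ (ℚ.- 0ℚ)} {fromℚ (w ℚ.+ ℚ.- 0ℚ)} {fromℚ w}
        (fromℚ-+ w (ℚ.- 0ℚ)) (fromℚ-cong (ℚₚ.+-identityʳ w))))

-- Since δ < 1/2, the number `w + ½` lies in [0, 1), so `w` is its own representative and no
-- reduction takes place.
∣mod1∣-≤ : ∀ z w {δ ε} → z ≈ fromℚ w → w ℚ.≤ δ → ℚ.- δ ℚ.≤ w → δ ℚ.< ½ → fromℚ δ ≤ ε → ∣ z mod1∣ ≤ ε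
∣mod1∣-≤ z w {δ} {ε} z≈w w≤δ -δ≤w δ<½ δ≤ε = ⊔-lub {ι z} { - ι z} {ε}
  (≤-trans {ι z} {fromℚ w} {ε} (proj₁ ι≈) (≤-trans {fromℚ w} {fromℚ δ} {ε} (fromℚ-mono w≤δ) δ≤ε))
  (≤-trans { - ι z} {fromℚ (ℚ.- w)} {ε}
    (proj₁ (≈-trans { - ι z} { - fromℚ w} {fromℚ (ℚ.- w)} (neg-cong {ι z} {fromℚ w} ι≈) (fromℚ-neg w)))
    (≤-trans {fromℚ (ℚ.- w)} {fromℚ δ} {ε} (fromℚ-mono (L.≤-neg-swap -δ≤w)) δ≤ε))
  where
  w+½<1 : w ℚ.+ ½ ℚ.< 1ℚ
  w+½<1 = ℚₚ.≤-<-trans (ℚₚ.+-monoˡ-≤ ½ w≤δ) (ℚₚ.+-monoˡ-< ½ δ<½)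
  0≤w+½ : 0ℚ ℚ.≤ w ℚ.+ ½
  0≤w+½ = ℚₚ.≤-trans (ℚₚ.+-monoˡ-≤ ½ (ℚₚ.<⇒≤ (ℚₚ.neg-antimono-< δ<½))) (ℚₚ.+-monoˡ-≤ ½ -δ≤w)
  ι≈ : ι z ≈ fromℚ w
  ι≈ = ι-small z w z≈w 0≤w+½ w+½<1

-- Dividing the integral inequalities of Close by 2 M E.
close-ℚ : ∀ {E M u b r s} → 0ℚ ℚ.≤ r → 0ℚ ℚ.≤ s → ♯ M ℚ.* r ≡ 1ℚ → ♯ E ℚ.* s ≡ 1ℚ → Close E M u b →
  let w = ♯ u ℚ.* r ℚ.- ♯ (bit b) ℚ.* ½ in w ℚ.≤ s × ℚ.- s ℚ.≤ w
close-ℚ {E} {M} {u} {b} {r} {s} 0≤r 0≤s Mr≡1 Es≡1 (upper , lower) =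
  subst₂ ℚ._≤_ (solve 2 (λ a b → a :+ (:- b) := a :- b) refl (♯ u ℚ.* r) h) (solve 2 (λ h s → h :+ s :+ (:- h) := s) refl h s)
    (ℚₚ.+-monoˡ-≤ (ℚ.- h) (subst₂ ℚ._≤_ left right (scaled upper))) ,
  subst₂ ℚ._≤_ (solve 2 (λ h s → h :+ (:- h :- s) := :- s) refl h s) (solve 3 (λ a h s → a :+ s :+ (:- h :- s) := a :- h) refl (♯ u ℚ.* r) h s)
    (ℚₚ.+-monoˡ-≤ (ℚ.- h ℚ.- s) (subst₂ ℚ._≤_ half≡ plus (scaled lower)))
  where
  h = ♯ (bit b) ℚ.* ½
  k = r ℚ.* s ℚ.* ½
  scaled : ∀ {x y} → x ℕ.≤ y → ♯ x ℚ.* k ℚ.≤ ♯ y ℚ.* k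
  scaled x≤y = L.*-monoʳ (L.*-0≤ (L.*-0≤ 0≤r 0≤s) L.0≤½) (♯-mono x≤y)
  e₁ : ♯ (2 ℕ.* (u ℕ.* E)) ≡ 2ℚ ℚ.* (♯ u ℚ.* ♯ E)
  e₁ = trans (♯-* 2 (u ℕ.* E)) (cong (2ℚ ℚ.*_) (♯-* u E))
  e₂ : ♯ (bit b ℕ.* (M ℕ.* E)) ≡ ♯ (bit b) ℚ.* (♯ M ℚ.* ♯ E)
  e₂ = trans (♯-* (bit b) (M ℕ.* E)) (cong (♯ (bit b) ℚ.*_) (♯-* M E))
  e₃ : ♯ (2 ℕ.* M) ≡ 2ℚ ℚ.* ♯ M
  e₃ = ♯-* 2 M
  uE : 2ℚ ℚ.* (♯ u ℚ.* ♯ E) ℚ.* k ≡ ♯ u ℚ.* r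
  uE = begin
    2ℚ ℚ.* (♯ u ℚ.* ♯ E) ℚ.* k         ≡⟨ solve 4 (λ u E r s → con 2ℚ :* (u :* E) :* (r :* s :* con ½) := u :* r :* (E :* s)) refl (♯ u) (♯ E) r s ⟩
    ♯ u ℚ.* r ℚ.* (♯ E ℚ.* s)          ≡⟨ cong (♯ u ℚ.* r ℚ.*_) Es≡1 ⟩
    ♯ u ℚ.* r ℚ.* 1ℚ                   ≡⟨ ℚₚ.*-identityʳ _ ⟩
    ♯ u ℚ.* r                          ∎
    where open ≡-Reasoning
  bME : ♯ (bit b) ℚ.* (♯ M ℚ.* ♯ E) ℚ.* k ≡ h
  bME = begin
    ♯ (bit b) ℚ.* (♯ M ℚ.* ♯ E) ℚ.* k         ≡⟨ solve 5 (λ b M E r s → b :* (M :* E) :* (r :* s :* con ½) := b :* con ½ :* ((M :* r) :* (E :* s))) refl (♯ (bit b)) (♯ M) (♯ E) r s ⟩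
    h ℚ.* ((♯ M ℚ.* r) ℚ.* (♯ E ℚ.* s))       ≡⟨ cong₂ (λ x y → h ℚ.* (x ℚ.* y)) Mr≡1 Es≡1 ⟩
    h ℚ.* 1ℚ                                  ≡⟨ ℚₚ.*-identityʳ h ⟩
    h                                         ∎
    where open ≡-Reasoning
  M2 : 2ℚ ℚ.* ♯ M ℚ.* k ≡ s
  M2 = begin
    2ℚ ℚ.* ♯ M ℚ.* k      ≡⟨ solve 3 (λ M r s → con 2ℚ :* M :* (r :* s :* con ½) := s :* (M :* r)) refl (♯ M) r s ⟩
    s ℚ.* (♯ M ℚ.* r)     ≡⟨ cong (s ℚ.*_) Mr≡1 ⟩
    s ℚ.* 1ℚ              ≡⟨ ℚₚ.*-identityʳ s ⟩
    s                     ∎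
    where open ≡-Reasoning
  left : ♯ (2 ℕ.* (u ℕ.* E)) ℚ.* k ≡ ♯ u ℚ.* r
  left = trans (cong (ℚ._* k) e₁) uE
  half≡ : ♯ (bit b ℕ.* (M ℕ.* E)) ℚ.* k ≡ h
  half≡ = trans (cong (ℚ._* k) e₂) bME
  right : ♯ (bit b ℕ.* (M ℕ.* E) ℕ.+ 2 ℕ.* M) ℚ.* k ≡ h ℚ.+ s
  right = trans (cong (ℚ._* k) (♯-+ (bit b ℕ.* (M ℕ.* E)) (2 ℕ.* M)))
    (trans (ℚₚ.*-distribʳ-+ k (♯ (bit b ℕ.* (M ℕ.* E))) (♯ (2 ℕ.* M))) (cong₂ ℚ._+_ half≡ (trans (cong (ℚ._* k) e₃) M2)))
  plus : ♯ (2 ℕ.* (u ℕ.* E) ℕ.+ 2 ℕ.* M) ℚ.* k ≡ ♯ u ℚ.* r ℚ.+ s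
  plus = trans (cong (ℚ._* k) (♯-+ (2 ℕ.* (u ℕ.* E)) (2 ℕ.* M)))
    (trans (ℚₚ.*-distribʳ-+ k (♯ (2 ℕ.* (u ℕ.* E))) (♯ (2 ℕ.* M))) (cong₂ ℚ._+_ left (trans (cong (ℚ._* k) e₃) M2)))

congruent⇒integer : ∀ {a b m r} .{{_ : ℕ.NonZero m}} → ♯ m ℚ.* r ≡ 1ℚ → a ≡ b [mod m ] →
  ∃[ k ] ♯ b ℚ.* r ≡ ♯ a ℚ.* r ℚ.+ ℤ→ℚ k
congruent⇒integer {a} {b} {m} {r} mr≡1 (sameRemainder a≡b) = k , (begin
  ♯ b ℚ.* r                                    ≡⟨ split b ⟩
  ♯ (b % m) ℚ.* r ℚ.+ ♯ (b / m)                ≡⟨ cong₂ (λ c d → ♯ c ℚ.* r ℚ.+ d) (sym a≡b) (trans (cong ℤ→ℚ integers) (sym (L.ℤ→ℚ-+ (+ (a / m)) k))) ⟩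
  ♯ (a % m) ℚ.* r ℚ.+ (♯ (a / m) ℚ.+ ℤ→ℚ k)    ≡⟨ ℚₚ.+-assoc (♯ (a % m) ℚ.* r) _ _ ⟨
  ♯ (a % m) ℚ.* r ℚ.+ ♯ (a / m) ℚ.+ ℤ→ℚ k      ≡⟨ cong (ℚ._+ ℤ→ℚ k) (split a) ⟨
  ♯ a ℚ.* r ℚ.+ ℤ→ℚ k                          ∎)
  where
  open ≡-Reasoning
  k = + (b / m) ℤ.- + (a / m)
  integers : + (b / m) ≡ + (a / m) ℤ.+ k
  integers = ℤ-Solver.solve 2 (λ a b → b ℤ-Solver.:= a ℤ-Solver.:+ (b ℤ-Solver.:- a)) refl (+ (a / m)) (+ (b / m))
  split : ∀ a → ♯ a ℚ.* r ≡ ♯ (a % m) ℚ.* r ℚ.+ ♯ (a / m)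
  split a = begin
    ♯ a ℚ.* r                                        ≡⟨ cong (λ c → ♯ c ℚ.* r) (m≡m%n+[m/n]*n a m) ⟩
    ♯ (a % m ℕ.+ a / m ℕ.* m) ℚ.* r                  ≡⟨ cong (ℚ._* r) (trans (♯-+ (a % m) _) (cong (♯ (a % m) ℚ.+_) (♯-* (a / m) m))) ⟩
    (♯ (a % m) ℚ.+ ♯ (a / m) ℚ.* ♯ m) ℚ.* r          ≡⟨ solve 4 (λ c q m r → (c :+ q :* m) :* r := c :* r :+ q :* (m :* r)) refl (♯ (a % m)) (♯ (a / m)) (♯ m) r ⟩
    ♯ (a % m) ℚ.* r ℚ.+ ♯ (a / m) ℚ.* (♯ m ℚ.* r)    ≡⟨ cong (λ e → ♯ (a % m) ℚ.* r ℚ.+ ♯ (a / m) ℚ.* e) mr≡1 ⟩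
    ♯ (a % m) ℚ.* r ℚ.+ ♯ (a / m) ℚ.* 1ℚ             ≡⟨ cong (♯ (a % m) ℚ.* r ℚ.+_) (ℚₚ.*-identityʳ (♯ (a / m))) ⟩
    ♯ (a % m) ℚ.* r ℚ.+ ♯ (a / m)                    ∎

module _ (p : ℕ) (p-prime : Prime p) where
  open CircuitApproximation p p-prime

  approximable : ∀ {n d E f ε δ} → Approximation {n} d E f → 0ℚ ℚ.≤ δ → ♯ E ℚ.* δ ≡ 1ℚ → δ ℚ.< ½ → fromℚ δ ≤ ε →
                 Approximable ε f d
  approximable {n} {d} {E} {f} {ε} {δ} A 0≤δ Eδ≡1 δ<½ δ≤ε = P , (coeff , isPolynomial) ,
    foldr-⊔-≤ (λ x → ∣ P x - half f x mod1∣) {ε} (bitVectors n)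
      (≤-trans {0ℝ} {fromℚ δ} {ε} (fromℚ-mono 0≤δ) δ≤ε) small
    where
    open Approximation A
    inverse = ♯-inverse modulus
    r     = proj₁ inverse
    0≤r   = ℚₚ.<⇒≤ (proj₁ (proj₂ inverse))
    Mr≡1  = proj₂ (proj₂ inverse)
    P : Cube n → 𝕋
    -- Built from the values instead of the polynomial: in ℝ/ℤ there is no difference, but these
    -- representatives are close to f / 2 as real numbers.
    P x = fromℚ (♯ (value x) ℚ.* r)
    coeff : Subset n → ℝ
    coeff S = fromℚ (♯ (coefficient (HasDegree≤.terms degree) S) ℚ.* r)
    isPolynomial : ∀ x → P x ≡₁ evalTorus d coeff x
    isPolynomial x =
      let k , eq = congruent⇒integer {r = r} Mr≡1 (congruent x)
      in k , ≈-shift (evalTorus d coeff x) k (torus-value {r = r} degree 0≤r x) eq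
    small : ∀ x → ∣ P x - half f x mod1∣ ≤ ε
    small x = ∣mod1∣-≤ (P x - half f x) w {δ} {ε} z≈w (proj₁ bounds) (proj₂ bounds) δ<½ δ≤ε
      where
      h = ♯ (bit (f x)) ℚ.* ½
      w = ♯ (value x) ℚ.* r ℚ.- h
      bounds = close-ℚ {E} {modulus} {value x} {f x} {r} {δ} 0≤r 0≤δ Mr≡1 Eδ≡1 (isClose x)
      z≈w : P x - half f x ≈ fromℚ w
      z≈w = ≈-trans {P x - half f x} {P x + fromℚ (ℚ.- h)} {fromℚ w}
        (+-cong {P x} {P x} { - half f x} {fromℚ (ℚ.- h)} (≈-refl {P x})
          (≈-trans { - half f x} { - fromℚ h} {fromℚ (ℚ.- h)}
            (neg-cong {half f x} {fromℚ h} (fromℚ-* (♯-0≤ (bit (f x))) L.0≤½)) (fromℚ-neg h)))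
        (fromℚ-+ (♯ (value x) ℚ.* r) (ℚ.- h))

-- Logarithms and powers

denominator-* : ∀ p → ♯ (↧ₙ p) ℚ.* p ≡ ℤ→ℚ (↥ p)
denominator-* p@(mkℚ k d _) = ℚₚ.toℚᵘ-injective (ℚᵘₚ.≃-trans (ℚₚ.toℚᵘ-homo-* (♯ (suc d)) p)
  (ℚᵘ.*≡* (trans (ℤₚ.*-identityʳ _) (trans (ℤₚ.*-comm (+ suc d) k)
    (cong (λ e → k ℤ.* + suc e) (sym (ℕₚ.+-identityʳ d)))))))

♯-cancel-≤ : ∀ {a b} → ♯ a ℚ.≤ ♯ b → a ℕ.≤ b
♯-cancel-≤ {a} {b} (ℚ.*≤* a≤b) = ℤₚ.drop‿+≤+ (subst₂ ℤ._≤_ (ℤₚ.*-identityʳ (+ a)) (ℤₚ.*-identityʳ (+ b)) a≤b)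

^-cancel-≤ : ∀ {x y} n → 0ℚ ℚ.≤ y → x ^ℚ suc n ℚ.≤ y ^ℚ suc n → x ℚ.≤ y
^-cancel-≤ n 0≤y x^≤y^ = ℚₚ.≮⇒≥ λ y<x → ℚₚ.<-irrefl refl (ℚₚ.<-≤-trans (L.^-mono-< n 0≤y y<x) x^≤y^)

^-swap : ∀ x m n → (x ^ℚ m) ^ℚ n ≡ (x ^ℚ n) ^ℚ m
^-swap x m n = trans (Exp.^-assocʳ x m n) (trans (cong (x ^ℚ_) (ℕₚ.*-comm m n)) (sym (Exp.^-assocʳ x n m)))

-- Raising to the power `b` reduces the claim to a comparison of integer exponents; a negative `t`
-- is trivial because `1ℚ ≤ s`. The cut of `log₂` refers to `t` in lowest terms, whereas here any
-- fraction a / b ≥ t can serve as evidence.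
2^-num≤^-den : ∀ t a b .{{_ : ℕ.NonZero b}} {s} → 1ℚ ℚ.≤ s → 2ℚ ^ℚ a ℚ.≤ s ^ℚ b → t ℚ.* ♯ b ℚ.≤ ♯ a →
             2^ (↥ t) ℚ.≤ s ^ℚ (↧ₙ t)
2^-num≤^-den t@(mkℚ -[1+ n ] d _) a b 1≤s _ _ = ℚₚ.≤-trans (L.^≤1 (suc n) L.0≤½ L.½≤1) (L.1≤^ (suc d) 1≤s)
2^-num≤^-den t@(mkℚ (+ n) d _) a b@(suc b′) {s} 1≤s 2^a≤s^b tb≤a =
  ^-cancel-≤ b′ (L.^-0≤ (suc d) 0≤s) (begin
    (2ℚ ^ℚ n) ^ℚ b         ≡⟨ Exp.^-assocʳ 2ℚ n b ⟩
    2ℚ ^ℚ (n ℕ.* b)        ≤⟨ L.2^-mono nb≤ad ⟩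
    2ℚ ^ℚ (a ℕ.* suc d)    ≡⟨ Exp.^-assocʳ 2ℚ a (suc d) ⟨
    (2ℚ ^ℚ a) ^ℚ suc d     ≤⟨ L.^-mono (suc d) (L.^-0≤ a (ℚₚ.≤-trans L.0≤1 L.1≤2)) 2^a≤s^b ⟩
    (s ^ℚ b) ^ℚ suc d      ≡⟨ ^-swap s b (suc d) ⟩
    (s ^ℚ suc d) ^ℚ b      ∎)
  where
  open ℚₚ.≤-Reasoning
  0≤s = ℚₚ.≤-trans L.0≤1 1≤s
  nb≤ad : n ℕ.* b ℕ.≤ a ℕ.* suc d
  nb≤ad = ♯-cancel-≤ (begin
    ♯ (n ℕ.* b)                 ≡⟨ ♯-* n b ⟩
    ♯ n ℚ.* ♯ b                 ≡⟨ cong (ℚ._* ♯ b) (denominator-* t) ⟨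
    ♯ (suc d) ℚ.* t ℚ.* ♯ b     ≡⟨ ℚₚ.*-assoc (♯ (suc d)) t (♯ b) ⟩
    ♯ (suc d) ℚ.* (t ℚ.* ♯ b)   ≤⟨ L.*-monoˡ (♯-0≤ (suc d)) tb≤a ⟩
    ♯ (suc d) ℚ.* ♯ a           ≡⟨ ℚₚ.*-comm (♯ (suc d)) (♯ a) ⟩
    ♯ a ℚ.* ♯ (suc d)           ≡⟨ ♯-* a (suc d) ⟨
    ♯ (a ℕ.* suc d)             ∎)

log₂-lower : ∀ y 0<y t a b .{{_ : ℕ.NonZero b}} s → s ◂ y → 1ℚ ℚ.≤ s → 2ℚ ^ℚ a ℚ.≤ s ^ℚ b → t ℚ.* ♯ b ℚ.≤ ♯ a →
             fromℚ t ≤ log₂ y 0<y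
log₂-lower y 0<y t a b s s◂y 1≤s 2^a≤s^b tb≤a q q<t =
  t , (s , s◂y , ℚₚ.<-≤-trans L.0<1 1≤s , 2^-num≤^-den t a b 1≤s 2^a≤s^b tb≤a) , q<t

exp₂-lower : ∀ y k → ♯ k ◂ y → fromℚ (2ℚ ^ℚ k) ≤ exp₂ y
exp₂-lower y k k◂y q q<2^k = 2ℚ ^ℚ k ,
  (L.^-0< k (ℚₚ.<-trans L.0<1 L.1<2) , ♯ k , k◂y , ℚₚ.≤-reflexive (ℚₚ.*-identityʳ _)) , q<2^k

exp₂-nonneg : ∀ y → 0ℝ ≤ exp₂ y
exp₂-nonneg y q q<0 =
  let t , t◂y = ℝ.inhabited y
      m = suc ℤ.∣ ↥ t ∣
      0<½^m = L.^-0< m (ℚₚ.positive⁻¹ ½)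
  in ½ ^ℚ m , (0<½^m , t , t◂y ,
       ℚₚ.≤-trans (L.^-suc≤ (ℕ.pred (↧ₙ t)) (L.^-0≤ m L.0≤½) (L.^≤1 m L.0≤½ L.½≤1)) (L.½^≤2^ (↥ t))) ,
     ℚₚ.<-trans q<0 0<½^m

recip-lower : ∀ ε 0<ε k → ¬ (½ ^ℚ k ◂ ε) → fromℚ (2ℚ ^ℚ k) ≤ recip ε 0<ε
recip-lower ε 0<ε k ¬◂ q q<2^k = 2ℚ ^ℚ k ,
  (½ ^ℚ k , ¬◂ , ℚₚ.≤-reflexive (trans (ℚₚ.*-comm (2ℚ ^ℚ k) (½ ^ℚ k)) (L.½^*2^ k))) , q<2^k

2^ℚ≡♯2^ : ∀ k → 2ℚ ^ℚ k ≡ ♯ (2 ℕ.^ k)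
2^ℚ≡♯2^ zero    = refl
2^ℚ≡♯2^ (suc k) = trans (cong (2ℚ ℚ.*_) (2^ℚ≡♯2^ k)) (sym (♯-* 2 (2 ℕ.^ k)))

divide-lower : ∀ n ε 0<ε λ′ k → 2 ℕ.^ λ′ ℕ.≤ n → ¬ (½ ^ℚ k ◂ ε) →
               fromℚ (2ℚ ^ℚ (λ′ ℕ.+ k)) ≤ divide (fromℕ n) ε 0<ε
divide-lower n ε 0<ε λ′ k 2^≤n ¬◂ =
  subst (λ v → fromℚ v ≤ divide (fromℕ n) ε 0<ε) (sym (Exp.^-homo-* 2ℚ λ′ k))
    (*-lower (fromℕ n) (recip ε 0<ε) (0≤2^ λ′) (0≤2^ k)
      (fromℚ-mono (subst (ℚ._≤ ♯ n) (sym (2^ℚ≡♯2^ λ′)) (♯-mono 2^≤n))) (recip-lower ε 0<ε k ¬◂))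
  where
  0≤2^ : ∀ k → 0ℚ ℚ.≤ 2ℚ ^ℚ k
  0≤2^ k = L.^-0≤ k (ℚₚ.≤-trans L.0≤1 L.1≤2)

3ℚ : ℚ
3ℚ = ♯ 3

-- log₂ y > B + 5/4 because 3 · 2 ^ B < y and 2 ^ (3/2) < 3.
log₂-large : ∀ y 0<y B → fromℚ (2ℚ ^ℚ (2 ℕ.+ B)) ≤ y → (♯ B ℚ.+ (+ 5 ℚ./ 4)) ◂ log₂ y 0<y
log₂-large y 0<y B large =
  log₂-lower y 0<y t (2 ℕ.* B ℕ.+ 3) 2 s (large s s<) 1≤s powers (ℚₚ.≤-reflexive tb≡a) (♯ B ℚ.+ (+ 5 ℚ./ 4)) (ℚₚ.+-monoʳ-< (♯ B) 5/4<3/2)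
  where
  open ℚₚ.≤-Reasoning
  t = ♯ B ℚ.+ (+ 3 ℚ./ 2)
  5/4<3/2 : + 5 ℚ./ 4 ℚ.< + 3 ℚ./ 2
  5/4<3/2 = ℚ.*<* (ℤ.+<+ (ℕₚ.<ᵇ⇒< 10 12 _))
  3<4 : 3ℚ ℚ.< 2ℚ ℚ.* 2ℚ
  3<4 = ℚ.*<* (ℤ.+<+ (ℕₚ.<ᵇ⇒< 3 4 _))
  P = 2ℚ ^ℚ B
  s = 3ℚ ℚ.* P
  0<P : 0ℚ ℚ.< P
  0<P = L.^-0< B (ℚₚ.<-trans L.0<1 L.1<2)
  s< : s ℚ.< 2ℚ ^ℚ (2 ℕ.+ B)
  s< = subst (s ℚ.<_) (ℚₚ.*-assoc 2ℚ 2ℚ P) (L.*-mono-<ʳ 0<P 3<4)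
  1≤s : 1ℚ ℚ.≤ s
  1≤s = subst (ℚ._≤ s) (ℚₚ.*-identityˡ 1ℚ) (L.*-mono (♯-0≤ 3) (♯-mono {1} {3} (ℕ.s≤s ℕ.z≤n)) L.0≤1 (L.1≤^ B L.1≤2))
  tb≡a : t ℚ.* ♯ 2 ≡ ♯ (2 ℕ.* B ℕ.+ 3)
  tb≡a = trans (solve 1 (λ B → (B :+ con (+ 3 ℚ./ 2)) :* con 2ℚ := con 2ℚ :* B :+ con 3ℚ) refl (♯ B))
    (sym (trans (♯-+ (2 ℕ.* B) 3) (cong (ℚ._+ 3ℚ) (♯-* 2 B))))
  powers : 2ℚ ^ℚ (2 ℕ.* B ℕ.+ 3) ℚ.≤ s ^ℚ 2
  powers = begin
    2ℚ ^ℚ (2 ℕ.* B ℕ.+ 3)            ≡⟨ Exp.^-homo-* 2ℚ (2 ℕ.* B) 3 ⟩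
    2ℚ ^ℚ (2 ℕ.* B) ℚ.* ♯ 8          ≡⟨ cong (λ k → 2ℚ ^ℚ k ℚ.* ♯ 8) (ℕₚ.*-comm 2 B) ⟩
    2ℚ ^ℚ (B ℕ.* 2) ℚ.* ♯ 8          ≡⟨ cong (ℚ._* ♯ 8) (Exp.^-assocʳ 2ℚ B 2) ⟨
    P ^ℚ 2 ℚ.* ♯ 8                   ≤⟨ L.*-monoˡ (L.^-0≤ 2 (ℚₚ.<⇒≤ 0<P)) (♯-mono {8} {9} (ℕₚ.n≤1+n 8)) ⟩
    P ^ℚ 2 ℚ.* ♯ 9                   ≡⟨ solve 1 (λ P → P :* (P :* con 1ℚ) :* con (♯ 9) := con 3ℚ :* P :* ((con 3ℚ :* P) :* con 1ℚ)) refl P ⟩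
    s ^ℚ 2                           ∎

-- With s = B + 5/4 we have s ^ 9 ≥ s (5/4) ^ 8 ≥ 24/5 s ≥ 2 (B + 3).
log₂-log₂-large : ∀ y 0<y B β → (♯ B ℚ.+ (+ 5 ℚ./ 4)) ◂ y → 2 ℕ.^ β ℕ.≤ 2 ℕ.* (3 ℕ.+ B) →
                  fromℚ (♯ β ℚ.* (+ 1 ℚ./ 9)) ≤ log₂ y 0<y
log₂-log₂-large y 0<y B β s◂y 2^β≤ =
  log₂-lower y 0<y (♯ β ℚ.* (+ 1 ℚ./ 9)) β 9 s s◂y 1≤s powers
    (ℚₚ.≤-reflexive (solve 1 (λ β → β :* con (+ 1 ℚ./ 9) :* con (♯ 9) := β) refl (♯ β)))
  where
  open ℚₚ.≤-Reasoning
  5/4 = + 5 ℚ./ 4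
  24/5 = + 24 ℚ./ 5
  s = ♯ B ℚ.+ 5/4
  5/4≤s : 5/4 ℚ.≤ s
  5/4≤s = subst (ℚ._≤ s) (ℚₚ.+-identityˡ 5/4) (ℚₚ.+-monoˡ-≤ 5/4 (♯-0≤ B))
  1≤5/4 : 1ℚ ℚ.≤ 5/4
  1≤5/4 = ℚ.*≤* (ℤ.+≤+ (ℕₚ.≤ᵇ⇒≤ 4 5 _))
  1≤s = ℚₚ.≤-trans 1≤5/4 5/4≤s
  0≤5/4 = ℚₚ.≤-trans L.0≤1 1≤5/4
  0≤s = ℚₚ.≤-trans L.0≤1 1≤s
  eighth : 24/5 ℚ.≤ 5/4 ^ℚ 8
  eighth = ℚₚ.≤ᵇ⇒≤ _
  powers : 2ℚ ^ℚ β ℚ.≤ s ^ℚ 9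
  powers = begin
    2ℚ ^ℚ β                          ≡⟨ 2^ℚ≡♯2^ β ⟩
    ♯ (2 ℕ.^ β)                      ≤⟨ ♯-mono 2^β≤ ⟩
    ♯ (2 ℕ.* (3 ℕ.+ B))              ≡⟨ trans (♯-* 2 (3 ℕ.+ B)) (cong (2ℚ ℚ.*_) (♯-+ 3 B)) ⟩
    2ℚ ℚ.* (3ℚ ℚ.+ ♯ B)              ≤⟨ ≤-by-gap (L.*-0≤ (ℚₚ.nonNegative⁻¹ (+ 14 ℚ./ 5)) (♯-0≤ B))
                                          (solve 1 (λ B → (B :+ con 5/4) :* con 24/5 := con 2ℚ :* (con 3ℚ :+ B) :+ con (+ 14 ℚ./ 5) :* B) refl (♯ B)) ⟩
    s ℚ.* 24/5                       ≤⟨ L.*-monoˡ 0≤s (ℚₚ.≤-trans eighth (L.^-mono 8 0≤5/4 5/4≤s)) ⟩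
    s ^ℚ 9                           ∎

module _ (n : ℕ) (1≤n : 1 ℕ.≤ n) (ε : ℝ) (0<ε : 0ℝ < ε) (ε<1 : ε < 1ℝ) where

  polylog-nonneg : ∀ c → 0ℝ ≤ polylog (fromℕ c) n 1≤n ε 0<ε ε<1
  polylog-nonneg c = ≤-trans {0ℝ} {fromℚ (♯ c ℚ.* 0ℚ)} {polylog (fromℕ c) n 1≤n ε 0<ε ε<1}
    (fromℚ-mono (ℚₚ.≤-reflexive (sym (ℚₚ.*-zeroʳ (♯ c)))))
    (*-lower (fromℕ c) power (♯-0≤ c) ℚₚ.≤-refl (fromℚ-mono {♯ c} ℚₚ.≤-refl)
      (exp₂-nonneg (fromℕ c * log₂ log 0<log)))
    where
    y = divide (fromℕ n) ε 0<ε
    1<y = 1<divide n 1≤n ε 0<ε ε<1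
    log = log₂ y (1<⇒0< {y} 1<y)
    0<log = 0<log₂ y 1<y
    power = pow log 0<log (fromℕ c)

  polylog-lower : ∀ λ′ k B β A → 2 ℕ.^ λ′ ℕ.≤ n → ¬ (½ ^ℚ k ◂ ε) → λ′ ℕ.+ k ≡ 2 ℕ.+ B →
    1 ℕ.≤ β → 2 ℕ.^ β ℕ.≤ 2 ℕ.* (3 ℕ.+ B) →
    fromℕ (2 ℕ.^ (A ℕ.* β)) ≤ polylog (fromℕ (9 ℕ.* suc A)) n 1≤n ε 0<ε ε<1
  polylog-lower λ′ k B β A 2^≤n ¬◂ λ+k≡2+B 1≤β 2^β≤ =
    ≤-trans {fromℕ (2 ℕ.^ (A ℕ.* β))} {fromℚ (♯ c ℚ.* 2ℚ ^ℚ (A ℕ.* β))} {polylog (fromℕ c) n 1≤n ε 0<ε ε<1}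
      (fromℚ-mono (ℚₚ.≤-trans (ℚₚ.≤-reflexive (trans (sym (2^ℚ≡♯2^ (A ℕ.* β))) (sym (ℚₚ.*-identityˡ _))))
        (L.*-monoʳ (0≤2^ (A ℕ.* β)) (♯-mono {1} {c} (ℕ.s≤s ℕ.z≤n)))))
      (*-lower (fromℕ c) (exp₂ (fromℕ c * loglog)) (♯-0≤ c) (0≤2^ (A ℕ.* β)) (fromℚ-mono {♯ c} ℚₚ.≤-refl)
        (exp₂-lower (fromℕ c * loglog) (A ℕ.* β) (c*loglog (♯ (A ℕ.* β)) strict)))
    where
    -- The 9 cancels the loss in log log (n / ε) ≥ β / 9. The successor leaves a surplus of β ≥ 1,
    -- as `exp₂-lower` asks for an exponent strictly inside the cut.
    c = 9 ℕ.* suc A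
    y = divide (fromℕ n) ε 0<ε
    1<y = 1<divide n 1≤n ε 0<ε ε<1
    log = log₂ y (1<⇒0< {y} 1<y)
    0<log = 0<log₂ y 1<y
    loglog = log₂ log 0<log
    0≤2^ : ∀ k → 0ℚ ℚ.≤ 2ℚ ^ℚ k
    0≤2^ k = L.^-0≤ k (ℚₚ.≤-trans L.0≤1 L.1≤2)
    t = ♯ β ℚ.* (+ 1 ℚ./ 9)
    loglog-large : fromℚ t ≤ loglog
    loglog-large = log₂-log₂-large log 0<log B β
      (log₂-large y (1<⇒0< {y} 1<y) B
        (subst (λ m → fromℚ (2ℚ ^ℚ m) ≤ y) λ+k≡2+B (divide-lower n ε 0<ε λ′ k 2^≤n ¬◂)))
      2^β≤
    c*loglog : fromℚ (♯ c ℚ.* t) ≤ fromℕ c * loglog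
    c*loglog = *-lower (fromℕ c) loglog (♯-0≤ c) (L.*-0≤ (♯-0≤ β) (ℚₚ.nonNegative⁻¹ (+ 1 ℚ./ 9)))
      (fromℚ-mono {♯ c} ℚₚ.≤-refl) loglog-large
    ct≡ : ♯ c ℚ.* t ≡ ♯ β ℚ.+ ♯ (A ℕ.* β)
    ct≡ = begin
      ♯ c ℚ.* t                                ≡⟨ cong (ℚ._* t) (♯-* 9 (suc A)) ⟩
      ♯ 9 ℚ.* ♯ (suc A) ℚ.* t                  ≡⟨ solve 2 (λ a β → con (♯ 9) :* a :* (β :* con (+ 1 ℚ./ 9)) := a :* β) refl (♯ (suc A)) (♯ β) ⟩
      ♯ (suc A) ℚ.* ♯ β                        ≡⟨ ♯-* (suc A) β ⟨
      ♯ (β ℕ.+ A ℕ.* β)                        ≡⟨ ♯-+ β (A ℕ.* β) ⟩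
      ♯ β ℚ.+ ♯ (A ℕ.* β)                      ∎
      where open ≡-Reasoning
    strict : ♯ (A ℕ.* β) ℚ.< ♯ c ℚ.* t
    strict = subst₂ ℚ._<_ (ℚₚ.+-identityˡ _) (sym ct≡)
      (ℚₚ.+-monoˡ-< (♯ (A ℕ.* β)) (ℚₚ.<-≤-trans L.0<1 (♯-mono 1≤β)))

-- The least degree, the scale of ε, and the conclusion

least : ExcludedMiddle (lsuc 0ℓ) → ∀ {P : ℕ → Set₁} d → P d → Σ[ m ∈ ℕ ] m ℕ.≤ d × P m × (∀ j → P j → m ℕ.≤ j)
least em zero    P0 = 0 , ℕ.z≤n , P0 , λ _ _ → ℕ.z≤n
least em {P} (suc d) Pd with em {P 0}
... | yes P0 = 0 , ℕ.z≤n , P0 , λ _ _ → ℕ.z≤n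
... | no ¬P0 =
  let m , m≤d , Pm , minimal = least em {λ j → P (suc j)} d Pd
  in suc m , ℕ.s≤s m≤d , Pm , λ { zero P0 → contradiction P0 ¬P0 ; (suc j) Pj → ℕ.s≤s (minimal j Pj) }

½^-antitone : ∀ {j k} → j ℕ.≤ k → ½ ^ℚ k ℚ.≤ ½ ^ℚ j
½^-antitone {k = k} ℕ.z≤n       = L.^≤1 k L.0≤½ L.½≤1
½^-antitone         (ℕ.s≤s j≤k) = L.*-monoˡ L.0≤½ (½^-antitone j≤k)

½^<½ : ∀ k → ½ ^ℚ (2 ℕ.+ k) ℚ.< ½
½^<½ k = ℚₚ.≤-<-trans (½^-antitone (ℕₚ.m≤m+n 2 k)) (ℚ.*<* (ℤ.+<+ (ℕₚ.<ᵇ⇒< 2 4 _)))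

♯2^*½^ : ∀ k → ♯ (2 ℕ.^ k) ℚ.* ½ ^ℚ k ≡ 1ℚ
♯2^*½^ k = trans (cong (ℚ._* ½ ^ℚ k) (sym (2^ℚ≡♯2^ k))) (trans (ℚₚ.*-comm (2ℚ ^ℚ k) (½ ^ℚ k)) (L.½^*2^ k))

-- Take the least i with `½ ^ℚ i ◂ ε`, which exists by the Archimedean property. The assumption ε ≤
-- 1/4 excludes i ≤ 2, and minimality gives the failure at i - 1.
dyadic-ε : ExcludedMiddle (lsuc 0ℓ) → ∀ ε → 0ℝ < ε → ¬ (½ ^ℚ 2 ◂ ε) →
           Σ[ k ∈ ℕ ] ½ ^ℚ (3 ℕ.+ k) ◂ ε × ¬ (½ ^ℚ (2 ℕ.+ k) ◂ ε)
dyadic-ε em ε 0<ε ε≤¼ with 0<⇒witness ε 0<ε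
... | r , 0<r , r◂ε with L.archimedean 0<r
...   | j , ½^j≤r with least em {λ i → Lift (lsuc 0ℓ) (½ ^ℚ i ◂ ε)} (suc j) (lift (◂-down ε ½^j≤r r◂ε))
...     | zero , _ , lift ◂ε , _ = contradiction (◂-down ε (½^-antitone {0} {2} ℕ.z≤n) ◂ε) ε≤¼
...     | suc zero , _ , lift ◂ε , _ = contradiction (◂-down ε (½^-antitone {1} {2} (ℕ.s≤s ℕ.z≤n)) ◂ε) ε≤¼
...     | suc (suc zero) , _ , lift ◂ε , _ = contradiction ◂ε ε≤¼
...     | suc (suc (suc k)) , _ , lift ◂ε , minimal =
  k , ◂ε , λ ◂ε′ → ℕₚ.<-irrefl refl (minimal (2 ℕ.+ k) (lift ◂ε′))

-- Approximability in a given degree quantifies over real coefficients, so excluded middle is used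
-- to find the least degree; an upper bound on any admissible degree passes to it.
toroidalDegree : ExcludedMiddle (lsuc 0ℓ) → ∀ {n} ε (f : BooleanFunction n) d {R} → Approximable ε f d → fromℕ d ≤ R →
                 Σ[ m ∈ ℕ ] IsToroidalDegree ε f m × fromℕ m ≤ R
toroidalDegree em ε f d {R} approx d≤R =
  let m , m≤d , approx′ , minimal = least em {Approximable ε f} d approx
  in m , (approx′ , minimal) , ≤-trans {fromℕ m} {fromℕ d} {R} (fromℚ-mono (♯-mono m≤d)) d≤R

module _ (p : ℕ) (p-prime : Prime p) where
  open CircuitApproximation p p-prime

  -- The constant 1/4 is at distance 1/4 from both 0 and 1/2.
  quarter : ∀ {n} (f : BooleanFunction n) → Approximation 0 4 f
  quarter f = record
    { modulus   = 4
    ; poly      = λ _ → 1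
    ; degree    = degree-const 1
    ; value     = λ _ → 1
    ; congruent = λ _ → mod-refl
    ; isClose   = λ x → close¼ (f x)
    }
    where
    close¼ : ∀ b → Close 4 4 1 b
    close¼ false = ℕₚ.≤-refl , ℕ.z≤n
    close¼ true  = ℕₚ.m≤m+n 8 16 , ℕₚ.≤-refl

corollary2p6 : ExcludedMiddle (lsuc 0ℓ) →
    ∀ (p : ℕ) → Prime p →
    ∀ (f : Family) → AC⁰[ p ] f →
    Σ[ C ∈ ℝ ] 0ℝ < C ×
    (∀ (n : ℕ) (1≤n : 1 ℕ.≤ n) (ε : ℝ) (0<ε : 0ℝ < ε) (ε<1 : ε < 1ℝ) →
    Σ[ d ∈ ℕ ] IsToroidalDegree ε (f n) d ×
    fromℕ d ≤ polylog C n 1≤n ε 0<ε ε<1)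
corollary2p6 em p p-prime f (ℓ , s , circuits) =
  fromℕ (9 ℕ.* suc A) , (0ℚ , ℚₚ.<-irrefl refl , ♯-0< (9 ℕ.* suc A)) ,
  λ n 1≤n ε 0<ε ε<1 → cases n 1≤n ε 0<ε ε<1 em
  where
  A = degreeExponent p ℓ (3 ℕ.+ sum s ℕ.+ length s)

  module _ (n : ℕ) (1≤n : 1 ℕ.≤ n) (ε : ℝ) (0<ε : 0ℝ < ε) (ε<1 : ε < 1ℝ) where
    R : ℝ
    R = polylog (fromℕ (9 ℕ.* suc A)) n 1≤n ε 0<ε ε<1

    Goal : Set₁
    Goal = Σ[ d ∈ ℕ ] IsToroidalDegree ε (f n) d × fromℕ d ≤ R

    large-ε : ½ ^ℚ 2 ◂ ε → Goal
    large-ε ¼◂ε = toroidalDegree em ε (f n) 0 {R}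
      (approximable p p-prime {ε = ε} {½ ^ℚ 2} (quarter p p-prime (f n)) (L.^-0≤ 2 L.0≤½) (♯2^*½^ 2) (½^<½ 0) (◂⇒fromℚ≤ ε ¼◂ε))
      (polylog-nonneg n 1≤n ε 0<ε ε<1 (9 ℕ.* suc A))

    small-ε : ∀ k → ½ ^ℚ (3 ℕ.+ k) ◂ ε → ¬ (½ ^ℚ (2 ℕ.+ k) ◂ ε) →
              ∀ λ′ → 2 ℕ.^ λ′ ℕ.≤ n → n ℕ.< 2 ℕ.^ suc λ′ → Goal
    small-ε k ◂ε ¬◂ε λ′ 2^≤n n< = toroidalDegree em ε (f n) d {R}
        (approximable p p-prime {ε = ε} {½ ^ℚ e} approx (L.^-0≤ e L.0≤½) (♯2^*½^ e) (½^<½ (suc k)) (◂⇒fromℚ≤ ε ◂ε))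
        (≤-trans {fromℕ d} {fromℕ (2 ℕ.^ (A ℕ.* β))} {R}
          (fromℚ-mono (♯-mono (degree-bound p ℓ β (ℕ.s≤s ℕ.z≤n) (ℕₚ.<⇒≤ (proj₂ (proj₂ dyadic-b))))))
          (polylog-lower n 1≤n ε 0<ε ε<1 λ′ (2 ℕ.+ k) (λ′ ℕ.+ k) β A 2^≤n ¬◂ε shift (ℕ.s≤s ℕ.z≤n)
            (ℕₚ.*-monoʳ-≤ 2 (proj₁ (proj₂ dyadic-b)))))
      where
      open Parameters s λ′ k
      instance
        n≢0 : ℕ.NonZero n
        n≢0 = ℕ.>-nonZero 1≤n
      dyadic-b = dyadic b (ℕ.s≤s ℕ.z≤n)
      -- One more than the dyadic exponent of `b`: then `b ≤ 2 ^ β` bounds the degree from above,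
      -- while `2 ^ β ≤ 2 * b` lets β be bounded by log log (n / ε).
      β = suc (proj₁ dyadic-b)
      d = suc κ ℕ.* (suc κ ℕ.* (ℕ.pred p ℕ.* (t ℕ.* ℕ.pred p) ℕ.^ ℓ))
      shift : λ′ ℕ.+ (2 ℕ.+ k) ≡ 2 ℕ.+ (λ′ ℕ.+ k)
      shift = trans (ℕₚ.+-suc λ′ (suc k)) (cong suc (ℕₚ.+-suc λ′ k))
      approx : CircuitApproximation.Approximation p p-prime d (2 ℕ.^ e) (f n)
      approx =
        let m , C , out , m≤ , shallow , computes = circuits n 1≤n
        in CircuitApproximation.approximation p p-prime t C out (f n) computes ℓ shallow (2 ℕ.^ e) κ
             {{ℕₚ.m^n≢0 2 e}} (enough-tests (ℕₚ.<⇒≤ n<) m≤)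
             (large-modulus (ModPrime.1<p p p-prime) (ℕₚ.<⇒≤ n<))

    cases : Dec (Lift (lsuc 0ℓ) (½ ^ℚ 2 ◂ ε)) → Goal
    cases (yes (lift ¼◂ε)) = large-ε ¼◂ε
    cases (no ¬¼◂ε)        =
      let k , ◂ε , ¬◂ε = dyadic-ε em ε 0<ε (λ ¼◂ε → ¬¼◂ε (lift ¼◂ε))
          λ′ , 2^≤n , n< = dyadic n 1≤n
      in small-ε k ◂ε ¬◂ε λ′ 2^≤n n<
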